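{- For integers $p,m\ge1$, \begin{align*} &\sum_{i=1}^m\zeta^\star(p+1,\{1\}_{i-1},2,\{1\}_{m-i})+\zeta^\star(p+2,\{1\}_m)-\sum_{i=0}^{m-1}\zeta(m-i+1)\,\zeta^\star(p+1,\{1\}_i)\\ &=\sum_{i=1}^{p-1}\sum_{j=1}^{p-i}(-1)^{i+j}\zeta(p+2-i-j)\,\zeta(m+1,\{1\}_{i+j-1})+(-1)^{p+1}p(m+1)\,\zeta(m+2,\{1\}_p)\\ &\quad+(-1)^{p+1}p\sum_{i=0}^{p-1}\zeta(m+1,\{1\}_i,2,\{1\}_{p-1-i})-(-1)^{p+1}\zeta(m+1,\{1\}_{p-1},2). \end{align*}
   Context: For positive integers $s_1\ge2,s_2,\dots,s_r$: $\zeta(s_1,\dots,s_r)=\sum_{n_1>n_2>\cdots>n_r\ge1}n_1^{ -s_1}\cdots n_r^{ -s_r}$ and $\zeta^\star(s_1,\dots,s_r)=\sum_{n_1\ge n_2\ge\cdots\ge n_r\ge1}n_1^{ -s_1}\cdots n_r^{ -s_r}$; single-argument values are Riemann zeta values. $\{1\}_j$ denotes $j$ consecutive arguments equal to $1$ (none if $j=0$). Empty sums are zero. -}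

module Defs where

open import Data.Nat using (ℕ; zero; suc; _+_; _∸_)
open import Data.Integer using (+_)
open import Data.Rational using (ℚ; 0ℚ; 1ℚ; _/_; _*_; -_)
import Data.Rational as Q
open import Data.List using (List; []; _∷_; replicate)

-- 1 / n^s as a rational (value at n = 0 is irrelevant; it is never used)
invPow : ℕ → ℕ → ℚ
invPow zero    _       = 0ℚ
invPow (suc k) zero    = 1ℚ
invPow (suc k) (suc s) = ((+ 1) / suc k) * invPow (suc k) s

Σ1 : ℕ → (ℕ → ℚ) → ℚ
Σ1 zero    f = 0ℚ
Σ1 (suc N) f = Σ1 N f Q.+ f (suc N)

-- Σ_{i=a}^{b} f i  (empty, i.e. 0, if b < a)
ΣR : ℕ → ℕ → (ℕ → ℚ) → ℚ
ΣR a b f = go (suc b ∸ a)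
  where
  go : ℕ → ℚ
  go zero    = 0ℚ
  go (suc k) = go k Q.+ f (a + k)

-- Truncated multiple zeta value:
-- ζ_N(s₁,…,s_r) = Σ_{N ≥ n₁ > n₂ > … > n_r ≥ 1} n₁^{-s₁} ⋯ n_r^{-s_r}
ζN : ℕ → List ℕ → ℚ
ζN N []       = 1ℚ
ζN N (s ∷ ss) = Σ1 N (λ n → invPow n s * ζN (n ∸ 1) ss)

-- Truncated multiple zeta-star value:
-- ζ⋆_N(s₁,…,s_r) = Σ_{N ≥ n₁ ≥ n₂ ≥ … ≥ n_r ≥ 1} n₁^{-s₁} ⋯ n_r^{-s_r}
ζ⋆N : ℕ → List ℕ → ℚ
ζ⋆N N []       = 1ℚ
ζ⋆N N (s ∷ ss) = Σ1 N (λ n → invPow n s * ζ⋆N n ss)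

ones : ℕ → List ℕ
ones j = replicate j 1

sgn : ℕ → ℚ
sgn zero    = 1ℚ
sgn (suc k) = - sgn k

ℕ→ℚ : ℕ → ℚ
ℕ→ℚ n = (+ n) / 1

{-# OPTIONS --safe #-}
module Submission where

-- Cut all sums off at M and read i/M as a variable t in [0,1].  The operators
-- (A f)(n) = Σ_{i≤n} f(i-1)/(M+1-i) and (B f)(n) = Σ_{i≤n} f(i)/i then stand for
-- integration against dt/(1-t) and dt/t, and on the functions C(n,k)/C(M,k),
-- which replace t^k, they act exactly as these integrals act on powers.  Hence
-- truncated multiple zeta values are values at M of words in A and B, without
-- error term (Maesaka, Seki, Watanabe), and the left-hand side is exactly the
-- discrete form of -∫ Li_p(t) log t (-log(1-t))^m/m! dt/t.  The reflection
-- i ↦ M+1-i turns t into 1-t, where Li_p(1-t) unfolds by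
-- L̃ (p+1) = ζ(p+1) - A (L̃ p).  Multiplying out the logarithms by summation by
-- parts yields the right-hand side up to diagonal terms, which are bounded by
-- powers of the harmonic number H_M divided by M.

-- No limit or integral is ever formed: all quantities are rationals at a finite level `M`, and the
-- claim is that a difference of truncations is a null sequence. The sample points, i - 1 in `A` and
-- i in `B`, are chosen so that reflection carries one operator exactly into the other. An error can
-- then arise only where two increments meet at the same index. This happens in two places:
-- -log(1-t) carried inside an `A` leaves a squared weight c_i^2 (`κL`), and -log t passing a `B`
-- leaves 1/i^2 (`Err`). Neither square is small by itself. Each becomes small because -log t ≤
-- (1-t)/t, or its mirror image, trades one singular factor for the opposite one, and the sum of
-- 1/(i(M+1-i)) is 2 H_M/(M+1). For c_i^2 the logarithm needed for this trade is supplied by an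
-- outer `B`, so the word must contain at least one, which is where m ≥ 1 enters.

open import Defs
open import Data.Nat using (ℕ; zero; suc; _≥_; _∸_; z≤n; s≤s)
open import Data.Nat as N using ()
import Data.Nat.Properties as NP
import Data.Integer as Z
import Data.Integer.Properties as ZP
open import Data.Empty using (⊥-elim)
open import Data.Product using (∃; _,_; _×_)
open import Data.Sum using (inj₁; inj₂)
open import Data.List using (List; _∷_; []; _++_)
open import Data.List.Properties using (++-identityʳ)
open import Data.Rational using (ℚ; 0ℚ; 1ℚ; ½; _<_; _≤_; ∣_∣)
import Data.Rational as Q
open import Data.Rational.Properties using (≤-refl; ≤-trans; ≤-reflexive; <⇒≤; ≤-<-trans)
import Data.Rational.Properties as QP
import Data.Rational.Unnormalised as Qᵘ
import Data.Rational.Unnormalised.Properties as QᵘP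
open import Relation.Binary.PropositionalEquality using (_≡_; refl; sym; trans; cong; cong₂; subst; subst₂; module ≡-Reasoning)
open import Relation.Nullary.Decidable using (Dec; yes; no; dec⇒maybe)
open import Tactic.RingSolver using (solve-∀)
open import Tactic.RingSolver.Core.AlmostCommutativeRing using (AlmostCommutativeRing; fromCommutativeRing)
open import Level using (0ℓ)

-- The operations of ℚ are hidden behind abstract copies, as the conversion
-- checker would otherwise unfold them down to gcd computations.

infix  8 ⊝_
infixl 7 _⊗_
infixl 6 _⊕_ _⊖_

abstract
  _⊕_ _⊗_ _⊖_ : ℚ → ℚ → ℚ
  _⊕_ = Q._+_
  _⊗_ = Q._*_
  _⊖_ = Q._-_

  ⊝_ : ℚ → ℚ
  ⊝_ = Q.-_

  ι inv : ℕ → ℚ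
  ι = ℕ→ℚ
  inv zero    = 0ℚ
  inv (suc n) = Z.+ 1 Q./ suc n

  ring : AlmostCommutativeRing 0ℓ 0ℓ
  ring = record
    { Carrier = ℚ
    ; _≈_ = _≡_
    ; _+_ = _⊕_
    ; _*_ = _⊗_
    ; -_  = ⊝_
    ; 0#  = 0ℚ
    ; 0≟_ = λ x → dec⇒maybe (0ℚ QP.≟ x)
    ; 1#  = 1ℚ
    ; isAlmostCommutativeRing = AlmostCommutativeRing.isAlmostCommutativeRing
        (fromCommutativeRing QP.+-*-commutativeRing (λ x → dec⇒maybe (0ℚ QP.≟ x)))
    }

  ⊕-assoc : ∀ p q r → p ⊕ q ⊕ r ≡ p ⊕ (q ⊕ r)
  ⊕-assoc = QP.+-assoc

  ⊕-comm : ∀ p q → p ⊕ q ≡ q ⊕ p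
  ⊕-comm = QP.+-comm

  ⊕-identityˡ : ∀ p → 0ℚ ⊕ p ≡ p
  ⊕-identityˡ = QP.+-identityˡ

  ⊕-identityʳ : ∀ p → p ⊕ 0ℚ ≡ p
  ⊕-identityʳ = QP.+-identityʳ

  ⊖-self : ∀ p → p ⊖ p ≡ 0ℚ
  ⊖-self = QP.+-inverseʳ

  ⊖-def : ∀ p q → p ⊖ q ≡ p ⊕ ⊝ q
  ⊖-def p q = refl

  ⊗-assoc : ∀ p q r → p ⊗ q ⊗ r ≡ p ⊗ (q ⊗ r)
  ⊗-assoc = QP.*-assoc

  ⊗-comm : ∀ p q → p ⊗ q ≡ q ⊗ p
  ⊗-comm = QP.*-comm

  ⊗-identityˡ : ∀ p → 1ℚ ⊗ p ≡ p
  ⊗-identityˡ = QP.*-identityˡ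

  ⊗-identityʳ : ∀ p → p ⊗ 1ℚ ≡ p
  ⊗-identityʳ = QP.*-identityʳ

  ⊗-zeroˡ : ∀ p → 0ℚ ⊗ p ≡ 0ℚ
  ⊗-zeroˡ = QP.*-zeroˡ

  ⊗-zeroʳ : ∀ p → p ⊗ 0ℚ ≡ 0ℚ
  ⊗-zeroʳ = QP.*-zeroʳ

  ⊗-distribˡ : ∀ p q r → p ⊗ (q ⊕ r) ≡ p ⊗ q ⊕ p ⊗ r
  ⊗-distribˡ = QP.*-distribˡ-+

  ⊗-distribʳ : ∀ p q r → (q ⊕ r) ⊗ p ≡ q ⊗ p ⊕ r ⊗ p
  ⊗-distribʳ = QP.*-distribʳ-+

  ⊕-mono : ∀ {p q r s} → p ≤ q → r ≤ s → p ⊕ r ≤ q ⊕ s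
  ⊕-mono = QP.+-mono-≤

  ⊝-antimono : ∀ {p q} → p ≤ q → ⊝ q ≤ ⊝ p
  ⊝-antimono = QP.neg-antimono-≤

  ⊗-monoˡ : ∀ {r p q} → 0ℚ ≤ r → p ≤ q → r ⊗ p ≤ r ⊗ q
  ⊗-monoˡ {r} 0≤r = QP.*-monoˡ-≤-nonNeg r {{Q.nonNegative 0≤r}}

  ∣⊕∣ : ∀ p q → ∣ p ⊕ q ∣ ≤ ∣ p ∣ ⊕ ∣ q ∣
  ∣⊕∣ = QP.∣p+q∣≤∣p∣+∣q∣

  ∣⊗∣ : ∀ p q → ∣ p ⊗ q ∣ ≡ ∣ p ∣ ⊗ ∣ q ∣
  ∣⊗∣ = QP.∣p*q∣≡∣p∣*∣q∣

  ½⊗-pos : ∀ {ε} → 0ℚ < ε → 0ℚ < ½ ⊗ ε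
  ½⊗-pos {ε} 0<ε = subst (_< ½ Q.* ε) (QP.*-zeroʳ ½) (QP.*-monoʳ-<-pos ½ 0<ε)

  ½+½ : ∀ ε → ½ ⊗ ε ⊕ ½ ⊗ ε ≡ ε
  ½+½ ε = trans (sym (QP.*-distribʳ-+ ε ½ ½)) (QP.*-identityˡ ε)

  ½⊗-< : ∀ {ε} → 0ℚ < ε → ½ ⊗ ε < ε
  ½⊗-< {ε} 0<ε = subst₂ _<_ (QP.+-identityʳ (½ Q.* ε)) (½+½ ε) (QP.+-monoʳ-< (½ Q.* ε) (½⊗-pos 0<ε))

  -- The witness is ε/(1+|c|); adding 1 to the denominator covers c = 0 without a case distinction.
  scale-down : ∀ c {ε} → 0ℚ < ε → ∃ λ δ → 0ℚ < δ × ∣ c ∣ ⊗ δ ≤ ε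
  scale-down c {ε} 0<ε = r Q.* ε , QP.positive⁻¹ (r Q.* ε) {{r*ε-pos}} , bound
    where
    d : ℚ
    d = 1ℚ Q.+ ∣ c ∣
    instance
      d-pos : Q.Positive d
      d-pos = QP.pos+nonNeg⇒pos 1ℚ ∣ c ∣ {{QP.∣-∣-nonNeg c}}
      d≢0 : Q.NonZero d
      d≢0 = QP.pos⇒nonZero d
      r-pos : Q.Positive (Q.1/ d)
      r-pos = QP.1/pos⇒pos d
      ε-pos : Q.Positive ε
      ε-pos = Q.positive 0<ε
    r : ℚ
    r = Q.1/ d
    r*ε-pos : Q.Positive (r Q.* ε)
    r*ε-pos = QP.pos*pos⇒pos r ε
    bound : ∣ c ∣ Q.* (r Q.* ε) ≤ ε
    bound = subst (∣ c ∣ Q.* (r Q.* ε) ≤_)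
      (trans (sym (QP.*-assoc d r ε)) (trans (cong (Q._* ε) (QP.*-inverseʳ d)) (QP.*-identityˡ ε)))
      (QP.*-monoʳ-≤-nonNeg (r Q.* ε) {{QP.pos⇒nonNeg (r Q.* ε) {{r*ε-pos}}}}
        (subst (_≤ d) (QP.+-identityˡ ∣ c ∣) (QP.+-monoˡ-≤ ∣ c ∣ (QP.nonNegative⁻¹ 1ℚ))))

⊗-monoʳ : ∀ {r p q} → 0ℚ ≤ r → p ≤ q → p ⊗ r ≤ q ⊗ r
⊗-monoʳ {r} {p} {q} 0≤r p≤q = subst₂ _≤_ (⊗-comm r p) (⊗-comm r q) (⊗-monoˡ 0≤r p≤q)

0≤⊗ : ∀ {p q} → 0ℚ ≤ p → 0ℚ ≤ q → 0ℚ ≤ p ⊗ q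
0≤⊗ {p} {q} 0≤p 0≤q = subst (_≤ p ⊗ q) (⊗-zeroʳ p) (⊗-monoˡ 0≤p 0≤q)

0≤⊕ : ∀ {p q} → 0ℚ ≤ p → 0ℚ ≤ q → 0ℚ ≤ p ⊕ q
0≤⊕ {p} {q} 0≤p 0≤q = subst (_≤ p ⊕ q) (⊕-identityʳ 0ℚ) (⊕-mono 0≤p 0≤q)

p≤p⊕q : ∀ p {q} → 0ℚ ≤ q → p ≤ p ⊕ q
p≤p⊕q p {q} 0≤q = subst (_≤ p ⊕ q) (⊕-identityʳ p) (⊕-mono ≤-refl 0≤q)

p⊖q≤p : ∀ p {q} → 0ℚ ≤ q → p ⊖ q ≤ p
p⊖q≤p p {q} 0≤q = subst₂ _≤_ (sym (⊖-def p q)) (eq p) (⊕-mono {p} ≤-refl (⊝-antimono 0≤q))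
  where
  abstract
    eq : ∀ p → p ⊕ ⊝ 0ℚ ≡ p
    eq = solve-∀ ring

⊗-mono : ∀ {p q r s} → 0ℚ ≤ p → 0ℚ ≤ s → p ≤ q → r ≤ s → p ⊗ r ≤ q ⊗ s
⊗-mono 0≤p 0≤s p≤q r≤s = ≤-trans (⊗-monoˡ 0≤p r≤s) (⊗-monoʳ 0≤s p≤q)

⊗-exchange : ∀ a b x → a ⊗ (b ⊗ x) ≡ b ⊗ (a ⊗ x)
⊗-exchange a b x = trans (sym (⊗-assoc a b x)) (trans (cong (_⊗ x) (⊗-comm a b)) (⊗-assoc b a x))

-- Natural numbers and their inverses in ℚ

abstract
  private
    toℚᵘ-/ : ∀ i n → Q.toℚᵘ (i Q./ suc n) Qᵘ.≃ Qᵘ.mkℚᵘ i n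
    toℚᵘ-/ i n = QP.toℚᵘ-fromℚᵘ (Qᵘ.mkℚᵘ i n)

  ι-zero : ι 0 ≡ 0ℚ
  ι-zero = refl

  ι-suc : ∀ n → ι (suc n) ≡ ι n ⊕ 1ℚ
  ι-suc n = QP.toℚᵘ-injective (begin
    Q.toℚᵘ (ℕ→ℚ (suc n))                  ≈⟨ toℚᵘ-/ (Z.+ suc n) 0 ⟩
    Qᵘ.mkℚᵘ (Z.+ suc n) 0                  ≈⟨ Qᵘ.*≡* (cong (Z._* Z.+ 1) (sym (trans (cong (Z._+ Z.+ 1) (ZP.*-identityʳ (Z.+ n))) (ZP.+-comm (Z.+ n) (Z.+ 1))))) ⟩
    Qᵘ.mkℚᵘ (Z.+ n) 0 Qᵘ.+ Qᵘ.mkℚᵘ (Z.+ 1) 0  ≈⟨ QᵘP.+-cong (QᵘP.≃-sym (toℚᵘ-/ (Z.+ n) 0)) QᵘP.≃-refl ⟩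
    Q.toℚᵘ (ℕ→ℚ n) Qᵘ.+ Q.toℚᵘ 1ℚ         ≈⟨ QᵘP.≃-sym (QP.toℚᵘ-homo-+ (ℕ→ℚ n) 1ℚ) ⟩
    Q.toℚᵘ (ℕ→ℚ n Q.+ 1ℚ)                 ∎)
    where open QᵘP.≃-Reasoning

  inv-inverse : ∀ n → inv (suc n) ⊗ ι (suc n) ≡ 1ℚ
  inv-inverse n = QP.toℚᵘ-injective (begin
    Q.toℚᵘ (inv (suc n) Q.* ι (suc n))               ≈⟨ QP.toℚᵘ-homo-* (inv (suc n)) (ι (suc n)) ⟩
    Q.toℚᵘ (inv (suc n)) Qᵘ.* Q.toℚᵘ (ι (suc n))    ≈⟨ QᵘP.*-cong (toℚᵘ-/ (Z.+ 1) n) (toℚᵘ-/ (Z.+ suc n) 0) ⟩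
    Qᵘ.mkℚᵘ (Z.+ 1) n Qᵘ.* Qᵘ.mkℚᵘ (Z.+ suc n) 0     ≈⟨ Qᵘ.*≡* (cong Z.+_ (eq n)) ⟩
    Q.toℚᵘ 1ℚ                                         ∎)
    where
    open QᵘP.≃-Reasoning
    eq : ∀ n → suc (n N.+ 0) N.* 1 ≡ 1 N.* (suc n N.* 1)
    eq n = trans (cong (λ x → suc x N.* 1) (NP.+-identityʳ n)) (sym (NP.*-identityˡ (suc n N.* 1)))

  inv-zero : inv 0 ≡ 0ℚ
  inv-zero = refl

  inv-nonneg : ∀ n → 0ℚ ≤ inv n
  inv-nonneg zero    = ≤-refl
  inv-nonneg (suc n) = QP.nonNegative⁻¹ (inv (suc n)) {{QP.normalize-nonNeg 1 (suc n)}}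

  ι-nonneg : ∀ n → 0ℚ ≤ ι n
  ι-nonneg n = QP.nonNegative⁻¹ (ι n) {{QP.normalize-nonNeg n 1}}

  -- A positive rational has numerator at least 1, so the reciprocal of its own denominator already
  -- lies below it.
  archimedean : ∀ {ε} → 0ℚ < ε → ∃ λ d → inv (suc d) ≤ ε
  archimedean {Q.mkℚ (Z.+ suc a) d _} _ = d , QP.toℚᵘ-cancel-≤
    (QᵘP.≤-respˡ-≃ (QᵘP.≃-sym (toℚᵘ-/ (Z.+ 1) d)) (Qᵘ.*≤* (ZP.*-monoʳ-≤-nonNeg (Z.+ suc d) {Z.+ 1} {Z.+ suc a} (Z.+≤+ (s≤s z≤n)))))
  archimedean {Q.mkℚ (Z.+ 0) d _} (Q.*<* (Z.+<+ lt)) = ⊥-elim (NP.<-irrefl refl lt)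
  archimedean {Q.mkℚ (Z.-[1+_] a) d _} (Q.*<* ())

  inv-1 : inv 1 ≡ 1ℚ
  inv-1 = refl

inv-cancel : ∀ n x → ι (suc n) ⊗ (inv (suc n) ⊗ x) ≡ x
inv-cancel n x = begin
  ι (suc n) ⊗ (inv (suc n) ⊗ x)  ≡⟨ eq (ι (suc n)) (inv (suc n)) x ⟩
  inv (suc n) ⊗ ι (suc n) ⊗ x    ≡⟨ cong (_⊗ x) (inv-inverse n) ⟩
  1ℚ ⊗ x                          ≡⟨ ⊗-identityˡ x ⟩
  x                               ∎
  where
  open ≡-Reasoning
  abstract
    eq : ∀ a b c → a ⊗ (b ⊗ c) ≡ b ⊗ a ⊗ c
    eq = solve-∀ ring

ι-+ : ∀ m n → ι (m N.+ n) ≡ ι m ⊕ ι n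
ι-+ zero    n = sym (trans (cong (_⊕ ι n) ι-zero) (⊕-identityˡ (ι n)))
ι-+ (suc m) n = begin
  ι (suc (m N.+ n))   ≡⟨ ι-suc (m N.+ n) ⟩
  ι (m N.+ n) ⊕ 1ℚ    ≡⟨ cong (_⊕ 1ℚ) (ι-+ m n) ⟩
  ι m ⊕ ι n ⊕ 1ℚ      ≡⟨ eq (ι m) (ι n) ⟩
  ι m ⊕ 1ℚ ⊕ ι n      ≡⟨ cong (_⊕ ι n) (sym (ι-suc m)) ⟩
  ι (suc m) ⊕ ι n     ∎
  where
  open ≡-Reasoning
  abstract
    eq : ∀ a b → a ⊕ b ⊕ 1ℚ ≡ a ⊕ 1ℚ ⊕ b
    eq = solve-∀ ring

ι-* : ∀ m n → ι (m N.* n) ≡ ι m ⊗ ι n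
ι-* zero    n = trans ι-zero (sym (trans (cong (_⊗ ι n) ι-zero) (⊗-zeroˡ (ι n))))
ι-* (suc m) n = begin
  ι (n N.+ m N.* n)   ≡⟨ ι-+ n (m N.* n) ⟩
  ι n ⊕ ι (m N.* n)   ≡⟨ cong (ι n ⊕_) (ι-* m n) ⟩
  ι n ⊕ ι m ⊗ ι n     ≡⟨ eq (ι n) (ι m) ⟩
  (ι m ⊕ 1ℚ) ⊗ ι n    ≡⟨ cong (_⊗ ι n) (sym (ι-suc m)) ⟩
  ι (suc m) ⊗ ι n     ∎
  where
  open ≡-Reasoning
  abstract
    eq : ∀ a b → a ⊕ b ⊗ a ≡ (b ⊕ 1ℚ) ⊗ a
    eq = solve-∀ ring

-- The difference of the two reciprocals is (n-m)/((m+1)(n+1)), a product of nonnegative factors.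
inv-antitone : ∀ {m n} → m N.≤ n → inv (suc n) ≤ inv (suc m)
inv-antitone {m} {n} m≤n = subst (inv (suc n) ≤_) (sym a≡b+)
  (p≤p⊕q b (0≤⊗ (0≤⊗ (inv-nonneg (suc m)) (inv-nonneg (suc n))) (ι-nonneg (n ∸ m))))
  where
  open ≡-Reasoning
  a = inv (suc m)
  b = inv (suc n)
  abstract
    eq : ∀ a b c d → a ⊗ (b ⊗ (c ⊕ d)) ≡ b ⊗ (a ⊗ c) ⊕ a ⊗ b ⊗ d
    eq = solve-∀ ring
  a≡b+ : a ≡ b ⊕ a ⊗ b ⊗ ι (n ∸ m)
  a≡b+ = begin
    a                                          ≡⟨ sym (⊗-identityʳ a) ⟩
    a ⊗ 1ℚ                                     ≡⟨ cong (a ⊗_) (sym (inv-inverse n)) ⟩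
    a ⊗ (b ⊗ ι (suc n))                        ≡⟨ cong (λ x → a ⊗ (b ⊗ ι (suc x))) (sym (NP.m+[n∸m]≡n m≤n)) ⟩
    a ⊗ (b ⊗ ι (suc m N.+ (n ∸ m)))            ≡⟨ cong (λ x → a ⊗ (b ⊗ x)) (ι-+ (suc m) (n ∸ m)) ⟩
    a ⊗ (b ⊗ (ι (suc m) ⊕ ι (n ∸ m)))          ≡⟨ eq a b (ι (suc m)) (ι (n ∸ m)) ⟩
    b ⊗ (a ⊗ ι (suc m)) ⊕ a ⊗ b ⊗ ι (n ∸ m)    ≡⟨ cong (λ x → b ⊗ x ⊕ a ⊗ b ⊗ ι (n ∸ m)) (inv-inverse m) ⟩
    b ⊗ 1ℚ ⊕ a ⊗ b ⊗ ι (n ∸ m)                 ≡⟨ cong (_⊕ a ⊗ b ⊗ ι (n ∸ m)) (⊗-identityʳ b) ⟩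
    b ⊕ a ⊗ b ⊗ ι (n ∸ m)                      ∎

inv-antitone-pos : ∀ {m n} → 0 N.< m → m N.≤ n → inv n ≤ inv m
inv-antitone-pos {suc m} {suc n} _ (s≤s m≤n) = inv-antitone m≤n

inv≤1 : ∀ n → inv (suc n) ≤ 1ℚ
inv≤1 n = subst (inv (suc n) ≤_) inv-1 (inv-antitone {0} {n} z≤n)

inv-partial-fractions : ∀ a b → inv (suc a) ⊗ inv (suc b) ≡ inv (suc a N.+ suc b) ⊗ (inv (suc a) ⊕ inv (suc b))
inv-partial-fractions a b = begin
  x ⊗ y                                               ≡⟨ sym (⊗-identityˡ (x ⊗ y)) ⟩
  1ℚ ⊗ (x ⊗ y)                                        ≡⟨ cong (_⊗ (x ⊗ y)) (sym (inv-inverse (a N.+ suc b))) ⟩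
  z ⊗ ι (suc a N.+ suc b) ⊗ (x ⊗ y)                   ≡⟨ cong (λ w → z ⊗ w ⊗ (x ⊗ y)) (ι-+ (suc a) (suc b)) ⟩
  z ⊗ (ι (suc a) ⊕ ι (suc b)) ⊗ (x ⊗ y)               ≡⟨ eq₁ z (ι (suc a)) (ι (suc b)) x y ⟩
  z ⊗ (x ⊗ ι (suc a) ⊗ y ⊕ y ⊗ ι (suc b) ⊗ x)         ≡⟨ cong₂ (λ v w → z ⊗ (v ⊗ y ⊕ w ⊗ x)) (inv-inverse a) (inv-inverse b) ⟩
  z ⊗ (1ℚ ⊗ y ⊕ 1ℚ ⊗ x)                               ≡⟨ eq₂ z x y ⟩
  z ⊗ (x ⊕ y)                                         ∎
  where
  open ≡-Reasoning
  x = inv (suc a)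
  y = inv (suc b)
  z = inv (suc a N.+ suc b)
  abstract
    eq₁ : ∀ z a b x y → z ⊗ (a ⊕ b) ⊗ (x ⊗ y) ≡ z ⊗ (x ⊗ a ⊗ y ⊕ y ⊗ b ⊗ x)
    eq₁ = solve-∀ ring
    eq₂ : ∀ z x y → z ⊗ (1ℚ ⊗ y ⊕ 1ℚ ⊗ x) ≡ z ⊗ (x ⊕ y)
    eq₂ = solve-∀ ring

-- Finite sums

∑ : ℕ → (ℕ → ℚ) → ℚ
∑ zero    f = 0ℚ
∑ (suc n) f = ∑ n f ⊕ f (suc n)

∑-cong : ∀ n {f g : ℕ → ℚ} → (∀ i → i N.< n → f (suc i) ≡ g (suc i)) → ∑ n f ≡ ∑ n g
∑-cong zero    h = refl
∑-cong (suc n) h = cong₂ _⊕_ (∑-cong n (λ i i<n → h i (NP.m<n⇒m<1+n i<n))) (h n NP.≤-refl)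

∑-zero : ∀ n → ∑ n (λ _ → 0ℚ) ≡ 0ℚ
∑-zero zero    = refl
∑-zero (suc n) = trans (⊕-identityʳ (∑ n (λ _ → 0ℚ))) (∑-zero n)

∑-⊕ : ∀ n (f g : ℕ → ℚ) → ∑ n (λ i → f i ⊕ g i) ≡ ∑ n f ⊕ ∑ n g
∑-⊕ zero    f g = sym (⊕-identityˡ 0ℚ)
∑-⊕ (suc n) f g = trans (cong (_⊕ (f (suc n) ⊕ g (suc n))) (∑-⊕ n f g)) (eq (∑ n f) (∑ n g) (f (suc n)) (g (suc n)))
  where
  abstract
    eq : ∀ a b c d → a ⊕ b ⊕ (c ⊕ d) ≡ a ⊕ c ⊕ (b ⊕ d)
    eq = solve-∀ ring

∑-⊗ˡ : ∀ n c (f : ℕ → ℚ) → ∑ n (λ i → c ⊗ f i) ≡ c ⊗ ∑ n f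
∑-⊗ˡ zero    c f = sym (⊗-zeroʳ c)
∑-⊗ˡ (suc n) c f = trans (cong (_⊕ c ⊗ f (suc n)) (∑-⊗ˡ n c f)) (sym (⊗-distribˡ c (∑ n f) (f (suc n))))

∑-⊗ʳ : ∀ n c (f : ℕ → ℚ) → ∑ n (λ i → f i ⊗ c) ≡ ∑ n f ⊗ c
∑-⊗ʳ n c f = trans (∑-cong n (λ i _ → ⊗-comm (f (suc i)) c)) (trans (∑-⊗ˡ n c f) (⊗-comm c (∑ n f)))

∑-⊖ : ∀ n (f g : ℕ → ℚ) → ∑ n (λ i → f i ⊖ g i) ≡ ∑ n f ⊖ ∑ n g
∑-⊖ zero    f g = sym (⊖-self 0ℚ)
∑-⊖ (suc n) f g = trans (cong (_⊕ (f (suc n) ⊖ g (suc n))) (∑-⊖ n f g)) (eq (∑ n f) (∑ n g) (f (suc n)) (g (suc n)))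
  where
  abstract
    eq : ∀ a b c d → a ⊖ b ⊕ (c ⊖ d) ≡ a ⊕ c ⊖ (b ⊕ d)
    eq = solve-∀ ring

∑-swap : ∀ m n (f : ℕ → ℕ → ℚ) → ∑ m (λ i → ∑ n (f i)) ≡ ∑ n (λ j → ∑ m (λ i → f i j))
∑-swap zero    n f = sym (∑-zero n)
∑-swap (suc m) n f = trans (cong (_⊕ ∑ n (f (suc m))) (∑-swap m n f)) (sym (∑-⊕ n (λ j → ∑ m (λ i → f i j)) (f (suc m))))

∑-telescope : ∀ n (f F : ℕ → ℚ) → (∀ i → i N.< n → F (suc i) ≡ F i ⊕ f (suc i)) → ∑ n f ≡ F n ⊖ F 0
∑-telescope zero    f F h = sym (⊖-self (F 0))
∑-telescope (suc n) f F h = begin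
  ∑ n f ⊕ f (suc n)       ≡⟨ cong (_⊕ f (suc n)) (∑-telescope n f F (λ i i<n → h i (NP.m<n⇒m<1+n i<n))) ⟩
  F n ⊖ F 0 ⊕ f (suc n)   ≡⟨ eq (F n) (F 0) (f (suc n)) ⟩
  F n ⊕ f (suc n) ⊖ F 0   ≡⟨ cong (_⊖ F 0) (sym (h n NP.≤-refl)) ⟩
  F (suc n) ⊖ F 0         ∎
  where
  open ≡-Reasoning
  abstract
    eq : ∀ a b c → a ⊖ b ⊕ c ≡ a ⊕ c ⊖ b
    eq = solve-∀ ring

∑-suc : ∀ n (f : ℕ → ℚ) → ∑ (suc n) f ≡ f 1 ⊕ ∑ n (λ i → f (suc i))
∑-suc zero    f = ⊕-comm 0ℚ (f 1)
∑-suc (suc n) f = trans (cong (_⊕ f (suc (suc n))) (∑-suc n f)) (⊕-assoc (f 1) (∑ n (λ i → f (suc i))) (f (suc (suc n))))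

∑-reverse : ∀ n (f : ℕ → ℚ) → ∑ n (λ i → f (suc n ∸ i)) ≡ ∑ n f
∑-reverse zero    f = refl
∑-reverse (suc n) f = begin
  ∑ (suc n) (λ i → f (suc (suc n) ∸ i))        ≡⟨ ∑-suc n (λ i → f (suc (suc n) ∸ i)) ⟩
  f (suc n) ⊕ ∑ n (λ i → f (suc n ∸ i))        ≡⟨ cong (f (suc n) ⊕_) (∑-reverse n f) ⟩
  f (suc n) ⊕ ∑ n f                            ≡⟨ ⊕-comm (f (suc n)) (∑ n f) ⟩
  ∑ n f ⊕ f (suc n)                            ∎
  where open ≡-Reasoning

∑-mono : ∀ n {f g : ℕ → ℚ} → (∀ i → i N.< n → f (suc i) ≤ g (suc i)) → ∑ n f ≤ ∑ n g
∑-mono zero    h = ≤-refl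
∑-mono (suc n) h = ⊕-mono (∑-mono n (λ i i<n → h i (NP.m<n⇒m<1+n i<n))) (h n NP.≤-refl)

∑-nonneg : ∀ n {f : ℕ → ℚ} → (∀ i → i N.< n → 0ℚ ≤ f (suc i)) → 0ℚ ≤ ∑ n f
∑-nonneg n {f} h = subst (_≤ ∑ n f) (∑-zero n) (∑-mono n h)

∑-const : ∀ n c → ∑ n (λ _ → c) ≡ ι n ⊗ c
∑-const zero    c = sym (trans (cong (_⊗ c) ι-zero) (⊗-zeroˡ c))
∑-const (suc n) c = begin
  ∑ n (λ _ → c) ⊕ c   ≡⟨ cong (_⊕ c) (∑-const n c) ⟩
  ι n ⊗ c ⊕ c         ≡⟨ eq (ι n) c ⟩
  (ι n ⊕ 1ℚ) ⊗ c      ≡⟨ cong (_⊗ c) (sym (ι-suc n)) ⟩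
  ι (suc n) ⊗ c       ∎
  where
  open ≡-Reasoning
  abstract
    eq : ∀ a c → a ⊗ c ⊕ c ≡ (a ⊕ 1ℚ) ⊗ c
    eq = solve-∀ ring

-- Null sequences

-- The weak inequality is easier to combine; `Null⇒<` recovers the strict one by halving ε.
Null : (ℕ → ℚ) → Set
Null f = ∀ ε → 0ℚ < ε → ∃ λ N₀ → ∀ n → n ≥ N₀ → ∣ f n ∣ ≤ ε

∣∣-nonneg : ∀ {p} → 0ℚ ≤ p → ∣ p ∣ ≡ p
∣∣-nonneg = QP.0≤p⇒∣p∣≡p

Null-cong : ∀ {f g} → (∀ n → f n ≡ g n) → Null f → Null g
Null-cong f≡g null ε 0<ε with null ε 0<ε
... | N₀ , h = N₀ , λ n n≥N₀ → subst (λ x → ∣ x ∣ ≤ ε) (f≡g n) (h n n≥N₀)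

Null-≤ : ∀ {f g} → (∀ n → 0ℚ ≤ f n) → (∀ n → f n ≤ g n) → Null g → Null f
Null-≤ {f} {g} 0≤f f≤g null ε 0<ε with null ε 0<ε
... | N₀ , h = N₀ , λ n n≥N₀ →
  subst (_≤ ε) (sym (∣∣-nonneg (0≤f n)))
    (≤-trans (f≤g n) (subst (_≤ ε) (∣∣-nonneg (≤-trans (0≤f n) (f≤g n))) (h n n≥N₀)))

Null-⊕ : ∀ {f g} → Null f → Null g → Null (λ n → f n ⊕ g n)
Null-⊕ {f} {g} nf ng ε 0<ε with nf (½ ⊗ ε) (½⊗-pos 0<ε) | ng (½ ⊗ ε) (½⊗-pos 0<ε)
... | N₁ , h₁ | N₂ , h₂ = N₁ N.+ N₂ , λ n n≥ → ≤-trans (∣⊕∣ (f n) (g n))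
  (subst (∣ f n ∣ ⊕ ∣ g n ∣ ≤_) (½+½ ε)
    (⊕-mono (h₁ n (NP.≤-trans (NP.m≤m+n N₁ N₂) n≥)) (h₂ n (NP.≤-trans (NP.m≤n+m N₂ N₁) n≥))))

Null-⊗ : ∀ c {f} → Null f → Null (λ n → c ⊗ f n)
Null-⊗ c {f} null ε 0<ε with scale-down c 0<ε
... | δ , 0<δ , bound with null δ 0<δ
... | N₀ , h = N₀ , λ n n≥N₀ → ≤-trans
  (subst (_≤ ∣ c ∣ ⊗ δ) (sym (∣⊗∣ c (f n))) (⊗-monoˡ (QP.0≤∣p∣ c) (h n n≥N₀))) bound

Null-suc : ∀ {f} → Null f → Null (λ n → f (suc n))
Null-suc null ε 0<ε with null ε 0<ε
... | N₀ , h = N₀ , λ n n≥N₀ → h (suc n) (NP.m≤n⇒m≤1+n n≥N₀)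

Null-0 : Null (λ _ → 0ℚ)
Null-0 ε 0<ε = 0 , λ _ _ → <⇒≤ 0<ε

Null-inv : Null inv
Null-inv ε 0<ε with archimedean 0<ε
... | d , inv≤ε = suc d , λ { (suc n) (s≤s d≤n) →
  subst (_≤ ε) (sym (∣∣-nonneg (inv-nonneg (suc n)))) (≤-trans (inv-antitone d≤n) inv≤ε) }

infix 4 _≈_

_≈_ : (ℕ → ℚ) → (ℕ → ℚ) → Set
f ≈ g = Null (λ n → f n ⊖ g n)

≡⇒≈ : ∀ {f g} → (∀ n → f n ≡ g n) → f ≈ g
≡⇒≈ {f} {g} h = Null-cong (λ n → sym (trans (cong (_⊖ g n) (h n)) (⊖-self (g n)))) Null-0

≈-trans : ∀ {f g h} → f ≈ g → g ≈ h → f ≈ h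
≈-trans {f} {g} {h} p q = Null-cong (λ n → eq (f n) (g n) (h n)) (Null-⊕ p q)
  where
  abstract
    eq : ∀ a b c → a ⊖ b ⊕ (b ⊖ c) ≡ a ⊖ c
    eq = solve-∀ ring

≈-⊕ : ∀ {f f′ g g′} → f ≈ f′ → g ≈ g′ → (λ n → f n ⊕ g n) ≈ (λ n → f′ n ⊕ g′ n)
≈-⊕ {f} {f′} {g} {g′} p q = Null-cong (λ n → eq (f n) (f′ n) (g n) (g′ n)) (Null-⊕ p q)
  where
  abstract
    eq : ∀ a b c d → a ⊖ b ⊕ (c ⊖ d) ≡ a ⊕ c ⊖ (b ⊕ d)
    eq = solve-∀ ring

≈-⊗ : ∀ c {f g} → f ≈ g → (λ n → c ⊗ f n) ≈ (λ n → c ⊗ g n)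
≈-⊗ c {f} {g} p = Null-cong (λ n → eq c (f n) (g n)) (Null-⊗ c p)
  where
  abstract
    eq : ∀ a b c → a ⊗ (b ⊖ c) ≡ a ⊗ b ⊖ a ⊗ c
    eq = solve-∀ ring

-- Growth of the harmonic numbers

pow : ℚ → ℕ → ℚ
pow x zero    = 1ℚ
pow x (suc k) = x ⊗ pow x k

0≤1 : 0ℚ ≤ 1ℚ
0≤1 = QP.nonNegative⁻¹ 1ℚ

pow-nonneg : ∀ {x} → 0ℚ ≤ x → ∀ k → 0ℚ ≤ pow x k
pow-nonneg 0≤x zero    = 0≤1
pow-nonneg 0≤x (suc k) = 0≤⊗ 0≤x (pow-nonneg 0≤x k)

pow-mono : ∀ {x y} → 0ℚ ≤ x → x ≤ y → ∀ k → pow x k ≤ pow y k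
pow-mono 0≤x x≤y zero    = ≤-refl
pow-mono 0≤x x≤y (suc k) = ⊗-mono 0≤x (pow-nonneg (≤-trans 0≤x x≤y) k) x≤y (pow-mono 0≤x x≤y k)

-- A mean value estimate with the derivative taken at the right end point. The induction multiplies
-- by x + d and uses monotonicity of powers on the cross term.
pow-increment : ∀ x d → 0ℚ ≤ x → 0ℚ ≤ d → ∀ k →
  pow (x ⊕ d) (suc k) ≤ pow x (suc k) ⊕ ι (suc k) ⊗ (d ⊗ pow (x ⊕ d) k)
pow-increment x d 0≤x 0≤d zero = ≤-reflexive (trans (eq x d) (cong (λ y → x ⊗ 1ℚ ⊕ y ⊗ (d ⊗ 1ℚ)) (sym ι-1)))
  where
  ι-1 : ι 1 ≡ 1ℚ
  ι-1 = trans (ι-suc 0) (trans (cong (_⊕ 1ℚ) ι-zero) (⊕-identityˡ 1ℚ))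
  abstract
    eq : ∀ x d → (x ⊕ d) ⊗ 1ℚ ≡ x ⊗ 1ℚ ⊕ 1ℚ ⊗ (d ⊗ 1ℚ)
    eq = solve-∀ ring
pow-increment x d 0≤x 0≤d (suc k) = ≤-trans
  (⊗-monoˡ 0≤y (pow-increment x d 0≤x 0≤d k))
  (subst₂ _≤_ (sym (eq₁ x d (pow x (suc k)) (ι (suc k)) (pow y k)))
    (trans (eq₂ (x ⊗ pow x (suc k)) (d ⊗ pow y (suc k)) (ι (suc k)))
      (cong (λ z → x ⊗ pow x (suc k) ⊕ z ⊗ (d ⊗ pow y (suc k))) (sym (ι-suc (suc k)))))
    (⊕-mono (⊕-mono (≤-refl {x ⊗ pow x (suc k)}) (⊗-monoˡ 0≤d (pow-mono 0≤x (p≤p⊕q x 0≤d) (suc k)))) ≤-refl))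
  where
  y = x ⊕ d
  0≤y : 0ℚ ≤ y
  0≤y = 0≤⊕ 0≤x 0≤d
  abstract
    eq₁ : ∀ x d p c q → (x ⊕ d) ⊗ (p ⊕ c ⊗ (d ⊗ q)) ≡ x ⊗ p ⊕ d ⊗ p ⊕ c ⊗ (d ⊗ ((x ⊕ d) ⊗ q))
    eq₁ = solve-∀ ring
    eq₂ : ∀ a b c → a ⊕ b ⊕ c ⊗ b ≡ a ⊕ (c ⊕ 1ℚ) ⊗ b
    eq₂ = solve-∀ ring

inv⊗ι≤1 : ∀ n → inv n ⊗ ι n ≤ 1ℚ
inv⊗ι≤1 zero    = subst (_≤ 1ℚ) (sym (trans (cong (_⊗ ι 0) inv-zero) (⊗-zeroˡ (ι 0)))) 0≤1
inv⊗ι≤1 (suc n) = ≤-reflexive (inv-inverse n)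

ι-mono : ∀ {m n} → m N.≤ n → ι m ≤ ι n
ι-mono {m} {n} m≤n = subst (ι m ≤_) (trans (sym (ι-+ m (n ∸ m))) (cong ι (NP.m+[n∸m]≡n m≤n))) (p≤p⊕q (ι m) (ι-nonneg (n ∸ m)))

-- From some index `N₁` on, every increment is at most ε/2, so `a` grows at most linearly with that
-- slope. Division by n leaves at most ε/2 from the slope, and the fixed value `a N₁` contributes
-- less than another ε/2 for large n.
cesàro : ∀ (a b : ℕ → ℚ) → (∀ n → 0ℚ ≤ a n) → (∀ n → 0ℚ ≤ b n) →
  (∀ n → a (suc n) ≤ a n ⊕ b (suc n)) → Null b → Null (λ n → inv n ⊗ a n)
cesàro a b 0≤a 0≤b step null-b ε 0<ε with null-b (½ ⊗ ε) (½⊗-pos 0<ε)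
... | N₁ , h₁ with Null-⊗ (a N₁) Null-inv (½ ⊗ ε) (½⊗-pos 0<ε)
... | N₂ , h₂ = N₁ N.+ N₂ , bound
  where
  δ = ½ ⊗ ε
  abstract
    eq₁ : ∀ a c δ → a ⊕ c ⊗ δ ⊕ δ ≡ a ⊕ (c ⊕ 1ℚ) ⊗ δ
    eq₁ = solve-∀ ring
    eq₂ : ∀ i a c δ → i ⊗ (a ⊕ c ⊗ δ) ≡ a ⊗ i ⊕ i ⊗ c ⊗ δ
    eq₂ = solve-∀ ring
    eq₃ : ∀ a δ → a ≡ a ⊕ 0ℚ ⊗ δ
    eq₃ = solve-∀ ring
  b≤δ : ∀ n → n ≥ N₁ → b n ≤ δ
  b≤δ n n≥ = subst (_≤ δ) (∣∣-nonneg (0≤b n)) (h₁ n n≥)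
  linear : ∀ k → a (k N.+ N₁) ≤ a N₁ ⊕ ι k ⊗ δ
  linear zero    = ≤-reflexive (trans (eq₃ (a N₁) δ) (cong (λ x → a N₁ ⊕ x ⊗ δ) (sym ι-zero)))
  linear (suc k) = ≤-trans (step (k N.+ N₁)) (subst (a (k N.+ N₁) ⊕ b (suc (k N.+ N₁)) ≤_)
    (trans (eq₁ (a N₁) (ι k) δ) (cong (λ x → a N₁ ⊕ x ⊗ δ) (sym (ι-suc k))))
    (⊕-mono (linear k) (b≤δ (suc (k N.+ N₁)) (NP.m≤n⇒m≤1+n (NP.m≤n+m N₁ k)))))
  bound : ∀ n → n ≥ N₁ N.+ N₂ → ∣ inv n ⊗ a n ∣ ≤ ε
  bound n n≥ = subst (_≤ ε) (sym (∣∣-nonneg (0≤⊗ (inv-nonneg n) (0≤a n))))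
    (≤-trans (⊗-monoˡ (inv-nonneg n) (subst (λ x → a x ≤ a N₁ ⊕ ι (n ∸ N₁) ⊗ δ) (NP.m∸n+n≡m n≥N₁) (linear (n ∸ N₁))))
      (subst₂ _≤_ (sym (eq₂ (inv n) (a N₁) (ι (n ∸ N₁)) δ)) (½+½ ε)
        (⊕-mono
          (subst (_≤ δ) (∣∣-nonneg (0≤⊗ (0≤a N₁) (inv-nonneg n))) (h₂ n (NP.≤-trans (NP.m≤n+m N₂ N₁) n≥)))
          (subst (inv n ⊗ ι (n ∸ N₁) ⊗ δ ≤_) (⊗-identityˡ δ)
            (⊗-monoʳ (<⇒≤ (½⊗-pos 0<ε)) (≤-trans (⊗-monoˡ (inv-nonneg n) (ι-mono (NP.m∸n≤m n N₁))) (inv⊗ι≤1 n)))))))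
    where
    n≥N₁ : N₁ N.≤ n
    n≥N₁ = NP.≤-trans (NP.m≤m+n N₁ N₂) n≥

H : ℕ → ℚ
H n = ∑ n inv

H-nonneg : ∀ n → 0ℚ ≤ H n
H-nonneg n = ∑-nonneg n (λ i _ → inv-nonneg (suc i))

-- Replaces the estimate H_n = O(log n). The increment of H^(k+1) at n is at most (k+1) H_n^k / n,
-- which is null by induction, and `cesàro` turns this into H_n^(k+1) = o(n).
Null-inv⊗H^ : ∀ k → Null (λ n → inv n ⊗ pow (H n) k)
Null-inv⊗H^ zero    = Null-cong (λ n → sym (⊗-identityʳ (inv n))) Null-inv
Null-inv⊗H^ (suc k) = cesàro (λ n → pow (H n) (suc k)) (λ n → ι (suc k) ⊗ (inv n ⊗ pow (H n) k))
  (λ n → pow-nonneg (H-nonneg n) (suc k))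
  (λ n → 0≤⊗ (ι-nonneg (suc k)) (0≤⊗ (inv-nonneg n) (pow-nonneg (H-nonneg n) k)))
  (λ n → pow-increment (H n) (inv (suc n)) (H-nonneg n) (inv-nonneg (suc n)) k)
  (Null-⊗ (ι (suc k)) (Null-inv⊗H^ k))

Null-inv-suc⊗H^ : ∀ k → Null (λ n → inv (suc n) ⊗ pow (H n) k)
Null-inv-suc⊗H^ k = Null-≤
  (λ n → 0≤⊗ (inv-nonneg (suc n)) (pow-nonneg (H-nonneg n) k))
  (λ n → ⊗-monoˡ (inv-nonneg (suc n)) (pow-mono (H-nonneg n) (p≤p⊕q (H n) (inv-nonneg (suc n))) k))
  (Null-suc (Null-inv⊗H^ k))

-- Truncated multiple zeta values as iterated sums

-- Differs from `invPow` at base 0 and exponent 0; all sums start at 1, so only positive bases are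
-- compared.
ipow : ℕ → ℕ → ℚ
ipow n zero    = 1ℚ
ipow n (suc s) = inv n ⊗ ipow n s

ζ ζ⋆ : ℕ → List ℕ → ℚ
ζ n []        = 1ℚ
ζ n (s ∷ ss)  = ∑ n (λ k → ipow k s ⊗ ζ (k ∸ 1) ss)
ζ⋆ n []       = 1ℚ
ζ⋆ n (s ∷ ss) = ∑ n (λ k → ipow k s ⊗ ζ⋆ k ss)

ipow-nonneg : ∀ n s → 0ℚ ≤ ipow n s
ipow-nonneg n zero    = 0≤1
ipow-nonneg n (suc s) = 0≤⊗ (inv-nonneg n) (ipow-nonneg n s)

ipow≤1 : ∀ n s → ipow (suc n) s ≤ 1ℚ
ipow≤1 n zero    = ≤-refl
ipow≤1 n (suc s) = subst (ipow (suc n) (suc s) ≤_) (⊗-identityʳ 1ℚ) (⊗-mono (inv-nonneg (suc n)) 0≤1 (inv≤1 n) (ipow≤1 n s))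

inv-inverse-pos : ∀ {n} → 0 N.< n → inv n ⊗ ι n ≡ 1ℚ
inv-inverse-pos {suc n} _ = inv-inverse n

∑-by-parts : ∀ n (a X : ℕ → ℚ) →
  ∑ n (λ k → (a (k ∸ 1) ⊖ a k) ⊗ X (k ∸ 1)) ⊕ a n ⊗ X n ≡ a 0 ⊗ X 0 ⊕ ∑ n (λ k → a k ⊗ (X k ⊖ X (k ∸ 1)))
∑-by-parts zero    a X = ⊕-comm 0ℚ (a 0 ⊗ X 0)
∑-by-parts (suc n) a X = begin
  S ⊕ (a n ⊖ a (suc n)) ⊗ X n ⊕ a (suc n) ⊗ X (suc n)     ≡⟨ eq S (a n) (a (suc n)) (X n) (X (suc n)) ⟩
  S ⊕ a n ⊗ X n ⊕ a (suc n) ⊗ (X (suc n) ⊖ X n)           ≡⟨ cong (_⊕ a (suc n) ⊗ (X (suc n) ⊖ X n)) (∑-by-parts n a X) ⟩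
  a 0 ⊗ X 0 ⊕ T ⊕ a (suc n) ⊗ (X (suc n) ⊖ X n)           ≡⟨ ⊕-assoc (a 0 ⊗ X 0) T (a (suc n) ⊗ (X (suc n) ⊖ X n)) ⟩
  a 0 ⊗ X 0 ⊕ (T ⊕ a (suc n) ⊗ (X (suc n) ⊖ X n))         ∎
  where
  open ≡-Reasoning
  S = ∑ n (λ k → (a (k ∸ 1) ⊖ a k) ⊗ X (k ∸ 1))
  T = ∑ n (λ k → a k ⊗ (X k ⊖ X (k ∸ 1)))
  abstract
    eq : ∀ s a b x y → s ⊕ (a ⊖ b) ⊗ x ⊕ b ⊗ y ≡ s ⊕ a ⊗ x ⊕ b ⊗ (y ⊖ x)
    eq = solve-∀ ring

-- Interchange of summation over pairs i ≤ j. The constant `C` stays fixed while `n` varies, so that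
-- the induction closes; for `C` equal to the full sum of `f` the correction term vanishes and the
-- brackets are tails.
∑-by-tails : ∀ n C (f φ : ℕ → ℚ) →
  ∑ n (λ i → φ i ⊗ (C ⊖ ∑ (i ∸ 1) f)) ⊕ ∑ n φ ⊗ (∑ n f ⊖ C) ≡ ∑ n (λ j → f j ⊗ ∑ j φ)
∑-by-tails zero    C f φ = eq C
  where
  abstract
    eq : ∀ C → 0ℚ ⊕ 0ℚ ⊗ (0ℚ ⊖ C) ≡ 0ℚ
    eq = solve-∀ ring
∑-by-tails (suc n) C f φ = trans
  (eq (∑ n (λ i → φ i ⊗ (C ⊖ ∑ (i ∸ 1) f))) (φ (suc n)) C (∑ n f) (∑ n φ) (f (suc n)))
  (cong (_⊕ f (suc n) ⊗ (∑ n φ ⊕ φ (suc n))) (∑-by-tails n C f φ))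
  where
  abstract
    eq : ∀ P x C F Φ y → P ⊕ x ⊗ (C ⊖ F) ⊕ (Φ ⊕ x) ⊗ (F ⊕ y ⊖ C) ≡ P ⊕ Φ ⊗ (F ⊖ C) ⊕ y ⊗ (Φ ⊕ x)
    eq = solve-∀ ring

one : ℕ → ℚ
one _ = 1ℚ

iter : ((ℕ → ℚ) → ℕ → ℚ) → ℕ → (ℕ → ℚ) → ℕ → ℚ
iter T zero    f = f
iter T (suc k) f = T (iter T k f)

iter-suc : ∀ T k f → iter T k (T f) ≡ T (iter T k f)
iter-suc T zero    f = refl
iter-suc T (suc k) f = cong T (iter-suc T k f)

-- Discrete integration at level `M`

module Truncation (M : ℕ) where

  infix 4 _≐_

  -- Arguments beyond `M` would correspond to t > 1, where the weights `c` have become the default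
  -- value 0.
  _≐_ : (ℕ → ℚ) → (ℕ → ℚ) → Set
  f ≐ g = ∀ n → n N.≤ M → f n ≡ g n

  c : ℕ → ℚ
  c i = inv (suc M ∸ i)

  -- Since M - (i-1) = M+1-i, applying `A` to a reversed function f(M-n) sums the very terms that
  -- `B f` sums, from the other end.
  A B : (ℕ → ℚ) → ℕ → ℚ
  A f n = ∑ n (λ i → c i ⊗ f (i ∸ 1))
  B f n = ∑ n (λ i → inv i ⊗ f i)

  A-cong : ∀ {f g} → f ≐ g → A f ≐ A g
  A-cong h n n≤M = ∑-cong n (λ i i<n → cong (c (suc i) ⊗_) (h i (NP.≤-trans (NP.<⇒≤ i<n) n≤M)))

  B-cong : ∀ {f g} → f ≐ g → B f ≐ B g
  B-cong h n n≤M = ∑-cong n (λ i i<n → cong (inv (suc i) ⊗_) (h (suc i) (NP.≤-trans i<n n≤M)))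

  A-⊕ : ∀ f g n → A (λ i → f i ⊕ g i) n ≡ A f n ⊕ A g n
  A-⊕ f g n = trans (∑-cong n (λ i _ → ⊗-distribˡ (c (suc i)) (f i) (g i))) (∑-⊕ n _ _)

  B-⊕ : ∀ f g n → B (λ i → f i ⊕ g i) n ≡ B f n ⊕ B g n
  B-⊕ f g n = trans (∑-cong n (λ i _ → ⊗-distribˡ (inv (suc i)) (f (suc i)) (g (suc i)))) (∑-⊕ n _ _)

  A-⊗ : ∀ a f n → A (λ i → a ⊗ f i) n ≡ a ⊗ A f n
  A-⊗ a f n = trans (∑-cong n (λ i _ → ⊗-exchange (c (suc i)) a (f i))) (∑-⊗ˡ n a (λ i → c i ⊗ f (i ∸ 1)))

  B-⊗ : ∀ a f n → B (λ i → a ⊗ f i) n ≡ a ⊗ B f n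
  B-⊗ a f n = trans (∑-cong n (λ i _ → ⊗-exchange (inv (suc i)) a (f (suc i)))) (∑-⊗ˡ n a (λ i → inv i ⊗ f i))

  A-∑ : ∀ K (a : ℕ → ℚ) (f : ℕ → ℕ → ℚ) n → A (λ i → ∑ K (λ k → f k i ⊗ a k)) n ≡ ∑ K (λ k → A (f k) n ⊗ a k)
  A-∑ K a f n = begin
    ∑ n (λ i → c i ⊗ ∑ K (λ k → f k (i ∸ 1) ⊗ a k))      ≡⟨ ∑-cong n (λ i _ → sym (∑-⊗ˡ K (c (suc i)) (λ k → f k i ⊗ a k))) ⟩
    ∑ n (λ i → ∑ K (λ k → c i ⊗ (f k (i ∸ 1) ⊗ a k)))    ≡⟨ ∑-swap n K (λ i k → c i ⊗ (f k (i ∸ 1) ⊗ a k)) ⟩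
    ∑ K (λ k → ∑ n (λ i → c i ⊗ (f k (i ∸ 1) ⊗ a k)))    ≡⟨ ∑-cong K (λ k _ → trans (∑-cong n (λ i _ → sym (⊗-assoc (c (suc i)) (f (suc k) i) (a (suc k))))) (∑-⊗ʳ n (a (suc k)) (λ i → c i ⊗ f (suc k) (i ∸ 1)))) ⟩
    ∑ K (λ k → A (f k) n ⊗ a k)                          ∎
    where open ≡-Reasoning

  B-∑ : ∀ K (a : ℕ → ℚ) (f : ℕ → ℕ → ℚ) n → B (λ i → ∑ K (λ k → f k i ⊗ a k)) n ≡ ∑ K (λ k → B (f k) n ⊗ a k)
  B-∑ K a f n = begin
    ∑ n (λ i → inv i ⊗ ∑ K (λ k → f k i ⊗ a k))          ≡⟨ ∑-cong n (λ i _ → sym (∑-⊗ˡ K (inv (suc i)) (λ k → f k (suc i) ⊗ a k))) ⟩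
    ∑ n (λ i → ∑ K (λ k → inv i ⊗ (f k i ⊗ a k)))        ≡⟨ ∑-swap n K (λ i k → inv i ⊗ (f k i ⊗ a k)) ⟩
    ∑ K (λ k → ∑ n (λ i → inv i ⊗ (f k i ⊗ a k)))        ≡⟨ ∑-cong K (λ k _ → trans (∑-cong n (λ i _ → sym (⊗-assoc (inv (suc i)) (f (suc k) (suc i)) (a (suc k))))) (∑-⊗ʳ n (a (suc k)) (λ i → inv i ⊗ f (suc k) i))) ⟩
    ∑ K (λ k → B (f k) n ⊗ a k)                          ∎
    where open ≡-Reasoning

  -- u k n is the quotient of binomial coefficients C(n,k) / C(M,k); it plays
  -- the role of the k-th power of the variable n/M.
  u : ℕ → ℕ → ℚ
  u zero    n = 1ℚ
  u (suc k) n = u k n ⊗ (ι (n ∸ k) ⊗ inv (M ∸ k))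

  u-vanish : ∀ {k n} → n N.< k → u k n ≡ 0ℚ
  u-vanish {suc k} {n} (s≤s n≤k) = begin
    u k n ⊗ (ι (n ∸ k) ⊗ inv (M ∸ k))   ≡⟨ cong (λ x → u k n ⊗ (ι x ⊗ inv (M ∸ k))) (NP.m≤n⇒m∸n≡0 n≤k) ⟩
    u k n ⊗ (ι 0 ⊗ inv (M ∸ k))         ≡⟨ cong (λ x → u k n ⊗ (x ⊗ inv (M ∸ k))) ι-zero ⟩
    u k n ⊗ (0ℚ ⊗ inv (M ∸ k))          ≡⟨ cong (u k n ⊗_) (⊗-zeroˡ (inv (M ∸ k))) ⟩
    u k n ⊗ 0ℚ                          ≡⟨ ⊗-zeroʳ (u k n) ⟩
    0ℚ                                  ∎
    where open ≡-Reasoning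

  u-top : ∀ {k} → k N.≤ M → u k M ≡ 1ℚ
  u-top {zero}  _   = refl
  u-top {suc k} k<M = trans (cong₂ _⊗_ (u-top (NP.<⇒≤ k<M)) (trans (⊗-comm (ι (M ∸ k)) (inv (M ∸ k))) (inv-inverse-pos (NP.m<n⇒0<n∸m k<M)))) (⊗-identityˡ 1ℚ)

  -- The absorption identity (k+1) C(j+1,k+1) = (j+1) C(j,k), divided by the same identity for
  -- C(M,k+1).
  u-absorb : ∀ k j → inv (suc j) ⊗ u (suc k) (suc j) ≡ u k j ⊗ inv (M ∸ k)
  u-absorb zero    j = begin
    inv (suc j) ⊗ (1ℚ ⊗ (ι (suc j) ⊗ inv M))   ≡⟨ eq (inv (suc j)) (ι (suc j)) (inv M) ⟩
    inv (suc j) ⊗ ι (suc j) ⊗ inv M            ≡⟨ cong (_⊗ inv M) (inv-inverse j) ⟩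
    1ℚ ⊗ inv M                                 ∎
    where
    open ≡-Reasoning
    abstract
      eq : ∀ a b d → a ⊗ (1ℚ ⊗ (b ⊗ d)) ≡ a ⊗ b ⊗ d
      eq = solve-∀ ring
  u-absorb (suc k) j = begin
    inv (suc j) ⊗ (u (suc k) (suc j) ⊗ (ι (j ∸ k) ⊗ inv (M ∸ suc k)))   ≡⟨ sym (⊗-assoc (inv (suc j)) (u (suc k) (suc j)) _) ⟩
    inv (suc j) ⊗ u (suc k) (suc j) ⊗ (ι (j ∸ k) ⊗ inv (M ∸ suc k))     ≡⟨ cong (_⊗ (ι (j ∸ k) ⊗ inv (M ∸ suc k))) (u-absorb k j) ⟩
    u k j ⊗ inv (M ∸ k) ⊗ (ι (j ∸ k) ⊗ inv (M ∸ suc k))                 ≡⟨ eq (u k j) (inv (M ∸ k)) (ι (j ∸ k)) (inv (M ∸ suc k)) ⟩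
    u k j ⊗ (ι (j ∸ k) ⊗ inv (M ∸ k)) ⊗ inv (M ∸ suc k)                 ∎
    where
    open ≡-Reasoning
    abstract
      eq : ∀ a b d e → a ⊗ b ⊗ (d ⊗ e) ≡ a ⊗ (d ⊗ b) ⊗ e
      eq = solve-∀ ring

  -- Pascal's rule, with the lower binomial coefficient rewritten by absorption. It is the discrete
  -- form of d(t^k) = k t^k dt/t.
  u-suc : ∀ k j → u k (suc j) ≡ u k j ⊕ ι k ⊗ (inv (suc j) ⊗ u k (suc j))
  u-suc zero    j = trans (eq (inv (suc j) ⊗ 1ℚ)) (cong (λ x → 1ℚ ⊕ x ⊗ (inv (suc j) ⊗ 1ℚ)) (sym ι-zero))
    where
    abstract
      eq : ∀ x → 1ℚ ≡ 1ℚ ⊕ 0ℚ ⊗ x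
      eq = solve-∀ ring
  u-suc (suc k) j = begin
    u (suc k) (suc j)                                       ≡⟨ sym (inv-cancel j (u (suc k) (suc j))) ⟩
    ι (suc j) ⊗ (inv (suc j) ⊗ u (suc k) (suc j))           ≡⟨ cong (ι (suc j) ⊗_) (u-absorb k j) ⟩
    ι (suc j) ⊗ (u k j ⊗ w)                                 ≡⟨ split (k N.≤? j) ⟩
    u k j ⊗ (ι (j ∸ k) ⊗ w) ⊕ ι (suc k) ⊗ (u k j ⊗ w)       ≡⟨ cong (λ x → u (suc k) j ⊕ ι (suc k) ⊗ x) (sym (u-absorb k j)) ⟩
    u (suc k) j ⊕ ι (suc k) ⊗ (inv (suc j) ⊗ u (suc k) (suc j)) ∎
    where
    open ≡-Reasoning
    w = inv (M ∸ k)
    abstract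
      eq₁ : ∀ a b x w → (a ⊕ b) ⊗ (x ⊗ w) ≡ x ⊗ (b ⊗ w) ⊕ a ⊗ (x ⊗ w)
      eq₁ = solve-∀ ring
      eq₂ : ∀ a b d w → a ⊗ (0ℚ ⊗ w) ≡ 0ℚ ⊗ (b ⊗ w) ⊕ d ⊗ (0ℚ ⊗ w)
      eq₂ = solve-∀ ring
    split : Dec (k N.≤ j) → ι (suc j) ⊗ (u k j ⊗ w) ≡ u k j ⊗ (ι (j ∸ k) ⊗ w) ⊕ ι (suc k) ⊗ (u k j ⊗ w)
    split (yes k≤j) = trans
      (cong (_⊗ (u k j ⊗ w)) (trans (cong (λ x → ι (suc x)) (sym (NP.m+[n∸m]≡n k≤j))) (ι-+ (suc k) (j ∸ k))))
      (eq₁ (ι (suc k)) (ι (j ∸ k)) (u k j) w)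
    -- Here j - k is truncated to 0, but `u k j` is a factor of every term and vanishes.
    split (no k≰j) = subst (λ x → ι (suc j) ⊗ (x ⊗ w) ≡ x ⊗ (ι (j ∸ k) ⊗ w) ⊕ ι (suc k) ⊗ (x ⊗ w))
      (sym (u-vanish (NP.≰⇒> k≰j))) (eq₂ (ι (suc j)) (ι (j ∸ k)) (ι (suc k)) w)

  -- Discrete form of (t^k - t^(k+1))/(1-t) = t^k. The quotient of consecutive `u` gives the factor
  -- 1 - (j-k)/(M-k) = (M-j)/(M-k), whose numerator cancels against `c (suc j)`; absorption does the
  -- rest.
  c⊗Δu : ∀ k {j} → j N.< M → c (suc j) ⊗ (u k j ⊖ u (suc k) j) ≡ inv (suc j) ⊗ u (suc k) (suc j)
  c⊗Δu k {j} j<M = trans (split (k N.≤? j)) (sym (u-absorb k j))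
    where
    open ≡-Reasoning
    w = inv (M ∸ k)
    abstract
      eq₁ : ∀ r x a w → r ⊗ (x ⊖ x ⊗ (a ⊗ w)) ≡ x ⊗ (r ⊗ (1ℚ ⊖ w ⊗ a))
      eq₁ = solve-∀ ring
      eq₂ : ∀ r w a b → r ⊗ (w ⊗ (a ⊕ b) ⊖ w ⊗ a) ≡ r ⊗ b ⊗ w
      eq₂ = solve-∀ ring
      eq₃ : ∀ r a w → r ⊗ (0ℚ ⊖ 0ℚ ⊗ (a ⊗ w)) ≡ 0ℚ ⊗ w
      eq₃ = solve-∀ ring
    split : Dec (k N.≤ j) → c (suc j) ⊗ (u k j ⊖ u k j ⊗ (ι (j ∸ k) ⊗ w)) ≡ u k j ⊗ w
    split (yes k≤j) = begin
      inv (M ∸ j) ⊗ (u k j ⊖ u k j ⊗ (ι (j ∸ k) ⊗ w))                            ≡⟨ eq₁ (inv (M ∸ j)) (u k j) (ι (j ∸ k)) w ⟩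
      u k j ⊗ (inv (M ∸ j) ⊗ (1ℚ ⊖ w ⊗ ι (j ∸ k)))                               ≡⟨ cong (λ x → u k j ⊗ (inv (M ∸ j) ⊗ (x ⊖ w ⊗ ι (j ∸ k)))) (sym (inv-inverse-pos (NP.m<n⇒0<n∸m (NP.≤-<-trans k≤j j<M)))) ⟩
      u k j ⊗ (inv (M ∸ j) ⊗ (w ⊗ ι (M ∸ k) ⊖ w ⊗ ι (j ∸ k)))                    ≡⟨ cong (λ x → u k j ⊗ (inv (M ∸ j) ⊗ (w ⊗ x ⊖ w ⊗ ι (j ∸ k)))) (trans (cong ι M∸k) (ι-+ (j ∸ k) (M ∸ j))) ⟩
      u k j ⊗ (inv (M ∸ j) ⊗ (w ⊗ (ι (j ∸ k) ⊕ ι (M ∸ j)) ⊖ w ⊗ ι (j ∸ k)))      ≡⟨ cong (u k j ⊗_) (eq₂ (inv (M ∸ j)) w (ι (j ∸ k)) (ι (M ∸ j))) ⟩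
      u k j ⊗ (inv (M ∸ j) ⊗ ι (M ∸ j) ⊗ w)                                      ≡⟨ cong (λ x → u k j ⊗ (x ⊗ w)) (inv-inverse-pos (NP.m<n⇒0<n∸m j<M)) ⟩
      u k j ⊗ (1ℚ ⊗ w)                                                           ≡⟨ cong (u k j ⊗_) (⊗-identityˡ w) ⟩
      u k j ⊗ w                                                                  ∎
      where
      M∸k : M ∸ k ≡ (j ∸ k) N.+ (M ∸ j)
      M∸k = trans (cong (_∸ k) (sym (NP.m+[n∸m]≡n (NP.<⇒≤ j<M)))) (NP.+-∸-comm (M ∸ j) k≤j)
    split (no k≰j) = subst (λ x → c (suc j) ⊗ (x ⊖ x ⊗ (ι (j ∸ k) ⊗ w)) ≡ x ⊗ w)
      (sym (u-vanish (NP.≰⇒> k≰j))) (eq₃ (c (suc j)) (ι (j ∸ k)) w)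

  B-u : ∀ k n → B (u (suc k)) n ≡ inv (suc k) ⊗ u (suc k) n
  B-u k n = begin
    B (u (suc k)) n                                              ≡⟨ ∑-telescope n (λ i → inv i ⊗ u (suc k) i) (λ j → inv (suc k) ⊗ u (suc k) j) (λ j _ → step j) ⟩
    inv (suc k) ⊗ u (suc k) n ⊖ inv (suc k) ⊗ u (suc k) 0        ≡⟨ cong (λ x → inv (suc k) ⊗ u (suc k) n ⊖ inv (suc k) ⊗ x) (u-vanish {suc k} {0} (s≤s z≤n)) ⟩
    inv (suc k) ⊗ u (suc k) n ⊖ inv (suc k) ⊗ 0ℚ                 ≡⟨ eq₂ (inv (suc k) ⊗ u (suc k) n) (inv (suc k)) ⟩
    inv (suc k) ⊗ u (suc k) n                                    ∎
    where
    open ≡-Reasoning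
    abstract
      eq₁ : ∀ i x y a → i ⊗ (x ⊕ a ⊗ y) ≡ i ⊗ x ⊕ a ⊗ (i ⊗ y)
      eq₁ = solve-∀ ring
      eq₂ : ∀ x y → x ⊖ y ⊗ 0ℚ ≡ x
      eq₂ = solve-∀ ring
    step : ∀ j → inv (suc k) ⊗ u (suc k) (suc j) ≡ inv (suc k) ⊗ u (suc k) j ⊕ inv (suc j) ⊗ u (suc k) (suc j)
    step j = trans (cong (inv (suc k) ⊗_) (u-suc (suc k) j))
      (trans (eq₁ (inv (suc k)) (u (suc k) j) (inv (suc j) ⊗ u (suc k) (suc j)) (ι (suc k)))
        (cong (inv (suc k) ⊗ u (suc k) j ⊕_) (inv-cancel k (inv (suc j) ⊗ u (suc k) (suc j)))))

  A-Δu : ∀ k n → n N.≤ M → A (u k) n ⊖ A (u (suc k)) n ≡ inv (suc k) ⊗ u (suc k) n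
  A-Δu k n n≤M = begin
    A (u k) n ⊖ A (u (suc k)) n                                         ≡⟨ sym (∑-⊖ n (λ i → c i ⊗ u k (i ∸ 1)) (λ i → c i ⊗ u (suc k) (i ∸ 1))) ⟩
    ∑ n (λ i → c i ⊗ u k (i ∸ 1) ⊖ c i ⊗ u (suc k) (i ∸ 1))             ≡⟨ ∑-cong n (λ i i<n → trans (eq (c (suc i)) (u k i) (u (suc k) i)) (c⊗Δu k (NP.≤-trans i<n n≤M))) ⟩
    B (u (suc k)) n                                                     ≡⟨ B-u k n ⟩
    inv (suc k) ⊗ u (suc k) n                                           ∎
    where
    open ≡-Reasoning
    abstract
      eq : ∀ a x y → a ⊗ x ⊖ a ⊗ y ≡ a ⊗ (x ⊖ y)
      eq = solve-∀ ring

  A-u-M : ∀ n → n N.≤ M → A (u M) n ≡ 0ℚ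
  A-u-M n n≤M = trans (∑-cong n (λ i i<n → trans (cong (c (suc i) ⊗_) (u-vanish (NP.≤-trans i<n n≤M))) (⊗-zeroʳ (c (suc i))))) (∑-zero n)

  -- Discrete multiple polylogarithms in one variable

  Z : List ℕ → ℕ → ℚ
  Z []       n = 1ℚ
  Z (s ∷ ss) n = ∑ M (λ k → u k n ⊗ (ipow k s ⊗ ζ (k ∸ 1) ss))

  Z-top : ∀ ss → Z ss M ≡ ζ M ss
  Z-top []       = refl
  Z-top (s ∷ ss) = ∑-cong M (λ k k<M → trans (cong (_⊗ (ipow (suc k) s ⊗ ζ k ss)) (u-top k<M)) (⊗-identityˡ (ipow (suc k) s ⊗ ζ k ss)))

  Z-B : ∀ s ss n → B (Z (s ∷ ss)) n ≡ Z (suc s ∷ ss) n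
  Z-B s ss n = trans (B-∑ M (λ k → ipow k s ⊗ ζ (k ∸ 1) ss) u n)
    (∑-cong M (λ k _ → trans (cong (_⊗ (ipow (suc k) s ⊗ ζ k ss)) (B-u k n)) (eq (inv (suc k)) (u (suc k) n) (ipow (suc k) s) (ζ k ss))))
    where
    abstract
      eq : ∀ i x p z → i ⊗ x ⊗ (p ⊗ z) ≡ x ⊗ (i ⊗ p ⊗ z)
      eq = solve-∀ ring

  -- In place of the geometric series for 1/(1-t), only the differences of `A (u k)` are used: Abel
  -- summation moves the difference onto the partial sums `ζ k ss`, whose increments are the
  -- coefficients of `Z ss`. The upper boundary term vanishes because `u M` is zero below `M`.
  Z-A : ∀ ss n → n N.≤ M → A (Z ss) n ≡ Z (1 ∷ ss) n
  Z-A ss n n≤M = sym (begin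
    Z (1 ∷ ss) n                                                         ≡⟨ ∑-cong M (λ k _ → trans (eq₁ (u (suc k) n) (inv (suc k)) (X k)) (cong (_⊗ X k) (sym (A-Δu k n n≤M)))) ⟩
    ∑ M (λ k → (a (k ∸ 1) ⊖ a k) ⊗ X (k ∸ 1))                            ≡⟨ eq₂ (∑ M (λ k → (a (k ∸ 1) ⊖ a k) ⊗ X (k ∸ 1))) (X M) ⟩
    ∑ M (λ k → (a (k ∸ 1) ⊖ a k) ⊗ X (k ∸ 1)) ⊕ 0ℚ ⊗ X M                 ≡⟨ cong (λ x → ∑ M (λ k → (a (k ∸ 1) ⊖ a k) ⊗ X (k ∸ 1)) ⊕ x ⊗ X M) (sym (A-u-M n n≤M)) ⟩
    ∑ M (λ k → (a (k ∸ 1) ⊖ a k) ⊗ X (k ∸ 1)) ⊕ a M ⊗ X M                ≡⟨ ∑-by-parts M a X ⟩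
    a 0 ⊗ X 0 ⊕ ∑ M (λ k → a k ⊗ (X k ⊖ X (k ∸ 1)))                      ≡⟨ rest ss ⟩
    A (Z ss) n                                                           ∎)
    where
    open ≡-Reasoning
    a X : ℕ → ℚ
    a k = A (u k) n
    X k = ζ k ss
    abstract
      eq₁ : ∀ x i y → x ⊗ (i ⊗ 1ℚ ⊗ y) ≡ i ⊗ x ⊗ y
      eq₁ = solve-∀ ring
      eq₂ : ∀ x y → x ≡ x ⊕ 0ℚ ⊗ y
      eq₂ = solve-∀ ring
      eq₃ : ∀ x → x ⊗ (1ℚ ⊖ 1ℚ) ≡ 0ℚ
      eq₃ = solve-∀ ring
      eq₄ : ∀ x y → x ⊗ 0ℚ ⊕ y ≡ y
      eq₄ = solve-∀ ring
      eq₅ : ∀ x y → x ⊕ y ⊖ x ≡ y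
      eq₅ = solve-∀ ring
    -- For the empty list the increments vanish and the lower boundary term is the whole value;
    -- otherwise `ζ 0` is an empty sum and only the increments remain.
    rest : ∀ ss → a 0 ⊗ ζ 0 ss ⊕ ∑ M (λ k → a k ⊗ (ζ k ss ⊖ ζ (k ∸ 1) ss)) ≡ A (Z ss) n
    rest []        = trans (cong₂ _⊕_ (⊗-identityʳ (a 0)) (trans (∑-cong M (λ k _ → eq₃ (a (suc k)))) (∑-zero M))) (⊕-identityʳ (a 0))
    rest (s ∷ ss′) = begin
      a 0 ⊗ 0ℚ ⊕ ∑ M (λ k → a k ⊗ (ζ k (s ∷ ss′) ⊖ ζ (k ∸ 1) (s ∷ ss′)))   ≡⟨ eq₄ (a 0) _ ⟩
      ∑ M (λ k → a k ⊗ (ζ k (s ∷ ss′) ⊖ ζ (k ∸ 1) (s ∷ ss′)))              ≡⟨ ∑-cong M (λ k _ → cong (a (suc k) ⊗_) (eq₅ (ζ k (s ∷ ss′)) (ipow (suc k) s ⊗ ζ k ss′))) ⟩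
      ∑ M (λ k → a k ⊗ (ipow k s ⊗ ζ (k ∸ 1) ss′))                         ≡⟨ sym (A-∑ M (λ k → ipow k s ⊗ ζ (k ∸ 1) ss′) u n) ⟩
      A (Z (s ∷ ss′)) n                                                    ∎

  iter-cong : ∀ {T} → (∀ {f g} → f ≐ g → T f ≐ T g) → ∀ k {f g} → f ≐ g → iter T k f ≐ iter T k g
  iter-cong T-cong zero    h = h
  iter-cong T-cong (suc k) h = T-cong (iter-cong T-cong k h)

  Z-iterB : ∀ m s ss → iter B m (Z (s ∷ ss)) ≐ Z (m N.+ s ∷ ss)
  Z-iterB zero    s ss n n≤M = refl
  Z-iterB (suc m) s ss n n≤M = trans (B-cong (Z-iterB m s ss) n n≤M) (Z-B (m N.+ s) ss n)

  -- Reflection and the discrete logarithm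

  ∑-reflect : ∀ (φ : ℕ → ℚ) j → j N.≤ M → ∑ j (λ i → φ (suc M ∸ i)) ⊕ ∑ (M ∸ j) φ ≡ ∑ M φ
  ∑-reflect φ zero    _   = ⊕-identityˡ (∑ M φ)
  ∑-reflect φ (suc j) j<M = begin
    S ⊕ φ (M ∸ j) ⊕ ∑ (M ∸ suc j) φ            ≡⟨ eq S (φ (M ∸ j)) (∑ (M ∸ suc j) φ) ⟩
    S ⊕ (∑ (M ∸ suc j) φ ⊕ φ (M ∸ j))          ≡⟨ cong (λ x → S ⊕ (∑ (M ∸ suc j) φ ⊕ φ x)) M∸j ⟩
    S ⊕ ∑ (suc (M ∸ suc j)) φ                  ≡⟨ cong (λ x → S ⊕ ∑ x φ) (sym M∸j) ⟩
    S ⊕ ∑ (M ∸ j) φ                            ≡⟨ ∑-reflect φ j (NP.<⇒≤ j<M) ⟩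
    ∑ M φ                                      ∎
    where
    open ≡-Reasoning
    S = ∑ j (λ i → φ (suc M ∸ i))
    M∸j : M ∸ j ≡ suc (M ∸ suc j)
    M∸j = NP.+-∸-assoc 1 j<M
    abstract
      eq : ∀ a b d → a ⊕ b ⊕ d ≡ a ⊕ (d ⊕ b)
      eq = solve-∀ ring

  -- ℓ corresponds to minus the logarithm of the variable.
  ℓ : ℕ → ℚ
  ℓ n = H M ⊖ H n

  ℓ-suc : ∀ i → ℓ i ≡ ℓ (suc i) ⊕ inv (suc i)
  ℓ-suc i = eq (H M) (H i) (inv (suc i))
    where
    abstract
      eq : ∀ a b d → a ⊖ b ≡ a ⊖ (b ⊕ d) ⊕ d
      eq = solve-∀ ring

  ℓ-top : ℓ M ≡ 0ℚ
  ℓ-top = ⊖-self (H M)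

  A-one : ∀ j → j N.≤ M → A one j ≡ ℓ (M ∸ j)
  A-one j j≤M = begin
    A one j                                                   ≡⟨ ∑-cong j (λ i _ → ⊗-identityʳ (c (suc i))) ⟩
    ∑ j c                                                     ≡⟨ eq (∑ j c) (H (M ∸ j)) ⟩
    ∑ j c ⊕ H (M ∸ j) ⊖ H (M ∸ j)                             ≡⟨ cong (_⊖ H (M ∸ j)) (∑-reflect inv j j≤M) ⟩
    ℓ (M ∸ j)                                                 ∎
    where
    open ≡-Reasoning
    abstract
      eq : ∀ a b → a ≡ a ⊕ b ⊖ b
      eq = solve-∀ ring

  ℓ≡A-one : ∀ j → j N.≤ M → ℓ j ≡ A one (M ∸ j)
  ℓ≡A-one j j≤M = sym (trans (A-one (M ∸ j) (NP.m∸n≤m M j)) (cong ℓ (NP.m∸[m∸n]≡n j≤M)))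

  -- Integration against powers of -log(1-t)

  -- g m stands for (-log(1-t))^m/m!, and Γ m f for the integral of f g_m, the
  -- measure being part of f.
  g : ℕ → ℕ → ℚ
  g zero    j = 1ℚ
  g (suc m) j = ∑ j (λ i → c i ⊗ g m i)

  Γ : ℕ → (ℕ → ℚ) → ℚ
  Γ m f = ∑ M (λ j → f j ⊗ g m j)

  Γ-cong : ∀ m {f f′} → (∀ i → i N.< M → f (suc i) ≡ f′ (suc i)) → Γ m f ≡ Γ m f′
  Γ-cong m h = ∑-cong M (λ i i<M → cong (_⊗ g m (suc i)) (h i i<M))

  Γ-⊕ : ∀ m f f′ → Γ m (λ i → f i ⊕ f′ i) ≡ Γ m f ⊕ Γ m f′
  Γ-⊕ m f f′ = trans (∑-cong M (λ i _ → ⊗-distribʳ (g m (suc i)) (f (suc i)) (f′ (suc i)))) (∑-⊕ M _ _)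

  Γ-⊖ : ∀ m f f′ → Γ m (λ i → f i ⊖ f′ i) ≡ Γ m f ⊖ Γ m f′
  Γ-⊖ m f f′ = trans (∑-cong M (λ i _ → eq (f (suc i)) (f′ (suc i)) (g m (suc i)))) (∑-⊖ M _ _)
    where
    abstract
      eq : ∀ a b d → (a ⊖ b) ⊗ d ≡ a ⊗ d ⊖ b ⊗ d
      eq = solve-∀ ring

  Γ-⊗ : ∀ m a f → Γ m (λ i → a ⊗ f i) ≡ a ⊗ Γ m f
  Γ-⊗ m a f = trans (∑-cong M (λ i _ → ⊗-assoc a (f (suc i)) (g m (suc i)))) (∑-⊗ˡ M a (λ i → f i ⊗ g m i))

  Γ-∑ : ∀ m K (f : ℕ → ℕ → ℚ) → Γ m (λ i → ∑ K (λ k → f k i)) ≡ ∑ K (λ k → Γ m (f k))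
  Γ-∑ m K f = trans (∑-cong M (λ i _ → sym (∑-⊗ʳ K (g m (suc i)) (λ k → f k (suc i))))) (∑-swap M K (λ i k → f k i ⊗ g m i))

  -- The outermost sum of `g` is interchanged with that of `Γ`, which replaces `f` by its weighted
  -- tails. This is the integration by parts behind every induction on `m`; tails are kept as
  -- differences because the sums of `v` and `w` have closed forms.
  Γ-suc : ∀ m f → Γ (suc m) f ≡ Γ m (λ i → c i ⊗ (∑ M f ⊖ ∑ (i ∸ 1) f))
  Γ-suc m f = begin
    ∑ M (λ j → f j ⊗ ∑ j φ)                                                   ≡⟨ sym (∑-by-tails M (∑ M f) f φ) ⟩
    ∑ M (λ i → φ i ⊗ (∑ M f ⊖ ∑ (i ∸ 1) f)) ⊕ ∑ M φ ⊗ (∑ M f ⊖ ∑ M f)         ≡⟨ eq₁ (∑ M (λ i → φ i ⊗ (∑ M f ⊖ ∑ (i ∸ 1) f))) (∑ M φ) (∑ M f) ⟩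
    ∑ M (λ i → φ i ⊗ (∑ M f ⊖ ∑ (i ∸ 1) f))                                   ≡⟨ ∑-cong M (λ i _ → eq₂ (c (suc i)) (g m (suc i)) (∑ M f ⊖ ∑ i f)) ⟩
    Γ m (λ i → c i ⊗ (∑ M f ⊖ ∑ (i ∸ 1) f))                                   ∎
    where
    open ≡-Reasoning
    φ : ℕ → ℚ
    φ i = c i ⊗ g m i
    abstract
      eq₁ : ∀ a b d → a ⊕ b ⊗ (d ⊖ d) ≡ a
      eq₁ = solve-∀ ring
      eq₂ : ∀ a b d → a ⊗ b ⊗ d ≡ a ⊗ d ⊗ b
      eq₂ = solve-∀ ring

  -- A tail of a reversed sequence is an initial sum of the original one, and `c i` is the
  -- reciprocal of the reflected index. So each factor removed from `g` becomes one application of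
  -- `B`.
  Γ-reflect : ∀ m φ → Γ m (λ j → φ (suc M ∸ j)) ≡ iter B m (λ n → ∑ n φ) M
  Γ-reflect zero    φ = trans (∑-cong M (λ i _ → ⊗-identityʳ (φ (M ∸ i)))) (∑-reverse M φ)
  Γ-reflect (suc m) φ = begin
    Γ (suc m) f                                            ≡⟨ Γ-suc m f ⟩
    Γ m (λ i → c i ⊗ (∑ M f ⊖ ∑ (i ∸ 1) f))                ≡⟨ Γ-cong m (λ j j<M → cong (c (suc j) ⊗_) (tail j j<M)) ⟩
    Γ m (λ i → c i ⊗ ∑ (suc M ∸ i) φ)                      ≡⟨ Γ-reflect m (λ i → inv i ⊗ ∑ i φ) ⟩
    iter B m (B (λ n → ∑ n φ)) M                           ≡⟨ cong (λ h → h M) (iter-suc B m (λ n → ∑ n φ)) ⟩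
    iter B (suc m) (λ n → ∑ n φ) M                         ∎
    where
    open ≡-Reasoning
    f : ℕ → ℚ
    f j = φ (suc M ∸ j)
    abstract
      eq : ∀ a b → a ⊕ b ⊖ a ≡ b
      eq = solve-∀ ring
    tail : ∀ j → j N.< M → ∑ M f ⊖ ∑ j f ≡ ∑ (M ∸ j) φ
    tail j j<M = trans (cong (_⊖ ∑ j f) (trans (∑-reverse M φ) (sym (∑-reflect φ j (NP.<⇒≤ j<M))))) (eq (∑ j f) (∑ (M ∸ j) φ))

  -- The integral of (-log t)(-log(1-t))^m/m! dt/(1-t). It is the source of the products with single
  -- zeta values on the left-hand side.
  Γ-ℓ : ∀ m → Γ m (λ i → c i ⊗ ℓ (i ∸ 1)) ≡ ζ M (suc (suc m) ∷ [])
  Γ-ℓ m = begin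
    Γ m (λ i → c i ⊗ ℓ (i ∸ 1))                 ≡⟨ Γ-cong m (λ j j<M → cong (c (suc j) ⊗_) (ℓ≡A-one j (NP.<⇒≤ j<M))) ⟩
    Γ m (λ i → c i ⊗ A one (suc M ∸ i))         ≡⟨ Γ-reflect m (λ i → inv i ⊗ A one i) ⟩
    iter B m (B (A one)) M                      ≡⟨ cong (λ h → h M) (iter-suc B m (A one)) ⟩
    iter B (suc m) (A one) M                    ≡⟨ iter-cong B-cong (suc m) (Z-A []) M NP.≤-refl ⟩
    iter B (suc m) (Z (1 ∷ [])) M               ≡⟨ Z-iterB (suc m) 1 [] M NP.≤-refl ⟩
    Z (suc (m N.+ 1) ∷ []) M                    ≡⟨ cong (λ s → Z (suc s ∷ []) M) (NP.+-comm m 1) ⟩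
    Z (suc (suc m) ∷ []) M                      ≡⟨ Z-top (suc (suc m) ∷ []) ⟩
    ζ M (suc (suc m) ∷ [])                      ∎
    where open ≡-Reasoning

  -- Geometric sums and moments of the discrete powers

  c⊗[1-u] : ∀ K {j} → j N.< M → c (suc j) ⊗ (1ℚ ⊖ u K j) ≡ ∑ K (λ l → inv (suc j) ⊗ u l (suc j))
  c⊗[1-u] zero    {j} j<M = eq (c (suc j))
    where
    abstract
      eq : ∀ a → a ⊗ (1ℚ ⊖ 1ℚ) ≡ 0ℚ
      eq = solve-∀ ring
  c⊗[1-u] (suc K) {j} j<M = trans (eq (c (suc j)) (u K j) (u (suc K) j)) (cong₂ _⊕_ (c⊗[1-u] K j<M) (c⊗Δu K j<M))
    where
    abstract
      eq : ∀ a x y → a ⊗ (1ℚ ⊖ y) ≡ a ⊗ (1ℚ ⊖ x) ⊕ a ⊗ (x ⊖ y)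
      eq = solve-∀ ring

  -- The integrands t^k dt/t and t^k (-log t) dt/t. The lag in `ℓ (j ∸ 1)` matches the step from j
  -- to j+1 in `c⊗[1-u]`, so that the recursion for `w` reproduces `w` without remainder.
  v w : ℕ → ℕ → ℚ
  v k j = inv j ⊗ u k j
  w k j = inv j ⊗ (u k j ⊗ ℓ (j ∸ 1))

  -- Integrating t^(k+1) leaves (1 - t^(k+1))/(1-t), a geometric sum of lower moments. It includes
  -- the exponent of the moment itself, whence star sums.
  Γ-v : ∀ m k → suc k N.≤ M → Γ m (v (suc k)) ≡ inv (suc k) ⊗ ζ⋆ (suc k) (ones m)
  Γ-v zero    k k<M = begin
    ∑ M (λ j → v (suc k) j ⊗ 1ℚ)    ≡⟨ ∑-cong M (λ i _ → ⊗-identityʳ (v (suc k) (suc i))) ⟩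
    B (u (suc k)) M                 ≡⟨ B-u k M ⟩
    inv (suc k) ⊗ u (suc k) M       ≡⟨ cong (inv (suc k) ⊗_) (u-top k<M) ⟩
    inv (suc k) ⊗ 1ℚ                ∎
    where open ≡-Reasoning
  Γ-v (suc m) k k<M = begin
    Γ (suc m) (v (suc k))                                               ≡⟨ Γ-suc m (v (suc k)) ⟩
    Γ m (λ i → c i ⊗ (∑ M (v (suc k)) ⊖ ∑ (i ∸ 1) (v (suc k))))         ≡⟨ Γ-cong m tail ⟩
    Γ m (λ i → r ⊗ ∑ (suc k) (λ l → v l i))                             ≡⟨ Γ-⊗ m r (λ i → ∑ (suc k) (λ l → v l i)) ⟩
    r ⊗ Γ m (λ i → ∑ (suc k) (λ l → v l i))                             ≡⟨ cong (r ⊗_) (Γ-∑ m (suc k) v) ⟩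
    r ⊗ ∑ (suc k) (λ l → Γ m (v l))                                     ≡⟨ cong (r ⊗_) (∑-cong (suc k) (λ l l≤k → trans (Γ-v m l (NP.≤-trans l≤k k<M)) (cong (_⊗ ζ⋆ (suc l) (ones m)) (sym (⊗-identityʳ (inv (suc l))))))) ⟩
    r ⊗ ζ⋆ (suc k) (ones (suc m))                                       ∎
    where
    open ≡-Reasoning
    r = inv (suc k)
    abstract
      eq : ∀ a r x → a ⊗ (r ⊗ 1ℚ ⊖ r ⊗ x) ≡ r ⊗ (a ⊗ (1ℚ ⊖ x))
      eq = solve-∀ ring
    tail : ∀ j → j N.< M → c (suc j) ⊗ (∑ M (v (suc k)) ⊖ ∑ j (v (suc k))) ≡ r ⊗ ∑ (suc k) (λ l → v l (suc j))
    tail j j<M = begin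
      c (suc j) ⊗ (B (u (suc k)) M ⊖ B (u (suc k)) j)       ≡⟨ cong₂ (λ x y → c (suc j) ⊗ (x ⊖ y)) (trans (B-u k M) (cong (r ⊗_) (u-top k<M))) (B-u k j) ⟩
      c (suc j) ⊗ (r ⊗ 1ℚ ⊖ r ⊗ u (suc k) j)                ≡⟨ eq (c (suc j)) r (u (suc k) j) ⟩
      r ⊗ (c (suc j) ⊗ (1ℚ ⊖ u (suc k) j))                  ≡⟨ cong (r ⊗_) (c⊗[1-u] (suc k) j<M) ⟩
      r ⊗ ∑ (suc k) (λ l → v l (suc j))                     ∎

  -- The antiderivative t^k (-log t)/k + t^k/k^2. It is exact because `w` takes the logarithm at the
  -- left end of each step, leaving no product of increments.
  ∑-w : ∀ k n → ∑ n (w (suc k)) ≡ inv (suc k) ⊗ (u (suc k) n ⊗ (ℓ n ⊕ inv (suc k)))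
  ∑-w k n = begin
    ∑ n (w (suc k))        ≡⟨ ∑-telescope n (w (suc k)) F (λ j _ → step j) ⟩
    F n ⊖ F 0              ≡⟨ cong (λ x → F n ⊖ r ⊗ (x ⊗ (ℓ 0 ⊕ r))) (u-vanish {suc k} {0} (s≤s z≤n)) ⟩
    F n ⊖ r ⊗ (0ℚ ⊗ (ℓ 0 ⊕ r))  ≡⟨ eq₀ (F n) r (ℓ 0 ⊕ r) ⟩
    F n                    ∎
    where
    open ≡-Reasoning
    r = inv (suc k)
    F : ℕ → ℚ
    F j = r ⊗ (u (suc k) j ⊗ (ℓ j ⊕ r))
    abstract
      eq₀ : ∀ a b d → a ⊖ b ⊗ (0ℚ ⊗ d) ≡ a
      eq₀ = solve-∀ ring
      eq₁ : ∀ r U κ y l i → r ⊗ ((U ⊕ κ ⊗ y) ⊗ (l ⊕ r)) ≡ r ⊗ (U ⊗ (l ⊕ i ⊕ r)) ⊕ (r ⊗ κ ⊗ y ⊗ (l ⊕ r) ⊖ r ⊗ U ⊗ i)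
      eq₁ = solve-∀ ring
      eq₂ : ∀ r U κ y i → r ⊗ U ⊗ i ≡ r ⊗ ((U ⊕ κ ⊗ y) ⊗ i) ⊖ r ⊗ κ ⊗ y ⊗ i
      eq₂ = solve-∀ ring
      eq₃ : ∀ r U′ l i → 1ℚ ⊗ (i ⊗ U′) ⊗ (l ⊕ r) ⊖ (r ⊗ (U′ ⊗ i) ⊖ 1ℚ ⊗ (i ⊗ U′) ⊗ i) ≡ i ⊗ (U′ ⊗ (l ⊕ i))
      eq₃ = solve-∀ ring
    step : ∀ j → F (suc j) ≡ F j ⊕ w (suc k) (suc j)
    step j = begin
      r ⊗ (U′ ⊗ (l ⊕ r))                                                               ≡⟨ cong (λ x → r ⊗ (x ⊗ (l ⊕ r))) U′≡ ⟩
      r ⊗ ((U ⊕ κ ⊗ y) ⊗ (l ⊕ r))                                                      ≡⟨ eq₁ r U κ y l i ⟩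
      r ⊗ (U ⊗ (l ⊕ i ⊕ r)) ⊕ (r ⊗ κ ⊗ y ⊗ (l ⊕ r) ⊖ r ⊗ U ⊗ i)                        ≡⟨ cong₂ (λ a b → r ⊗ (U ⊗ (a ⊕ r)) ⊕ (r ⊗ κ ⊗ y ⊗ (l ⊕ r) ⊖ b)) (sym (ℓ-suc j)) (eq₂ r U κ y i) ⟩
      F j ⊕ (r ⊗ κ ⊗ y ⊗ (l ⊕ r) ⊖ (r ⊗ ((U ⊕ κ ⊗ y) ⊗ i) ⊖ r ⊗ κ ⊗ y ⊗ i))            ≡⟨ cong₂ (λ a b → F j ⊕ (a ⊗ y ⊗ (l ⊕ r) ⊖ (r ⊗ (b ⊗ i) ⊖ a ⊗ y ⊗ i))) (inv-inverse k) (sym U′≡) ⟩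
      F j ⊕ (1ℚ ⊗ y ⊗ (l ⊕ r) ⊖ (r ⊗ (U′ ⊗ i) ⊖ 1ℚ ⊗ y ⊗ i))                           ≡⟨ cong (F j ⊕_) (eq₃ r U′ l i) ⟩
      F j ⊕ i ⊗ (U′ ⊗ (l ⊕ i))                                                         ≡⟨ cong (λ a → F j ⊕ i ⊗ (U′ ⊗ a)) (sym (ℓ-suc j)) ⟩
      F j ⊕ w (suc k) (suc j)                                                          ∎
      where
      U = u (suc k) j
      U′ = u (suc k) (suc j)
      κ = ι (suc k)
      i = inv (suc j)
      y = i ⊗ U′
      l = ℓ (suc j)
      U′≡ : U′ ≡ U ⊕ κ ⊗ y
      U′≡ = u-suc (suc k) j

  -- b m k / k is the discrete ∫ t^k (-log t) (-log(1-t))^m/m! dt/t.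
  b : ℕ → ℕ → ℚ
  b zero    k = inv k
  b (suc m) k = inv k ⊗ ζ⋆ k (ones (suc m)) ⊖ ζ M (suc (suc m) ∷ []) ⊕ ∑ k (λ l → inv l ⊗ b m l)

  Γ-w : ∀ m k → suc k N.≤ M → Γ m (w (suc k)) ≡ inv (suc k) ⊗ b m (suc k)
  Γ-w zero    k k<M = begin
    ∑ M (λ j → w (suc k) j ⊗ 1ℚ)                 ≡⟨ ∑-cong M (λ i _ → ⊗-identityʳ (w (suc k) (suc i))) ⟩
    ∑ M (w (suc k))                              ≡⟨ ∑-w k M ⟩
    r ⊗ (u (suc k) M ⊗ (ℓ M ⊕ r))                ≡⟨ cong₂ (λ x y → r ⊗ (x ⊗ (y ⊕ r))) (u-top k<M) ℓ-top ⟩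
    r ⊗ (1ℚ ⊗ (0ℚ ⊕ r))                          ≡⟨ eq r ⟩
    r ⊗ r                                        ∎
    where
    open ≡-Reasoning
    r = inv (suc k)
    abstract
      eq : ∀ r → r ⊗ (1ℚ ⊗ (0ℚ ⊕ r)) ≡ r ⊗ r
      eq = solve-∀ ring
  Γ-w (suc m) k k<M = begin
    Γ (suc m) (w (suc k))                                                         ≡⟨ Γ-suc m (w (suc k)) ⟩
    Γ m (λ i → c i ⊗ (∑ M (w (suc k)) ⊖ ∑ (i ∸ 1) (w (suc k))))                   ≡⟨ Γ-cong m tail ⟩
    Γ m (λ i → c i ⊗ (∑ M (v (suc k)) ⊖ ∑ (i ∸ 1) (v (suc k))) ⊗ r ⊖ r ⊗ (c i ⊗ ℓ (i ∸ 1)) ⊕ r ⊗ ∑ (suc k) (λ l → w l i))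
      ≡⟨ Γ-⊕ m (λ i → p i ⊗ r ⊖ r ⊗ (c i ⊗ ℓ (i ∸ 1))) (λ i → r ⊗ ∑ (suc k) (λ l → w l i)) ⟩
    Γ m (λ i → p i ⊗ r ⊖ r ⊗ (c i ⊗ ℓ (i ∸ 1))) ⊕ Γ m (λ i → r ⊗ ∑ (suc k) (λ l → w l i))
      ≡⟨ cong₂ _⊕_ (trans (Γ-⊖ m (λ i → p i ⊗ r) (λ i → r ⊗ (c i ⊗ ℓ (i ∸ 1)))) (cong₂ _⊖_ part₁ (trans (Γ-⊗ m r (λ i → c i ⊗ ℓ (i ∸ 1))) (cong (r ⊗_) (Γ-ℓ m))))) part₃ ⟩
    r ⊗ (r ⊗ ζ⋆ (suc k) (ones (suc m))) ⊖ r ⊗ ζ M (suc (suc m) ∷ []) ⊕ r ⊗ ∑ (suc k) (λ l → inv l ⊗ b m l)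
      ≡⟨ eq₃ r (r ⊗ ζ⋆ (suc k) (ones (suc m))) (ζ M (suc (suc m) ∷ [])) (∑ (suc k) (λ l → inv l ⊗ b m l)) ⟩
    r ⊗ b (suc m) (suc k)                                                         ∎
    where
    open ≡-Reasoning
    r = inv (suc k)
    p : ℕ → ℚ
    p i = c i ⊗ (∑ M (v (suc k)) ⊖ ∑ (i ∸ 1) (v (suc k)))
    abstract
      -- Splits -x l as (1-x) l - l: the first part becomes a geometric sum of the `w`, the second
      -- is handled by `Γ-ℓ`, and the terms without logarithm form the tail of `v`.
      eq₁ : ∀ a r x l → a ⊗ (r ⊗ (1ℚ ⊗ (0ℚ ⊕ r)) ⊖ r ⊗ (x ⊗ (l ⊕ r))) ≡ a ⊗ (r ⊗ 1ℚ ⊖ r ⊗ x) ⊗ r ⊖ r ⊗ (a ⊗ l) ⊕ r ⊗ (a ⊗ (1ℚ ⊖ x) ⊗ l)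
      eq₁ = solve-∀ ring
      eq₃ : ∀ r x y z → r ⊗ x ⊖ r ⊗ y ⊕ r ⊗ z ≡ r ⊗ (x ⊖ y ⊕ z)
      eq₃ = solve-∀ ring
    tail : ∀ j → j N.< M → c (suc j) ⊗ (∑ M (w (suc k)) ⊖ ∑ j (w (suc k))) ≡
      p (suc j) ⊗ r ⊖ r ⊗ (c (suc j) ⊗ ℓ j) ⊕ r ⊗ ∑ (suc k) (λ l → w l (suc j))
    tail j j<M = begin
      c (suc j) ⊗ (∑ M (w (suc k)) ⊖ ∑ j (w (suc k)))
        ≡⟨ cong₂ (λ x y → c (suc j) ⊗ (x ⊖ y)) (trans (∑-w k M) (cong₂ (λ x y → r ⊗ (x ⊗ (y ⊕ r))) (u-top k<M) ℓ-top)) (∑-w k j) ⟩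
      c (suc j) ⊗ (r ⊗ (1ℚ ⊗ (0ℚ ⊕ r)) ⊖ r ⊗ (u (suc k) j ⊗ (ℓ j ⊕ r)))
        ≡⟨ eq₁ (c (suc j)) r (u (suc k) j) (ℓ j) ⟩
      c (suc j) ⊗ (r ⊗ 1ℚ ⊖ r ⊗ u (suc k) j) ⊗ r ⊖ r ⊗ (c (suc j) ⊗ ℓ j) ⊕ r ⊗ (c (suc j) ⊗ (1ℚ ⊖ u (suc k) j) ⊗ ℓ j)
        ≡⟨ cong₂ (λ x y → c (suc j) ⊗ (x ⊖ y) ⊗ r ⊖ r ⊗ (c (suc j) ⊗ ℓ j) ⊕ r ⊗ (c (suc j) ⊗ (1ℚ ⊖ u (suc k) j) ⊗ ℓ j)) (sym (trans (B-u k M) (cong (r ⊗_) (u-top k<M)))) (sym (B-u k j)) ⟩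
      p (suc j) ⊗ r ⊖ r ⊗ (c (suc j) ⊗ ℓ j) ⊕ r ⊗ (c (suc j) ⊗ (1ℚ ⊖ u (suc k) j) ⊗ ℓ j)
        ≡⟨ cong (λ x → p (suc j) ⊗ r ⊖ r ⊗ (c (suc j) ⊗ ℓ j) ⊕ r ⊗ x) (trans (cong (_⊗ ℓ j) (c⊗[1-u] (suc k) j<M)) (trans (sym (∑-⊗ʳ (suc k) (ℓ j) (λ l → v l (suc j)))) (∑-cong (suc k) (λ l _ → ⊗-assoc (inv (suc j)) (u (suc l) (suc j)) (ℓ j))))) ⟩
      p (suc j) ⊗ r ⊖ r ⊗ (c (suc j) ⊗ ℓ j) ⊕ r ⊗ ∑ (suc k) (λ l → w l (suc j)) ∎
    part₁ : Γ m (λ i → p i ⊗ r) ≡ r ⊗ (r ⊗ ζ⋆ (suc k) (ones (suc m)))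
    part₁ = trans (Γ-cong m (λ i _ → ⊗-comm (p (suc i)) r)) (trans (Γ-⊗ m r p) (cong (r ⊗_) (trans (sym (Γ-suc m (v (suc k)))) (Γ-v (suc m) k k<M))))
    part₃ : Γ m (λ i → r ⊗ ∑ (suc k) (λ l → w l i)) ≡ r ⊗ ∑ (suc k) (λ l → inv l ⊗ b m l)
    part₃ = trans (Γ-⊗ m r (λ i → ∑ (suc k) (λ l → w l i))) (cong (r ⊗_) (trans (Γ-∑ m (suc k) w) (∑-cong (suc k) (λ l l≤k → Γ-w m l (NP.≤-trans l≤k k<M)))))

  -- The left-hand side in the reflected variable

  L L̃ : ℕ → ℕ → ℚ
  L p = Z (p ∷ [])
  L̃ p n = L p (M ∸ n)

  iterB-⊕ : ∀ m f g n → n N.≤ M → iter B m (λ i → f i ⊕ g i) n ≡ iter B m f n ⊕ iter B m g n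
  iterB-⊕ zero    f g n n≤M = refl
  iterB-⊕ (suc m) f g n n≤M = trans (B-cong (iterB-⊕ m f g) n n≤M) (B-⊕ (iter B m f) (iter B m g) n)

  -- Summing t^k against k^(-p) under the integral gives Li_p(t). After reflection the logarithm is
  -- `A one i`, whereas an application of `A` needs it at i - 1; the excess `c i` produces the
  -- second, diagonal term.
  ∑-b : ∀ m p → ∑ M (λ k → ipow k (suc p) ⊗ b m k) ≡
    iter B m (A (λ n → L̃ p n ⊗ A one n)) M ⊕ iter B m (A (λ n → c (suc n) ⊗ L̃ p n)) M
  ∑-b m p = begin
    ∑ M (λ k → ipow k (suc p) ⊗ b m k)                        ≡⟨ ∑-cong M (λ k k<M → trans (eq₁ (inv (suc k)) (ipow (suc k) p) (b m (suc k))) (cong (ipow (suc k) p ⊗_) (sym (Γ-w m k k<M)))) ⟩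
    ∑ M (λ k → ipow k p ⊗ Γ m (w k))                          ≡⟨ ∑-cong M (λ k _ → sym (Γ-⊗ m (ipow (suc k) p) (w (suc k)))) ⟩
    ∑ M (λ k → Γ m (λ i → ipow k p ⊗ w k i))                  ≡⟨ sym (Γ-∑ m M (λ k i → ipow k p ⊗ w k i)) ⟩
    Γ m (λ i → ∑ M (λ k → ipow k p ⊗ w k i))                  ≡⟨ Γ-cong m collect ⟩
    Γ m (λ i → φ (suc M ∸ i))                                 ≡⟨ Γ-reflect m φ ⟩
    iter B m (λ n → ∑ n φ) M                                  ≡⟨ iter-cong B-cong m (λ n _ → split n) M NP.≤-refl ⟩
    iter B m (λ n → A (λ n → L̃ p n ⊗ A one n) n ⊕ A (λ n → c (suc n) ⊗ L̃ p n) n) M  ≡⟨ iterB-⊕ m (A (λ n → L̃ p n ⊗ A one n)) (A (λ n → c (suc n) ⊗ L̃ p n)) M NP.≤-refl ⟩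
    iter B m (A (λ n → L̃ p n ⊗ A one n)) M ⊕ iter B m (A (λ n → c (suc n) ⊗ L̃ p n)) M ∎
    where
    open ≡-Reasoning
    φ : ℕ → ℚ
    φ i = c i ⊗ (L p (suc M ∸ i) ⊗ A one i)
    abstract
      eq₁ : ∀ a x y → a ⊗ x ⊗ y ≡ x ⊗ (a ⊗ y)
      eq₁ = solve-∀ ring
      eq₂ : ∀ p i x l → p ⊗ (i ⊗ (x ⊗ l)) ≡ i ⊗ l ⊗ (x ⊗ (p ⊗ 1ℚ))
      eq₂ = solve-∀ ring
      eq₃ : ∀ i l x → i ⊗ l ⊗ x ≡ i ⊗ (x ⊗ l)
      eq₃ = solve-∀ ring
      eq₄ : ∀ a x y → a ⊗ (x ⊗ (y ⊕ a ⊗ 1ℚ)) ≡ a ⊗ (x ⊗ y) ⊕ a ⊗ (a ⊗ x)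
      eq₄ = solve-∀ ring
    collect : ∀ j → j N.< M → ∑ M (λ k → ipow k p ⊗ w k (suc j)) ≡ φ (M ∸ j)
    collect j j<M = begin
      ∑ M (λ k → ipow k p ⊗ w k (suc j))                     ≡⟨ ∑-cong M (λ k _ → eq₂ (ipow (suc k) p) (inv (suc j)) (u (suc k) (suc j)) (ℓ j)) ⟩
      ∑ M (λ k → inv (suc j) ⊗ ℓ j ⊗ (u k (suc j) ⊗ (ipow k p ⊗ 1ℚ)))  ≡⟨ ∑-⊗ˡ M (inv (suc j) ⊗ ℓ j) (λ k → u k (suc j) ⊗ (ipow k p ⊗ 1ℚ)) ⟩
      inv (suc j) ⊗ ℓ j ⊗ L p (suc j)                        ≡⟨ eq₃ (inv (suc j)) (ℓ j) (L p (suc j)) ⟩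
      inv (suc j) ⊗ (L p (suc j) ⊗ ℓ j)                      ≡⟨ cong₂ (λ x y → inv x ⊗ (L p x ⊗ y)) (sym twice) (ℓ≡A-one j (NP.<⇒≤ j<M)) ⟩
      φ (M ∸ j)                                              ∎
      where
      twice : suc M ∸ (M ∸ j) ≡ suc j
      twice = trans (NP.+-∸-assoc 1 (NP.m∸n≤m M j)) (cong suc (NP.m∸[m∸n]≡n (NP.<⇒≤ j<M)))
    split : ∀ n → ∑ n φ ≡ A (λ n → L̃ p n ⊗ A one n) n ⊕ A (λ n → c (suc n) ⊗ L̃ p n) n
    split n = trans (∑-cong n (λ i _ → eq₄ (c (suc i)) (L̃ p i) (A one i))) (∑-⊕ n _ _)

  -- Values at `M` of words in `A` and `B`

  A-⊖ : ∀ f g n → A (λ i → f i ⊖ g i) n ≡ A f n ⊖ A g n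
  A-⊖ f g n = trans (∑-cong n (λ i _ → eq (c (suc i)) (f i) (g i))) (∑-⊖ n _ _)
    where
    abstract
      eq : ∀ a x y → a ⊗ (x ⊖ y) ≡ a ⊗ x ⊖ a ⊗ y
      eq = solve-∀ ring

  B-⊖ : ∀ f g n → B (λ i → f i ⊖ g i) n ≡ B f n ⊖ B g n
  B-⊖ f g n = trans (∑-cong n (λ i _ → eq (inv (suc i)) (f (suc i)) (g (suc i)))) (∑-⊖ n _ _)
    where
    abstract
      eq : ∀ a x y → a ⊗ (x ⊖ y) ≡ a ⊗ x ⊖ a ⊗ y
      eq = solve-∀ ring

  iter-⊖ : ∀ {T} → (∀ {f g} → f ≐ g → T f ≐ T g) → (∀ f g n → T (λ i → f i ⊖ g i) n ≡ T f n ⊖ T g n) →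
    ∀ k f g → iter T k (λ i → f i ⊖ g i) ≐ (λ n → iter T k f n ⊖ iter T k g n)
  iter-⊖         T-cong T-⊖ zero    f g n n≤M = refl
  iter-⊖ {T = T} T-cong T-⊖ (suc k) f g n n≤M = trans (T-cong (iter-⊖ T-cong T-⊖ k f g) n n≤M) (T-⊖ (iter T k f) (iter T k g) n)

  iter-⊗ : ∀ {T} → (∀ {f g} → f ≐ g → T f ≐ T g) → (∀ a f n → T (λ i → a ⊗ f i) n ≡ a ⊗ T f n) →
    ∀ k a f → iter T k (λ i → a ⊗ f i) ≐ (λ n → a ⊗ iter T k f n)
  iter-⊗         T-cong T-⊗ zero    a f n n≤M = refl
  iter-⊗ {T = T} T-cong T-⊗ (suc k) a f n n≤M = trans (T-cong (iter-⊗ T-cong T-⊗ k a f) n n≤M) (T-⊗ a (iter T k f) n)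

  ev : ℕ → ℕ → (ℕ → ℚ) → ℚ
  ev m r f = iter B m (iter A r f) M

  ev-cong : ∀ m r {f g} → f ≐ g → ev m r f ≡ ev m r g
  ev-cong m r h = iter-cong B-cong m (iter-cong A-cong r h) M NP.≤-refl

  ev-⊖ : ∀ m r f g → ev m r (λ i → f i ⊖ g i) ≡ ev m r f ⊖ ev m r g
  ev-⊖ m r f g = trans (iter-cong B-cong m (iter-⊖ A-cong A-⊖ r f g) M NP.≤-refl) (iter-⊖ B-cong B-⊖ m (iter A r f) (iter A r g) M NP.≤-refl)

  ev-⊗ : ∀ m r a f → ev m r (λ i → a ⊗ f i) ≡ a ⊗ ev m r f
  ev-⊗ m r a f = trans (iter-cong B-cong m (iter-⊗ A-cong A-⊗ r a f) M NP.≤-refl) (iter-⊗ B-cong B-⊗ m a (iter A r f) M NP.≤-refl)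

  ev-A : ∀ m r f → ev m r (A f) ≡ ev m (suc r) f
  ev-A m r f = cong (λ h → iter B m h M) (iter-suc A r f)

  L̃-1 : L̃ 1 ≐ ℓ
  L̃-1 n n≤M = trans (sym (Z-A [] (M ∸ n) (NP.m∸n≤m M n))) (sym (ℓ≡A-one n n≤M))

  L̃-suc : ∀ p → L̃ (suc p) ≐ (λ n → ζ M (suc p ∷ []) ⊖ A (L̃ p) n)
  L̃-suc p n n≤M = begin
    L (suc p) (M ∸ n)                                            ≡⟨ sym (Z-B p [] (M ∸ n)) ⟩
    B (L p) (M ∸ n)                                              ≡⟨ eq (A (L̃ p) n) (B (L p) (M ∸ n)) ⟩
    A (L̃ p) n ⊕ B (L p) (M ∸ n) ⊖ A (L̃ p) n                    ≡⟨ cong (_⊖ A (L̃ p) n) (trans (cong (_⊕ B (L p) (M ∸ n)) (∑-cong n (λ _ _ → refl))) (∑-reflect (λ i → inv i ⊗ L p i) n n≤M)) ⟩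
    B (L p) M ⊖ A (L̃ p) n                                       ≡⟨ cong (_⊖ A (L̃ p) n) (trans (Z-B p [] M) (Z-top (suc p ∷ []))) ⟩
    ζ M (suc p ∷ []) ⊖ A (L̃ p) n                                ∎
    where
    open ≡-Reasoning
    abstract
      eq : ∀ a b → b ≡ a ⊕ b ⊖ a
      eq = solve-∀ ring

  ev-L̃ : ∀ m r p → ev m r (L̃ (suc p)) ≡ ζ M (suc p ∷ []) ⊗ ev m r one ⊖ ev m (suc r) (L̃ p)
  ev-L̃ m r p = begin
    ev m r (L̃ (suc p))                                              ≡⟨ ev-cong m r (λ n n≤M → trans (L̃-suc p n n≤M) (cong (_⊖ A (L̃ p) n) (sym (⊗-identityʳ (ζ M (suc p ∷ [])))))) ⟩
    ev m r (λ n → ζ M (suc p ∷ []) ⊗ one n ⊖ A (L̃ p) n)             ≡⟨ ev-⊖ m r (λ n → ζ M (suc p ∷ []) ⊗ one n) (A (L̃ p)) ⟩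
    ev m r (λ n → ζ M (suc p ∷ []) ⊗ one n) ⊖ ev m r (A (L̃ p))      ≡⟨ cong₂ _⊖_ (ev-⊗ m r (ζ M (suc p ∷ [])) one) (ev-A m r (L̃ p)) ⟩
    ζ M (suc p ∷ []) ⊗ ev m r one ⊖ ev m (suc r) (L̃ p)              ∎
    where open ≡-Reasoning

  Lλ κL : ℕ → ℕ → ℚ
  Lλ p n = L̃ p n ⊗ A one n
  κL p n = c (suc n) ⊗ L̃ p n

  -- The product rule: along `A` the factor `L̃ (suc p)` has derivative `⊝ L̃ p` and `A one` has
  -- derivative 1, while `κL` is the product of both increments. No constant of integration appears
  -- since `A one 0` is an empty sum.
  Lλ-suc : ∀ p → Lλ (suc p) ≐ (λ n → A (L̃ (suc p)) n ⊖ A (Lλ p) n ⊖ A (κL p) n)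
  Lλ-suc p n n≤M = sym (begin
    A (L̃ (suc p)) n ⊖ A (Lλ p) n ⊖ A (κL p) n       ≡⟨ trans (cong (_⊖ A (κL p) n) (sym (A-⊖ (L̃ (suc p)) (Lλ p) n))) (sym (A-⊖ (λ i → L̃ (suc p) i ⊖ Lλ p i) (κL p) n)) ⟩
    A (λ i → L̃ (suc p) i ⊖ Lλ p i ⊖ κL p i) n       ≡⟨ ∑-telescope n (λ i → c i ⊗ (L̃ (suc p) (i ∸ 1) ⊖ Lλ p (i ∸ 1) ⊖ κL p (i ∸ 1))) (Lλ (suc p)) (λ j j<n → step j (NP.≤-trans j<n n≤M)) ⟩
    Lλ (suc p) n ⊖ L̃ (suc p) 0 ⊗ 0ℚ                 ≡⟨ eq₂ (Lλ (suc p) n) (L̃ (suc p) 0) ⟩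
    Lλ (suc p) n                                     ∎)
    where
    open ≡-Reasoning
    abstract
      eq₀ : ∀ z a r y → z ⊖ (a ⊕ r ⊗ y) ≡ z ⊖ a ⊖ r ⊗ y
      eq₀ = solve-∀ ring
      eq₁ : ∀ X y r l → (X ⊖ r ⊗ y) ⊗ (l ⊕ r ⊗ 1ℚ) ≡ X ⊗ l ⊕ r ⊗ (X ⊖ y ⊗ l ⊖ r ⊗ y)
      eq₁ = solve-∀ ring
      eq₂ : ∀ a x → a ⊖ x ⊗ 0ℚ ≡ a
      eq₂ = solve-∀ ring
    step : ∀ j → j N.< M → Lλ (suc p) (suc j) ≡ Lλ (suc p) j ⊕ c (suc j) ⊗ (L̃ (suc p) j ⊖ Lλ p j ⊖ κL p j)
    step j j<M = trans (cong (_⊗ A one (suc j)) L̃-step) (eq₁ (L̃ (suc p) j) (L̃ p j) (c (suc j)) (A one j))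
      where
      L̃-step : L̃ (suc p) (suc j) ≡ L̃ (suc p) j ⊖ c (suc j) ⊗ L̃ p j
      L̃-step = trans (L̃-suc p (suc j) j<M) (trans (eq₀ (ζ M (suc p ∷ [])) (A (L̃ p) j) (c (suc j)) (L̃ p j))
        (cong (_⊖ c (suc j) ⊗ L̃ p j) (sym (L̃-suc p j (NP.<⇒≤ j<M)))))

  ev-Lλ : ∀ m r p → ev m r (Lλ (suc p)) ≡ ev m (suc r) (L̃ (suc p)) ⊖ ev m (suc r) (Lλ p) ⊖ ev m (suc r) (κL p)
  ev-Lλ m r p = begin
    ev m r (Lλ (suc p))                                                           ≡⟨ ev-cong m r (Lλ-suc p) ⟩
    ev m r (λ n → A (L̃ (suc p)) n ⊖ A (Lλ p) n ⊖ A (κL p) n)                     ≡⟨ ev-⊖ m r (λ n → A (L̃ (suc p)) n ⊖ A (Lλ p) n) (A (κL p)) ⟩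
    ev m r (λ n → A (L̃ (suc p)) n ⊖ A (Lλ p) n) ⊖ ev m r (A (κL p))              ≡⟨ cong (_⊖ ev m r (A (κL p))) (ev-⊖ m r (A (L̃ (suc p))) (A (Lλ p))) ⟩
    ev m r (A (L̃ (suc p))) ⊖ ev m r (A (Lλ p)) ⊖ ev m r (A (κL p))               ≡⟨ cong₂ _⊖_ (cong₂ _⊖_ (ev-A m r (L̃ (suc p))) (ev-A m r (Lλ p))) (ev-A m r (κL p)) ⟩
    ev m (suc r) (L̃ (suc p)) ⊖ ev m (suc r) (Lλ p) ⊖ ev m (suc r) (κL p)         ∎
    where open ≡-Reasoning

  -- Moving the logarithm out of words in `A` and `B`

  A-ℓ : ∀ f n → A (λ i → ℓ i ⊗ f i) n ≡ ℓ n ⊗ A f n ⊕ B (A f) n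
  A-ℓ f n = begin
    A (λ i → ℓ i ⊗ f i) n              ≡⟨ ∑-telescope n (λ i → c i ⊗ (ℓ (i ∸ 1) ⊗ f (i ∸ 1))) (λ j → ℓ j ⊗ A f j ⊕ B (A f) j) (λ j _ → step j) ⟩
    ℓ n ⊗ A f n ⊕ B (A f) n ⊖ (ℓ 0 ⊗ 0ℚ ⊕ 0ℚ)  ≡⟨ eq₂ (ℓ n ⊗ A f n ⊕ B (A f) n) (ℓ 0) ⟩
    ℓ n ⊗ A f n ⊕ B (A f) n            ∎
    where
    open ≡-Reasoning
    abstract
      eq₁ : ∀ l i r x a b → l ⊗ (a ⊕ r ⊗ x) ⊕ (b ⊕ i ⊗ (a ⊕ r ⊗ x)) ≡ (l ⊕ i) ⊗ a ⊕ b ⊕ r ⊗ ((l ⊕ i) ⊗ x)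
      eq₁ = solve-∀ ring
      eq₂ : ∀ a x → a ⊖ (x ⊗ 0ℚ ⊕ 0ℚ) ≡ a
      eq₂ = solve-∀ ring
    step : ∀ j → ℓ (suc j) ⊗ A f (suc j) ⊕ B (A f) (suc j) ≡ ℓ j ⊗ A f j ⊕ B (A f) j ⊕ c (suc j) ⊗ (ℓ j ⊗ f j)
    step j = trans (eq₁ (ℓ (suc j)) (inv (suc j)) (c (suc j)) (f j) (A f j) (B (A f) j))
      (cong (λ x → x ⊗ A f j ⊕ B (A f) j ⊕ c (suc j) ⊗ (x ⊗ f j)) (sym (ℓ-suc j)))

  -- Unlike in `A-ℓ`, where the logarithm is sampled at the left end of each step, here it is
  -- sampled at the right end, after it has dropped by 1/i. This leaves a diagonal sum with weight
  -- 1/i^2.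
  B-ℓ : ∀ G n → B (λ i → ℓ i ⊗ G i) n ≡ ℓ n ⊗ B G n ⊕ B (B G) n ⊖ B (λ i → inv i ⊗ G i) n
  B-ℓ G n = begin
    B (λ i → ℓ i ⊗ G i) n              ≡⟨ ∑-telescope n (λ i → inv i ⊗ (ℓ i ⊗ G i)) F (λ j _ → step j) ⟩
    F n ⊖ (ℓ 0 ⊗ 0ℚ ⊕ 0ℚ ⊖ 0ℚ)         ≡⟨ eq₂ (F n) (ℓ 0) ⟩
    F n                                ∎
    where
    open ≡-Reasoning
    F : ℕ → ℚ
    F n = ℓ n ⊗ B G n ⊕ B (B G) n ⊖ B (λ i → inv i ⊗ G i) n
    abstract
      eq₁ : ∀ l i x a b d → l ⊗ (a ⊕ i ⊗ x) ⊕ (b ⊕ i ⊗ (a ⊕ i ⊗ x)) ⊖ (d ⊕ i ⊗ (i ⊗ x)) ≡ (l ⊕ i) ⊗ a ⊕ b ⊖ d ⊕ i ⊗ (l ⊗ x)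
      eq₁ = solve-∀ ring
      eq₂ : ∀ a x → a ⊖ (x ⊗ 0ℚ ⊕ 0ℚ ⊖ 0ℚ) ≡ a
      eq₂ = solve-∀ ring
    step : ∀ j → F (suc j) ≡ F j ⊕ inv (suc j) ⊗ (ℓ (suc j) ⊗ G (suc j))
    step j = trans (eq₁ (ℓ (suc j)) (inv (suc j)) (G (suc j)) (B G j) (B (B G) j) (B (λ i → inv i ⊗ G i) j))
      (cong (λ x → x ⊗ B G j ⊕ B (B G) j ⊖ B (λ i → inv i ⊗ G i) j ⊕ inv (suc j) ⊗ (ℓ (suc j) ⊗ G (suc j))) (sym (ℓ-suc j)))

  Err : (ℕ → ℚ) → ℕ → ℕ → ℚ
  Err G zero    n = 0ℚ
  Err G (suc m) n = B (λ i → inv i ⊗ iter B m G i) n ⊕ B (Err G m) n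

  -- Passing any one of the `m` letters `B` inserts a further `B` beside it, always with the same
  -- resulting word; hence the factor `ι m`.
  iterB-ℓ : ∀ G m → iter B m (λ i → ℓ i ⊗ G i) ≐ (λ n → ℓ n ⊗ iter B m G n ⊕ ι m ⊗ iter B (suc m) G n ⊖ Err G m n)
  iterB-ℓ G zero    n n≤M = trans (eq (ℓ n ⊗ G n) (B G n)) (cong (λ x → ℓ n ⊗ G n ⊕ x ⊗ B G n ⊖ 0ℚ) (sym ι-zero))
    where
    abstract
      eq : ∀ a b → a ≡ a ⊕ 0ℚ ⊗ b ⊖ 0ℚ
      eq = solve-∀ ring
  iterB-ℓ G (suc m) n n≤M = begin
    B (iter B m (λ i → ℓ i ⊗ G i)) n                                          ≡⟨ B-cong (iterB-ℓ G m) n n≤M ⟩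
    B (λ i → ℓ i ⊗ F i ⊕ ι m ⊗ B F i ⊖ Err G m i) n                           ≡⟨ B-⊖ (λ i → ℓ i ⊗ F i ⊕ ι m ⊗ B F i) (Err G m) n ⟩
    B (λ i → ℓ i ⊗ F i ⊕ ι m ⊗ B F i) n ⊖ B (Err G m) n                       ≡⟨ cong (_⊖ B (Err G m) n) (B-⊕ (λ i → ℓ i ⊗ F i) (λ i → ι m ⊗ B F i) n) ⟩
    B (λ i → ℓ i ⊗ F i) n ⊕ B (λ i → ι m ⊗ B F i) n ⊖ B (Err G m) n           ≡⟨ cong₂ (λ x y → x ⊕ y ⊖ B (Err G m) n) (B-ℓ F n) (B-⊗ (ι m) (B F) n) ⟩
    ℓ n ⊗ B F n ⊕ B (B F) n ⊖ B (λ i → inv i ⊗ F i) n ⊕ ι m ⊗ B (B F) n ⊖ B (Err G m) n  ≡⟨ eq (ℓ n ⊗ B F n) (B (B F) n) (B (λ i → inv i ⊗ F i) n) (ι m) (B (Err G m) n) ⟩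
    ℓ n ⊗ B F n ⊕ (ι m ⊕ 1ℚ) ⊗ B (B F) n ⊖ Err G (suc m) n                    ≡⟨ cong (λ x → ℓ n ⊗ B F n ⊕ x ⊗ B (B F) n ⊖ Err G (suc m) n) (sym (ι-suc m)) ⟩
    ℓ n ⊗ B F n ⊕ ι (suc m) ⊗ B (B F) n ⊖ Err G (suc m) n                     ∎
    where
    open ≡-Reasoning
    F : ℕ → ℚ
    F = iter B m G
    abstract
      eq : ∀ a b d i e → a ⊕ b ⊖ d ⊕ i ⊗ b ⊖ e ≡ a ⊕ (i ⊕ 1ℚ) ⊗ b ⊖ (d ⊕ e)
      eq = solve-∀ ring

  -- The words obtained from `r + s` letters `A` by inserting one `B` in front of one of the first
  -- `r` of them.
  D : ℕ → ℕ → ℕ → ℚ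
  D zero    s n = 0ℚ
  D (suc r) s n = B (iter A (suc (r N.+ s)) one) n ⊕ A (D r s) n

  iterA-ℓ : ∀ r s → iter A r (λ i → ℓ i ⊗ iter A s one i) ≐ (λ n → ℓ n ⊗ iter A (r N.+ s) one n ⊕ D r s n)
  iterA-ℓ zero    s n n≤M = sym (⊕-identityʳ (ℓ n ⊗ iter A s one n))
  iterA-ℓ (suc r) s n n≤M = begin
    A (iter A r (λ i → ℓ i ⊗ iter A s one i)) n                       ≡⟨ A-cong (iterA-ℓ r s) n n≤M ⟩
    A (λ i → ℓ i ⊗ F i ⊕ D r s i) n                                   ≡⟨ A-⊕ (λ i → ℓ i ⊗ F i) (D r s) n ⟩
    A (λ i → ℓ i ⊗ F i) n ⊕ A (D r s) n                               ≡⟨ cong (_⊕ A (D r s) n) (A-ℓ F n) ⟩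
    ℓ n ⊗ A F n ⊕ B (A F) n ⊕ A (D r s) n                             ≡⟨ ⊕-assoc (ℓ n ⊗ A F n) (B (A F) n) (A (D r s) n) ⟩
    ℓ n ⊗ A F n ⊕ D (suc r) s n                                       ∎
    where
    open ≡-Reasoning
    F : ℕ → ℚ
    F = iter A (r N.+ s) one

  -- Both insert a `B` into the same word, but the left side allows one more place. With s = 0 this
  -- is the place before the innermost `A`, and its absence from `D r 1` is the origin of the
  -- separate term with final argument 2 in the identity.
  D-last : ∀ r s → D (suc r) s ≐ (λ n → D r (suc s) n ⊕ iter A r (B (iter A (suc s) one)) n)
  D-last zero    s n n≤M = trans (⊕-comm (B (A (iter A s one)) n) (A (D 0 s) n)) (cong (_⊕ B (A (iter A s one)) n) (trans (∑-cong n (λ i _ → ⊗-zeroʳ (c (suc i)))) (∑-zero n)))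
  D-last (suc r) s n n≤M = begin
    B (iter A (suc (suc (r N.+ s))) one) n ⊕ A (D (suc r) s) n        ≡⟨ cong₂ (λ k x → B (iter A (suc k) one) n ⊕ x) (sym (NP.+-suc r s)) (trans (A-cong (D-last r s) n n≤M) (A-⊕ (D r (suc s)) F n)) ⟩
    B (iter A (suc (r N.+ suc s)) one) n ⊕ (A (D r (suc s)) n ⊕ A F n)  ≡⟨ sym (⊕-assoc (B (iter A (suc (r N.+ suc s)) one) n) (A (D r (suc s)) n) (A F n)) ⟩
    D (suc r) (suc s) n ⊕ A F n                                       ∎
    where
    open ≡-Reasoning
    F : ℕ → ℚ
    F = iter A r (B (iter A (suc s) one))

  -- Words as discrete polylogarithms

  Z-iterA : ∀ r ss → iter A r (Z ss) ≐ Z (ones r ++ ss)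
  Z-iterA zero    ss n n≤M = refl
  Z-iterA (suc r) ss n n≤M = trans (A-cong (Z-iterA r ss) n n≤M) (Z-A (ones r ++ ss) n n≤M)

  iterA-one : ∀ r → iter A r one ≐ Z (ones r)
  iterA-one r n n≤M = trans (iter-cong A-cong r (λ _ _ → refl) n n≤M) (trans (Z-iterA r [] n n≤M) (cong (λ ss → Z ss n) (++-identityʳ (ones r))))

  B-iterA-one : ∀ r → B (iter A (suc r) one) ≐ Z (2 ∷ ones r)
  B-iterA-one r n n≤M = trans (B-cong (iterA-one (suc r)) n n≤M) (Z-B 1 (ones r) n)

  D-Z : ∀ r s → D r s ≐ (λ n → ∑ r (λ i → Z (ones (i ∸ 1) ++ 2 ∷ ones (r N.+ s ∸ i)) n))
  D-Z zero    s n n≤M = refl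
  D-Z (suc r) s n n≤M = begin
    B (iter A (suc (r N.+ s)) one) n ⊕ A (D r s) n                                                        ≡⟨ cong₂ _⊕_ (B-iterA-one (r N.+ s) n n≤M) (A-cong (D-Z r s) n n≤M) ⟩
    Z (2 ∷ ones (r N.+ s)) n ⊕ A (λ n → ∑ r (λ i → F i n)) n                                              ≡⟨ cong (Z (2 ∷ ones (r N.+ s)) n ⊕_) A-sum ⟩
    Z (2 ∷ ones (r N.+ s)) n ⊕ ∑ r (λ i → Z (ones i ++ 2 ∷ ones (suc (r N.+ s) ∸ suc i)) n)               ≡⟨ sym (∑-suc r (λ i → Z (ones (i ∸ 1) ++ 2 ∷ ones (suc (r N.+ s) ∸ i)) n)) ⟩
    ∑ (suc r) (λ i → Z (ones (i ∸ 1) ++ 2 ∷ ones (suc r N.+ s ∸ i)) n)                                    ∎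
    where
    open ≡-Reasoning
    F : ℕ → ℕ → ℚ
    F i = Z (ones (i ∸ 1) ++ 2 ∷ ones (r N.+ s ∸ i))
    A-sum : A (λ n → ∑ r (λ i → F i n)) n ≡ ∑ r (λ i → Z (ones i ++ 2 ∷ ones (suc (r N.+ s) ∸ suc i)) n)
    A-sum = begin
      A (λ n → ∑ r (λ i → F i n)) n             ≡⟨ A-cong {λ n → ∑ r (λ i → F i n)} {λ n → ∑ r (λ i → F i n ⊗ 1ℚ)} (λ n _ → ∑-cong r {λ i → F i n} {λ i → F i n ⊗ 1ℚ} (λ i _ → sym (⊗-identityʳ (F (suc i) n)))) n n≤M ⟩
      A (λ n → ∑ r (λ i → F i n ⊗ 1ℚ)) n        ≡⟨ A-∑ r one F n ⟩
      ∑ r (λ i → A (F i) n ⊗ 1ℚ)                ≡⟨ ∑-cong r (λ i _ → trans (⊗-identityʳ (A (F (suc i)) n)) (Z-A (ones i ++ 2 ∷ ones (r N.+ s ∸ suc i)) n n≤M)) ⟩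
      ∑ r (λ i → Z (ones i ++ 2 ∷ ones (suc (r N.+ s) ∸ suc i)) n) ∎

  -- Bounds for the diagonal terms

  infix 4 _≼_

  _≼_ : (ℕ → ℚ) → (ℕ → ℚ) → Set
  f ≼ g = ∀ n → n N.≤ M → f n ≤ g n

  NonNeg : (ℕ → ℚ) → Set
  NonNeg f = ∀ n → n N.≤ M → 0ℚ ≤ f n

  Increasing : (ℕ → ℚ) → Set
  Increasing f = ∀ i n → i N.≤ n → n N.≤ M → f i ≤ f n

  c-nonneg : ∀ i → 0ℚ ≤ c i
  c-nonneg i = inv-nonneg (suc M ∸ i)

  A-mono : ∀ {f g} → f ≼ g → A f ≼ A g
  A-mono h n n≤M = ∑-mono n (λ i i<n → ⊗-monoˡ (c-nonneg (suc i)) (h i (NP.≤-trans (NP.<⇒≤ i<n) n≤M)))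

  B-mono : ∀ {f g} → f ≼ g → B f ≼ B g
  B-mono h n n≤M = ∑-mono n (λ i i<n → ⊗-monoˡ (inv-nonneg (suc i)) (h (suc i) (NP.≤-trans i<n n≤M)))

  A-nonneg : ∀ {f} → NonNeg f → NonNeg (A f)
  A-nonneg h n n≤M = ∑-nonneg n (λ i i<n → 0≤⊗ (c-nonneg (suc i)) (h i (NP.≤-trans (NP.<⇒≤ i<n) n≤M)))

  B-nonneg : ∀ {f} → NonNeg f → NonNeg (B f)
  B-nonneg h n n≤M = ∑-nonneg n (λ i i<n → 0≤⊗ (inv-nonneg (suc i)) (h (suc i) (NP.≤-trans i<n n≤M)))

  iter-nonneg : ∀ {T} → (∀ {f} → NonNeg f → NonNeg (T f)) → ∀ k {f} → NonNeg f → NonNeg (iter T k f)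
  iter-nonneg T-nonneg zero    h = h
  iter-nonneg T-nonneg (suc k) h = T-nonneg (iter-nonneg T-nonneg k h)

  iter-mono : ∀ {T} → (∀ {f g} → f ≼ g → T f ≼ T g) → ∀ k {f g} → f ≼ g → iter T k f ≼ iter T k g
  iter-mono T-mono zero    h = h
  iter-mono T-mono (suc k) h = T-mono (iter-mono T-mono k h)

  ∑-increasing : ∀ (φ : ℕ → ℚ) → (∀ i → i N.< M → 0ℚ ≤ φ (suc i)) → Increasing (λ n → ∑ n φ)
  ∑-increasing φ h i zero    z≤n  _   = ≤-refl
  ∑-increasing φ h i (suc n) i≤sn n<M with NP.m≤n⇒m<n∨m≡n i≤sn
  ... | inj₁ (s≤s i≤n) = ≤-trans (∑-increasing φ h i n i≤n (NP.<⇒≤ n<M)) (p≤p⊕q (∑ n φ) (h n n<M))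
  ... | inj₂ refl      = ≤-refl

  A-increasing : ∀ {f} → NonNeg f → Increasing (A f)
  A-increasing {f} h = ∑-increasing (λ i → c i ⊗ f (i ∸ 1)) (λ i i<M → 0≤⊗ (c-nonneg (suc i)) (h i (NP.<⇒≤ i<M)))

  B-increasing : ∀ {f} → NonNeg f → Increasing (B f)
  B-increasing {f} h = ∑-increasing (λ i → inv i ⊗ f i) (λ i i<M → 0≤⊗ (inv-nonneg (suc i)) (h (suc i) i<M))

  h : ℚ
  h = H M

  0≤h : 0ℚ ≤ h
  0≤h = H-nonneg M

  ∑-c : ∑ M c ≡ h
  ∑-c = ∑-reverse M inv

  A-bound : ∀ {F} → NonNeg F → Increasing F → A F ≼ (λ n → h ⊗ F n)
  A-bound {F} F≥0 F↑ n n≤M = ≤-trans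
    (∑-mono n (λ i i<n → ⊗-monoˡ (c-nonneg (suc i)) (F↑ i n (NP.<⇒≤ i<n) n≤M)))
    (subst (_≤ h ⊗ F n) (sym (∑-⊗ʳ n (F n) c))
      (⊗-monoʳ (F≥0 n n≤M) (subst (∑ n c ≤_) ∑-c (∑-increasing c (λ i _ → c-nonneg (suc i)) n M n≤M NP.≤-refl))))

  B-bound : ∀ {F} → NonNeg F → Increasing F → B F ≼ (λ n → h ⊗ F n)
  B-bound {F} F≥0 F↑ n n≤M = ≤-trans
    (∑-mono n (λ i i<n → ⊗-monoˡ (inv-nonneg (suc i)) (F↑ (suc i) n i<n n≤M)))
    (subst (_≤ h ⊗ F n) (sym (∑-⊗ʳ n (F n) inv))
      (⊗-monoʳ (F≥0 n n≤M) (∑-increasing inv (λ i _ → inv-nonneg (suc i)) n M n≤M NP.≤-refl)))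

  iter-bound : ∀ {T F} → (∀ {f g} → f ≼ g → T f ≼ T g) → (∀ a f n → T (λ i → a ⊗ f i) n ≡ a ⊗ T f n) →
    T F ≼ (λ n → h ⊗ F n) → ∀ k → iter T k F ≼ (λ n → pow h k ⊗ F n)
  iter-bound {T} {F} T-mono T-⊗ T-bound zero    n n≤M = ≤-reflexive (sym (⊗-identityˡ (F n)))
  iter-bound {T} {F} T-mono T-⊗ T-bound (suc k) n n≤M = ≤-trans (T-mono (iter-bound T-mono T-⊗ T-bound k) n n≤M)
    (subst₂ _≤_ (sym (T-⊗ (pow h k) F n)) (eq (pow h k) h (F n)) (⊗-monoˡ (pow-nonneg 0≤h k) (T-bound n n≤M)))
    where
    abstract
      eq : ∀ a b x → a ⊗ (b ⊗ x) ≡ b ⊗ a ⊗ x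
      eq = solve-∀ ring

  one-nonneg : NonNeg one
  one-nonneg _ _ = 0≤1

  -- A one n is a sum of n terms, the largest of which is c n.
  inv⊗A-one≤c : ∀ n → n N.< M → inv (suc n) ⊗ A one (suc n) ≤ c (suc n)
  inv⊗A-one≤c n n<M = subst (inv (suc n) ⊗ A one (suc n) ≤_) eq
    (⊗-monoˡ (inv-nonneg (suc n)) (∑-mono (suc n) (λ i i≤n → subst (_≤ c (suc n)) (sym (⊗-identityʳ (c (suc i))))
      (inv-antitone-pos (NP.m<n⇒0<n∸m n<M) (NP.∸-monoʳ-≤ M (NP.≤-pred i≤n))))))
    where
    eq : inv (suc n) ⊗ ∑ (suc n) (λ _ → c (suc n)) ≡ c (suc n)
    eq = trans (cong (inv (suc n) ⊗_) (∑-const (suc n) (c (suc n)))) (trans (⊗-exchange (inv (suc n)) (ι (suc n)) (c (suc n))) (inv-cancel n (c (suc n))))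

  -- The mirror image of `inv⊗A-one≤c`, standing for -log t ≤ (1-t)/t.
  c⊗ℓ≤inv : ∀ j → j N.< M → c (suc j) ⊗ ℓ j ≤ inv (suc j)
  c⊗ℓ≤inv j j<M = subst₂ _≤_ (cong (c (suc j) ⊗_) (sym (ℓ≡A-one j (NP.<⇒≤ j<M)))) (cong inv twice)
    (at (M ∸ j) (NP.m<n⇒0<n∸m j<M) (NP.m∸n≤m M j))
    where
    twice : suc M ∸ (M ∸ j) ≡ suc j
    twice = trans (NP.+-∸-assoc 1 (NP.m∸n≤m M j)) (cong suc (NP.m∸[m∸n]≡n (NP.<⇒≤ j<M)))
    at : ∀ n → 0 N.< n → n N.≤ M → inv n ⊗ A one n ≤ c n
    at (suc n) _ n<M = inv⊗A-one≤c n n<M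

  -- The sum of 1/(i(M+1-i)) in partial fractions; every diagonal term is at most this times a
  -- polynomial in `h`.
  δ : ℚ
  δ = inv (suc M) ⊗ (h ⊕ h)

  ∑-inv⊗c : ∑ M (λ i → inv i ⊗ c i) ≡ δ
  ∑-inv⊗c = begin
    ∑ M (λ i → inv i ⊗ c i)                      ≡⟨ ∑-cong M split ⟩
    ∑ M (λ i → inv (suc M) ⊗ (inv i ⊕ c i))      ≡⟨ ∑-⊗ˡ M (inv (suc M)) (λ i → inv i ⊕ c i) ⟩
    inv (suc M) ⊗ ∑ M (λ i → inv i ⊕ c i)        ≡⟨ cong (inv (suc M) ⊗_) (trans (∑-⊕ M inv c) (cong (h ⊕_) ∑-c)) ⟩
    δ                                            ∎
    where
    open ≡-Reasoning
    split : ∀ j → j N.< M → inv (suc j) ⊗ c (suc j) ≡ inv (suc M) ⊗ (inv (suc j) ⊕ c (suc j))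
    split j j<M = subst₂ (λ x y → inv (suc j) ⊗ inv x ≡ inv (suc y) ⊗ (inv (suc j) ⊕ inv x))
      (sym M∸j) (trans (cong (j N.+_) (sym M∸j)) (NP.m+[n∸m]≡n (NP.<⇒≤ j<M)))
      (inv-partial-fractions j (M ∸ suc j))
      where
      M∸j : M ∸ j ≡ suc (M ∸ suc j)
      M∸j = NP.+-∸-assoc 1 j<M

  u-nonneg : ∀ k n → 0ℚ ≤ u k n
  u-nonneg zero    n = 0≤1
  u-nonneg (suc k) n = 0≤⊗ (u-nonneg k n) (0≤⊗ (ι-nonneg (n ∸ k)) (inv-nonneg (M ∸ k)))

  L̃-nonneg : ∀ p n → 0ℚ ≤ L̃ p n
  L̃-nonneg p n = ∑-nonneg M (λ k _ → 0≤⊗ (u-nonneg (suc k) (M ∸ n)) (0≤⊗ (ipow-nonneg (suc k) p) 0≤1))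

  ζ-depth-1≤h : ∀ s → ζ M (suc s ∷ []) ≤ h
  ζ-depth-1≤h s = ∑-mono M (λ k _ → subst₂ _≤_ (sym (⊗-identityʳ (ipow (suc k) (suc s)))) (⊗-identityʳ (inv (suc k))) (⊗-monoˡ (inv-nonneg (suc k)) (ipow≤1 k s)))

  L̃≤h : ∀ p → L̃ (suc p) ≼ (λ _ → h)
  L̃≤h p n n≤M = ≤-trans (≤-reflexive (L̃-suc p n n≤M))
    (≤-trans (p⊖q≤p (ζ M (suc p ∷ [])) (A-nonneg (λ i _ → L̃-nonneg p i) n n≤M)) (ζ-depth-1≤h p))

  κ : ℕ → ℚ
  κ n = c (suc n)

  κ-nonneg : NonNeg κ
  κ-nonneg n _ = c-nonneg (suc n)

  -- By `A-ℓ` and `ℓ M` = 0, the outer `B` amounts to a factor `ℓ` under the sum of c_i^2, and the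
  -- product of `ℓ` with one `c` is at most 1/i. Without that `B` the value would be the sum of
  -- 1/i^2, which is not null.
  BAκ≤δ : B (A κ) M ≤ δ
  BAκ≤δ = subst₂ _≤_ eq ∑-inv⊗c
    (∑-mono M (λ j j<M → subst₂ _≤_ (cong (c (suc j) ⊗_) (⊗-comm (c (suc j)) (ℓ j))) (⊗-comm (c (suc j)) (inv (suc j))) (⊗-monoˡ (c-nonneg (suc j)) (c⊗ℓ≤inv j j<M))))
    where
    eq₁ : ∀ x y → 0ℚ ⊗ x ⊕ y ≡ y
    eq₁ x y = trans (cong (_⊕ y) (⊗-zeroˡ x)) (⊕-identityˡ y)
    eq : A (λ i → ℓ i ⊗ κ i) M ≡ B (A κ) M
    eq = trans (A-ℓ κ M) (trans (cong (λ x → x ⊗ A κ M ⊕ B (A κ) M) ℓ-top) (eq₁ (A κ M) (B (A κ) M)))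

  ev-κL-nonneg : ∀ m r p → 0ℚ ≤ ev m r (κL p)
  ev-κL-nonneg m r p = iter-nonneg B-nonneg m (iter-nonneg A-nonneg r (λ n _ → 0≤⊗ (c-nonneg (suc n)) (L̃-nonneg p n))) M NP.≤-refl

  -- One factor `h` bounds the polylogarithm. The innermost `A` and `B` are reserved for `BAκ≤δ`;
  -- each of the other `r + m` letters acts on an increasing nonnegative function and costs at most
  -- one more `h`.
  ev-κL≤ : ∀ m r p → ev (suc m) (suc r) (κL (suc p)) ≤ pow h m ⊗ (pow h (suc r) ⊗ δ)
  ev-κL≤ m r p = ≤-trans step₁ (≤-trans (≤-reflexive step₂) (≤-trans (⊗-monoˡ (pow-nonneg 0≤h (suc r)) step₃) (≤-reflexive (⊗-exchange (pow h (suc r)) (pow h m) δ))))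
    where
    A-κL≤ : A (κL (suc p)) ≼ (λ n → h ⊗ A κ n)
    A-κL≤ n n≤M = ≤-trans
      (A-mono {g = λ i → h ⊗ κ i} (λ i i≤M → subst (κL (suc p) i ≤_) (⊗-comm (κ i) h) (⊗-monoˡ (c-nonneg (suc i)) (L̃≤h p i i≤M))) n n≤M)
      (≤-reflexive (A-⊗ h κ n))
    Aκ≥0 : NonNeg (A κ)
    Aκ≥0 = A-nonneg κ-nonneg
    iterA≤ : iter A (suc r) (κL (suc p)) ≼ (λ n → pow h (suc r) ⊗ A κ n)
    iterA≤ n n≤M = ≤-trans (≤-reflexive (cong (λ f → f n) (sym (iter-suc A r (κL (suc p))))))
      (≤-trans (iter-mono A-mono r A-κL≤ n n≤M)
      (≤-trans (≤-reflexive (iter-⊗ A-cong A-⊗ r h (A κ) n n≤M))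
      (≤-trans (⊗-monoˡ 0≤h (iter-bound A-mono A-⊗ (A-bound Aκ≥0 (A-increasing κ-nonneg)) r n n≤M))
      (≤-reflexive (sym (⊗-assoc h (pow h r) (A κ n)))))))
    step₁ : ev (suc m) (suc r) (κL (suc p)) ≤ iter B (suc m) (λ n → pow h (suc r) ⊗ A κ n) M
    step₁ = iter-mono B-mono (suc m) iterA≤ M NP.≤-refl
    step₂ : iter B (suc m) (λ n → pow h (suc r) ⊗ A κ n) M ≡ pow h (suc r) ⊗ iter B (suc m) (A κ) M
    step₂ = iter-⊗ B-cong B-⊗ (suc m) (pow h (suc r)) (A κ) M NP.≤-refl
    step₃ : iter B (suc m) (A κ) M ≤ pow h m ⊗ δ
    step₃ = ≤-trans (≤-reflexive (cong (λ f → f M) (sym (iter-suc B m (A κ)))))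
      (≤-trans (iter-bound B-mono B-⊗ (B-bound (B-nonneg Aκ≥0) (B-increasing Aκ≥0)) m M NP.≤-refl)
      (⊗-monoˡ (pow-nonneg 0≤h m) BAκ≤δ))

  β : ℕ → ℚ
  β = B (λ i → inv i ⊗ A one i)

  invA-one-nonneg : NonNeg (λ i → inv i ⊗ A one i)
  invA-one-nonneg n n≤M = 0≤⊗ (inv-nonneg n) (A-nonneg one-nonneg n n≤M)

  β-nonneg : NonNeg β
  β-nonneg = B-nonneg invA-one-nonneg

  β≤δ : β M ≤ δ
  β≤δ = subst (β M ≤_) ∑-inv⊗c (∑-mono M (λ n n<M → ⊗-monoˡ (inv-nonneg (suc n)) (inv⊗A-one≤c n n<M)))

  G : ℕ → ℕ → ℚ
  G p = iter A (suc p) one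

  G-nonneg : ∀ p → NonNeg (G p)
  G-nonneg p = iter-nonneg A-nonneg (suc p) one-nonneg

  G≤ : ∀ p → G p ≼ (λ n → pow h p ⊗ A one n)
  G≤ p n n≤M = ≤-trans (≤-reflexive (cong (λ f → f n) (sym (iter-suc A p one))))
    (iter-bound A-mono A-⊗ (A-bound (A-nonneg one-nonneg) (A-increasing one-nonneg)) p n n≤M)

  -- Since A 1 at i, divided by i, is at most c_i, applying `B` never increases `A one`; these
  -- letters cost no power of `h`.
  iterB-A-one≤ : ∀ m → iter B m (A one) ≼ A one
  iterB-A-one≤ zero    n n≤M = ≤-refl
  iterB-A-one≤ (suc m) n n≤M = ≤-trans (B-mono (iterB-A-one≤ m) n n≤M)
    (∑-mono n (λ i i<n → subst (inv (suc i) ⊗ A one (suc i) ≤_) (sym (⊗-identityʳ (c (suc i)))) (inv⊗A-one≤c i (NP.≤-trans i<n n≤M))))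

  iterB-G≤ : ∀ m p → iter B m (G p) ≼ (λ n → pow h p ⊗ A one n)
  iterB-G≤ m p n n≤M = ≤-trans (iter-mono B-mono m (G≤ p) n n≤M)
    (≤-trans (≤-reflexive (iter-⊗ B-cong B-⊗ m (pow h p) (A one) n n≤M))
    (⊗-monoˡ (pow-nonneg 0≤h p) (iterB-A-one≤ m n n≤M)))

  -- Equals h^p (1 + h + ... + h^(m-1)): in the recursion of `Err` the new diagonal sum costs h^p,
  -- and the `B` in front of the earlier ones costs `h`.
  C : ℕ → ℕ → ℚ
  C p zero    = 0ℚ
  C p (suc m) = pow h p ⊕ h ⊗ C p m

  C-nonneg : ∀ p m → 0ℚ ≤ C p m
  C-nonneg p zero    = ≤-refl
  C-nonneg p (suc m) = 0≤⊕ (pow-nonneg 0≤h p) (0≤⊗ 0≤h (C-nonneg p m))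

  Err-nonneg : ∀ p m → NonNeg (Err (G p) m)
  Err-nonneg p zero    n n≤M = ≤-refl
  Err-nonneg p (suc m) n n≤M = 0≤⊕
    (B-nonneg (λ i i≤M → 0≤⊗ (inv-nonneg i) (iter-nonneg B-nonneg m (G-nonneg p) i i≤M)) n n≤M)
    (B-nonneg (Err-nonneg p m) n n≤M)

  Err≤ : ∀ p m → Err (G p) m ≼ (λ n → C p m ⊗ β n)
  Err≤ p zero    n n≤M = ≤-reflexive (sym (⊗-zeroˡ (β n)))
  Err≤ p (suc m) n n≤M = ≤-trans (⊕-mono part₁ part₂) (≤-reflexive (eq (pow h p) (β n) (C p m) h))
    where
    abstract
      eq : ∀ a x d h → a ⊗ x ⊕ d ⊗ (h ⊗ x) ≡ (a ⊕ h ⊗ d) ⊗ x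
      eq = solve-∀ ring
    part₁ : B (λ i → inv i ⊗ iter B m (G p) i) n ≤ pow h p ⊗ β n
    part₁ = ≤-trans
      (B-mono {g = λ i → pow h p ⊗ (inv i ⊗ A one i)} (λ i i≤M → subst (inv i ⊗ iter B m (G p) i ≤_) (⊗-exchange (inv i) (pow h p) (A one i)) (⊗-monoˡ (inv-nonneg i) (iterB-G≤ m p i i≤M))) n n≤M)
      (≤-reflexive (B-⊗ (pow h p) (λ i → inv i ⊗ A one i) n))
    part₂ : B (Err (G p) m) n ≤ C p m ⊗ (h ⊗ β n)
    part₂ = ≤-trans (B-mono (Err≤ p m) n n≤M) (≤-trans (≤-reflexive (B-⊗ (C p m) β n))
      (⊗-monoˡ (C-nonneg p m) (B-bound β-nonneg (B-increasing invA-one-nonneg) n n≤M)))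

  -- Evaluation of the words that remain

  iterB-∑ : ∀ m K (f : ℕ → ℕ → ℚ) → iter B m (λ n → ∑ K (λ k → f k n)) ≐ (λ n → ∑ K (λ k → iter B m (f k) n))
  iterB-∑ zero    K f n n≤M = refl
  iterB-∑ (suc m) K f n n≤M = begin
    B (iter B m (λ n → ∑ K (λ k → f k n))) n       ≡⟨ B-cong {g = λ n → ∑ K (λ k → F k n ⊗ 1ℚ)} (λ n n≤M → trans (iterB-∑ m K f n n≤M) (∑-cong K (λ k _ → sym (⊗-identityʳ (F (suc k) n))))) n n≤M ⟩
    B (λ n → ∑ K (λ k → F k n ⊗ 1ℚ)) n             ≡⟨ B-∑ K one F n ⟩
    ∑ K (λ k → B (F k) n ⊗ 1ℚ)                     ≡⟨ ∑-cong K (λ k _ → ⊗-identityʳ (B (F (suc k)) n)) ⟩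
    ∑ K (λ k → B (F k) n)                          ∎
    where
    open ≡-Reasoning
    F : ℕ → ℕ → ℚ
    F k = iter B m (f k)

  iterB-Z : ∀ m s ss → iter B m (Z (s ∷ ss)) M ≡ ζ M (m N.+ s ∷ ss)
  iterB-Z m s ss = trans (Z-iterB m s ss M NP.≤-refl) (Z-top (m N.+ s ∷ ss))

  ev-one : ∀ m r → ev m (suc r) one ≡ ζ M (m N.+ 1 ∷ ones r)
  ev-one m r = trans (iter-cong B-cong m (iterA-one (suc r)) M NP.≤-refl) (iterB-Z m 1 (ones r))

  S last top : ℕ → ℕ → ℚ
  S m p = ∑ p (λ i → ζ M (m N.+ 1 ∷ ones (i ∸ 1) ++ 2 ∷ ones (p ∸ i)))
  last m p = ζ M (m N.+ 1 ∷ ones p ++ 2 ∷ [])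
  top m p = ζ M (m N.+ 2 ∷ ones p)

  -- A `B` inserted in front merges with the outer `m` letters into the leading argument m + 2; at
  -- any later place it creates an argument 2 and leaves m + 1 in front.
  iterB-D : ∀ m p → iter B m (D (suc p) 0) M ≡ top m p ⊕ S m p
  iterB-D m p = begin
    iter B m (D (suc p) 0) M                                              ≡⟨ iter-cong B-cong m {g = λ n → ∑ (suc p) (λ i → F i n)} (λ n n≤M → trans (D-Z (suc p) 0 n n≤M) (∑-cong (suc p) (λ i _ → cong (λ k → Z (ones i ++ 2 ∷ ones (k ∸ i)) n) (NP.+-identityʳ p)))) M NP.≤-refl ⟩
    iter B m (λ n → ∑ (suc p) (λ i → F i n)) M                            ≡⟨ iterB-∑ m (suc p) F M NP.≤-refl ⟩
    ∑ (suc p) (λ i → iter B m (F i) M)                                    ≡⟨ ∑-suc p (λ i → iter B m (F i) M) ⟩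
    iter B m (Z (2 ∷ ones p)) M ⊕ ∑ p (λ i → iter B m (F (suc i)) M)      ≡⟨ cong₂ _⊕_ (iterB-Z m 2 (ones p)) (∑-cong p (λ i _ → iterB-Z m 1 (ones i ++ 2 ∷ ones (p ∸ suc i)))) ⟩
    top m p ⊕ S m p                                                       ∎
    where
    open ≡-Reasoning
    F : ℕ → ℕ → ℚ
    F i = Z (ones (i ∸ 1) ++ 2 ∷ ones (suc p ∸ i))

  iterB-D-1 : ∀ m p → iter B m (D (suc p) 1) M ≡ top m (suc p) ⊕ S m (suc p) ⊖ last m p
  iterB-D-1 m p = begin
    iter B m (D (suc p) 1) M                                         ≡⟨ eq (iter B m (D (suc p) 1) M) (iter B m F M) ⟩
    iter B m (D (suc p) 1) M ⊕ iter B m F M ⊖ iter B m F M           ≡⟨ cong₂ _⊖_ (trans (sym (iterB-⊕ m (D (suc p) 1) F M NP.≤-refl)) (trans (sym (iter-cong B-cong m (D-last (suc p) 0) M NP.≤-refl)) (iterB-D m (suc p)))) F-last ⟩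
    top m (suc p) ⊕ S m (suc p) ⊖ last m p                           ∎
    where
    open ≡-Reasoning
    F : ℕ → ℚ
    F = iter A (suc p) (B (iter A 1 one))
    abstract
      eq : ∀ a b → a ≡ a ⊕ b ⊖ b
      eq = solve-∀ ring
    F-last : iter B m F M ≡ last m p
    F-last = trans (iter-cong B-cong m (λ n n≤M → trans (iter-cong A-cong (suc p) (B-iterA-one 0) n n≤M) (Z-iterA (suc p) (2 ∷ []) n n≤M)) M NP.≤-refl) (iterB-Z m 1 (ones p ++ 2 ∷ []))

  ev-ℓ : ∀ m p → ev m (suc p) ℓ ≡ iter B m (λ i → ℓ i ⊗ G p i) M ⊕ (top m p ⊕ S m p)
  ev-ℓ m p = begin
    ev m (suc p) ℓ                                                        ≡⟨ ev-cong m (suc p) (λ n _ → sym (⊗-identityʳ (ℓ n))) ⟩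
    ev m (suc p) (λ n → ℓ n ⊗ iter A 0 one n)                             ≡⟨ iter-cong B-cong m (iterA-ℓ (suc p) 0) M NP.≤-refl ⟩
    iter B m (λ n → ℓ n ⊗ iter A (suc p N.+ 0) one n ⊕ D (suc p) 0 n) M   ≡⟨ cong (λ k → iter B m (λ n → ℓ n ⊗ iter A (suc k) one n ⊕ D (suc p) 0 n) M) (NP.+-identityʳ p) ⟩
    iter B m (λ n → ℓ n ⊗ G p n ⊕ D (suc p) 0 n) M                        ≡⟨ iterB-⊕ m (λ n → ℓ n ⊗ G p n) (D (suc p) 0) M NP.≤-refl ⟩
    iter B m (λ n → ℓ n ⊗ G p n) M ⊕ iter B m (D (suc p) 0) M             ≡⟨ cong (iter B m (λ n → ℓ n ⊗ G p n) M ⊕_) (iterB-D m p) ⟩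
    iter B m (λ i → ℓ i ⊗ G p i) M ⊕ (top m p ⊕ S m p)                    ∎
    where open ≡-Reasoning

  ev-Lλ-1 : ∀ m p → ev m (suc p) (Lλ 1) ≡ iter B m (λ i → ℓ i ⊗ G (suc p) i) M ⊕ (top m (suc p) ⊕ S m (suc p) ⊖ last m p)
  ev-Lλ-1 m p = begin
    ev m (suc p) (Lλ 1)                                                   ≡⟨ ev-cong m (suc p) (λ n n≤M → cong (_⊗ A one n) (L̃-1 n n≤M)) ⟩
    ev m (suc p) (λ n → ℓ n ⊗ iter A 1 one n)                             ≡⟨ iter-cong B-cong m (iterA-ℓ (suc p) 1) M NP.≤-refl ⟩
    iter B m (λ n → ℓ n ⊗ iter A (suc p N.+ 1) one n ⊕ D (suc p) 1 n) M   ≡⟨ cong (λ k → iter B m (λ n → ℓ n ⊗ iter A (suc k) one n ⊕ D (suc p) 1 n) M) (NP.+-comm p 1) ⟩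
    iter B m (λ n → ℓ n ⊗ G (suc p) n ⊕ D (suc p) 1 n) M                  ≡⟨ iterB-⊕ m (λ n → ℓ n ⊗ G (suc p) n) (D (suc p) 1) M NP.≤-refl ⟩
    iter B m (λ n → ℓ n ⊗ G (suc p) n) M ⊕ iter B m (D (suc p) 1) M       ≡⟨ cong (iter B m (λ n → ℓ n ⊗ G (suc p) n) M ⊕_) (iterB-D-1 m p) ⟩
    iter B m (λ i → ℓ i ⊗ G (suc p) i) M ⊕ (top m (suc p) ⊕ S m (suc p) ⊖ last m p) ∎
    where open ≡-Reasoning

  iterB-ℓG : ∀ m p → iter B m (λ i → ℓ i ⊗ G p i) M ≡ ι m ⊗ top m p ⊖ Err (G p) m M
  iterB-ℓG m p = begin
    iter B m (λ i → ℓ i ⊗ G p i) M                                             ≡⟨ iterB-ℓ (G p) m M NP.≤-refl ⟩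
    ℓ M ⊗ iter B m (G p) M ⊕ ι m ⊗ iter B (suc m) (G p) M ⊖ Err (G p) m M      ≡⟨ cong₂ (λ x y → x ⊗ iter B m (G p) M ⊕ ι m ⊗ y ⊖ Err (G p) m M) ℓ-top top-eq ⟩
    0ℚ ⊗ iter B m (G p) M ⊕ ι m ⊗ top m p ⊖ Err (G p) m M                      ≡⟨ cong (_⊖ Err (G p) m M) (trans (cong (_⊕ ι m ⊗ top m p) (⊗-zeroˡ (iter B m (G p) M))) (⊕-identityˡ (ι m ⊗ top m p))) ⟩
    ι m ⊗ top m p ⊖ Err (G p) m M                                              ∎
    where
    open ≡-Reasoning
    top-eq : iter B (suc m) (G p) M ≡ top m p
    top-eq = trans (ev-one (suc m) p) (cong (λ s → ζ M (s ∷ ones p)) (sym (NP.+-suc m 1)))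

  -- The star values on the left-hand side

  b-expand : ∀ m k → b m k ≡
    ∑ m (λ i → ζ⋆ k (ones (i ∸ 1) ++ 2 ∷ ones (m ∸ i))) ⊕ inv k ⊗ ζ⋆ k (ones m)
    ⊖ ∑ m (λ i → ζ M (suc (m ∸ (i ∸ 1)) ∷ []) ⊗ ζ⋆ k (ones (i ∸ 1)))
  b-expand zero    k = eq (inv k)
    where
    abstract
      eq : ∀ a → a ≡ 0ℚ ⊕ a ⊗ 1ℚ ⊖ 0ℚ
      eq = solve-∀ ring
  b-expand (suc m) k = begin
    inv k ⊗ ζ⋆ k (ones (suc m)) ⊖ z ⊕ ∑ k (λ l → inv l ⊗ b m l)                            ≡⟨ cong (inv k ⊗ ζ⋆ k (ones (suc m)) ⊖ z ⊕_) recursive ⟩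
    inv k ⊗ ζ⋆ k (ones (suc m)) ⊖ z ⊕ (∑ m (λ i → P (suc i)) ⊕ P 1 ⊖ ∑ m (λ i → R (suc i)))  ≡⟨ eq₁ (inv k ⊗ ζ⋆ k (ones (suc m))) z (∑ m (λ i → P (suc i))) (P 1) (∑ m (λ i → R (suc i))) ⟩
    (P 1 ⊕ ∑ m (λ i → P (suc i))) ⊕ inv k ⊗ ζ⋆ k (ones (suc m)) ⊖ (z ⊗ 1ℚ ⊕ ∑ m (λ i → R (suc i)))  ≡⟨ cong₂ (λ x y → x ⊕ inv k ⊗ ζ⋆ k (ones (suc m)) ⊖ y) (sym (∑-suc m P)) (sym (∑-suc m R)) ⟩
    ∑ (suc m) P ⊕ inv k ⊗ ζ⋆ k (ones (suc m)) ⊖ ∑ (suc m) R                                ∎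
    where
    open ≡-Reasoning
    z = ζ M (suc (suc m) ∷ [])
    P R : ℕ → ℚ
    P i = ζ⋆ k (ones (i ∸ 1) ++ 2 ∷ ones (suc m ∸ i))
    R i = ζ M (suc (suc m ∸ (i ∸ 1)) ∷ []) ⊗ ζ⋆ k (ones (i ∸ 1))
    abstract
      eq₁ : ∀ a z p q r → a ⊖ z ⊕ (p ⊕ q ⊖ r) ≡ (q ⊕ p) ⊕ a ⊖ (z ⊗ 1ℚ ⊕ r)
      eq₁ = solve-∀ ring
      eq₂ : ∀ i x y z → i ⊗ (x ⊕ i ⊗ y ⊖ z) ≡ i ⊗ 1ℚ ⊗ x ⊕ i ⊗ (i ⊗ 1ℚ) ⊗ y ⊖ i ⊗ 1ℚ ⊗ z
      eq₂ = solve-∀ ring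
    swap : ∀ (f : ℕ → ℕ → ℚ) → ∑ k (λ l → ipow l 1 ⊗ ∑ m (λ i → f i l)) ≡ ∑ m (λ i → ∑ k (λ l → ipow l 1 ⊗ f i l))
    swap f = trans (∑-cong k (λ l _ → sym (∑-⊗ˡ m (ipow (suc l) 1) (λ i → f i (suc l))))) (∑-swap k m (λ l i → ipow l 1 ⊗ f i l))
    -- Summation against 1/l puts a 1 in front of each star value, except that the middle term
    -- already carries 1/l and so acquires a leading 2, the missing term `P 1`.
    recursive : ∑ k (λ l → inv l ⊗ b m l) ≡ ∑ m (λ i → P (suc i)) ⊕ P 1 ⊖ ∑ m (λ i → R (suc i))
    recursive = begin
      ∑ k (λ l → inv l ⊗ b m l)
        ≡⟨ ∑-cong k (λ l _ → trans (cong (inv (suc l) ⊗_) (b-expand m (suc l))) (eq₂ (inv (suc l)) (P′ (suc l)) (ζ⋆ (suc l) (ones m)) (R′ (suc l)))) ⟩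
      ∑ k (λ l → ipow l 1 ⊗ P′ l ⊕ ipow l 2 ⊗ ζ⋆ l (ones m) ⊖ ipow l 1 ⊗ R′ l)
        ≡⟨ trans (∑-⊖ k (λ l → ipow l 1 ⊗ P′ l ⊕ ipow l 2 ⊗ ζ⋆ l (ones m)) (λ l → ipow l 1 ⊗ R′ l)) (cong (_⊖ ∑ k (λ l → ipow l 1 ⊗ R′ l)) (∑-⊕ k (λ l → ipow l 1 ⊗ P′ l) (λ l → ipow l 2 ⊗ ζ⋆ l (ones m)))) ⟩
      ∑ k (λ l → ipow l 1 ⊗ P′ l) ⊕ P 1 ⊖ ∑ k (λ l → ipow l 1 ⊗ R′ l)
        ≡⟨ cong₂ (λ x y → x ⊕ P 1 ⊖ y) (trans (swap (λ i l → ζ⋆ l (ones (i ∸ 1) ++ 2 ∷ ones (m ∸ i)))) (∑-cong m (λ _ _ → refl))) (trans (swap (λ i l → ζ M (suc (m ∸ (i ∸ 1)) ∷ []) ⊗ ζ⋆ l (ones (i ∸ 1))))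
             (∑-cong m (λ i _ → trans (∑-cong k (λ l _ → ⊗-exchange (ipow (suc l) 1) (ζ M (suc (m ∸ i) ∷ [])) (ζ⋆ (suc l) (ones i)))) (∑-⊗ˡ k (ζ M (suc (m ∸ i) ∷ [])) (λ l → ipow l 1 ⊗ ζ⋆ l (ones i)))))) ⟩
      ∑ m (λ i → P (suc i)) ⊕ P 1 ⊖ ∑ m (λ i → R (suc i)) ∎
      where
      P′ R′ : ℕ → ℚ
      P′ l = ∑ m (λ i → ζ⋆ l (ones (i ∸ 1) ++ 2 ∷ ones (m ∸ i)))
      R′ l = ∑ m (λ i → ζ M (suc (m ∸ (i ∸ 1)) ∷ []) ⊗ ζ⋆ l (ones (i ∸ 1)))

  lhs : ℕ → ℕ → ℚ
  lhs m p = ∑ m (λ i → ζ⋆ M (suc p ∷ ones (i ∸ 1) ++ 2 ∷ ones (m ∸ i))) ⊕ ζ⋆ M (suc (suc p) ∷ ones m)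
    ⊖ ∑ m (λ i → ζ M (suc (m ∸ (i ∸ 1)) ∷ []) ⊗ ζ⋆ M (suc p ∷ ones (i ∸ 1)))

  lhs-expand : ∀ m p → lhs m p ≡ ev m 1 (Lλ p) ⊕ ev m 1 (κL p)
  lhs-expand m p = trans (sym (begin
    ∑ M (λ k → ipow k (suc p) ⊗ b m k)
      ≡⟨ ∑-cong M (λ k _ → trans (cong (ipow (suc k) (suc p) ⊗_) (b-expand m (suc k))) (eq (inv (suc k)) (ipow (suc k) p) (P (suc k)) (ζ⋆ (suc k) (ones m)) (R (suc k)))) ⟩
    ∑ M (λ k → ipow k (suc p) ⊗ P k ⊕ ipow k (suc (suc p)) ⊗ ζ⋆ k (ones m) ⊖ ipow k (suc p) ⊗ R k)
      ≡⟨ trans (∑-⊖ M (λ k → ipow k (suc p) ⊗ P k ⊕ ipow k (suc (suc p)) ⊗ ζ⋆ k (ones m)) (λ k → ipow k (suc p) ⊗ R k)) (cong (_⊖ ∑ M (λ k → ipow k (suc p) ⊗ R k)) (∑-⊕ M (λ k → ipow k (suc p) ⊗ P k) (λ k → ipow k (suc (suc p)) ⊗ ζ⋆ k (ones m)))) ⟩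
    ∑ M (λ k → ipow k (suc p) ⊗ P k) ⊕ ζ⋆ M (suc (suc p) ∷ ones m) ⊖ ∑ M (λ k → ipow k (suc p) ⊗ R k)
      ≡⟨ cong₂ (λ x y → x ⊕ ζ⋆ M (suc (suc p) ∷ ones m) ⊖ y) (swap (λ i l → ζ⋆ l (ones (i ∸ 1) ++ 2 ∷ ones (m ∸ i)))) (trans (swap (λ i l → ζ M (suc (m ∸ (i ∸ 1)) ∷ []) ⊗ ζ⋆ l (ones (i ∸ 1))))
           (∑-cong m (λ i _ → trans (∑-cong M (λ l _ → ⊗-exchange (ipow (suc l) (suc p)) (ζ M (suc (m ∸ i) ∷ [])) (ζ⋆ (suc l) (ones i)))) (∑-⊗ˡ M (ζ M (suc (m ∸ i) ∷ [])) (λ l → ipow l (suc p) ⊗ ζ⋆ l (ones i)))))) ⟩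
    lhs m p ∎)) (∑-b m p)
    where
    open ≡-Reasoning
    P R : ℕ → ℚ
    P k = ∑ m (λ i → ζ⋆ k (ones (i ∸ 1) ++ 2 ∷ ones (m ∸ i)))
    R k = ∑ m (λ i → ζ M (suc (m ∸ (i ∸ 1)) ∷ []) ⊗ ζ⋆ k (ones (i ∸ 1)))
    abstract
      eq : ∀ i a x y z → i ⊗ a ⊗ (x ⊕ i ⊗ y ⊖ z) ≡ i ⊗ a ⊗ x ⊕ i ⊗ (i ⊗ a) ⊗ y ⊖ i ⊗ a ⊗ z
      eq = solve-∀ ring
    swap : ∀ (f : ℕ → ℕ → ℚ) → ∑ M (λ l → ipow l (suc p) ⊗ ∑ m (λ i → f i l)) ≡ ∑ m (λ i → ∑ M (λ l → ipow l (suc p) ⊗ f i l))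
    swap f = trans (∑-cong M (λ l _ → sym (∑-⊗ˡ m (ipow (suc l) (suc p)) (λ i → f i (suc l))))) (∑-swap M m (λ l i → ipow l (suc p) ⊗ f i l))

open Truncation

-- Vanishing of the diagonal terms in the limit

pow-+ : ∀ x a b → pow x (a N.+ b) ≡ pow x a ⊗ pow x b
pow-+ x zero    b = sym (⊗-identityˡ (pow x b))
pow-+ x (suc a) b = trans (cong (x ⊗_) (pow-+ x a b)) (sym (⊗-assoc x (pow x a) (pow x b)))

Null-H^⊗δ : ∀ k → Null (λ M → pow (H M) k ⊗ δ M)
Null-H^⊗δ k = Null-cong (λ M → eq (inv (suc M)) (H M) (pow (H M) k)) (Null-⊕ (Null-inv-suc⊗H^ (suc k)) (Null-inv-suc⊗H^ (suc k)))
  where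
  abstract
    eq : ∀ i h p → i ⊗ (h ⊗ p) ⊕ i ⊗ (h ⊗ p) ≡ p ⊗ (i ⊗ (h ⊕ h))
    eq = solve-∀ ring

Null-κL : ∀ m r p → Null (λ M → ev M (suc m) (suc r) (κL M (suc p)))
Null-κL m r p = Null-≤ (λ M → ev-κL-nonneg M (suc m) (suc r) (suc p))
  (λ M → subst (ev M (suc m) (suc r) (κL M (suc p)) ≤_)
    (trans (sym (⊗-assoc (pow (H M) m) (pow (H M) (suc r)) (δ M))) (cong (_⊗ δ M) (sym (pow-+ (H M) m (suc r)))))
    (ev-κL≤ M m r p))
  (Null-H^⊗δ (m N.+ suc r))

Null-C⊗δ : ∀ p m k → Null (λ M → C M p m ⊗ (pow (H M) k ⊗ δ M))
Null-C⊗δ p zero    k = Null-cong (λ M → sym (⊗-zeroˡ (pow (H M) k ⊗ δ M))) Null-0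
Null-C⊗δ p (suc m) k = Null-cong
  (λ M → trans (cong (λ x → x ⊗ δ M ⊕ C M p m ⊗ (H M ⊗ pow (H M) k ⊗ δ M)) (pow-+ (H M) p k))
    (eq (pow (H M) p) (H M) (C M p m) (pow (H M) k) (δ M)))
  (Null-⊕ (Null-H^⊗δ (p N.+ k)) (Null-C⊗δ p m (suc k)))
  where
  abstract
    eq : ∀ a h C b d → a ⊗ b ⊗ d ⊕ C ⊗ (h ⊗ b ⊗ d) ≡ (a ⊕ h ⊗ C) ⊗ (b ⊗ d)
    eq = solve-∀ ring

Null-Err : ∀ p m → Null (λ M → Err M (G M p) m M)
Null-Err p m = Null-≤ (λ M → Err-nonneg M p m M NP.≤-refl)
  (λ M → ≤-trans (Err≤ M p m M NP.≤-refl) (⊗-monoˡ (C-nonneg M p m) (≤-trans (β≤δ M) (≤-reflexive (sym (⊗-identityˡ (δ M)))))))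
  (Null-C⊗δ p m 0)

-- Descent in the order of the polylogarithm

sg : ℕ → ℚ
sg zero    = 1ℚ
sg (suc k) = ⊝ sg k

sg-+ : ∀ a b → sg a ⊗ sg b ≡ sg (a N.+ b)
sg-+ zero    b = ⊗-identityˡ (sg b)
sg-+ (suc a) b = trans (eq (sg a) (sg b)) (cong ⊝_ (sg-+ a b))
  where
  abstract
    eq : ∀ x y → ⊝ x ⊗ y ≡ ⊝ (x ⊗ y)
    eq = solve-∀ ring

-- Iterates `ev-Lλ`: every step lowers the order by one, adds an `A`, flips the sign and discards a
-- null `κL` term. It stops at order 1, where the polylogarithm is `ℓ`.
ev-Lλ-asymptotic : ∀ m r q → (λ M → ev M (suc m) r (Lλ M (suc q))) ≈
  (λ M → ∑ q (λ i → sg (i ∸ 1) ⊗ ev M (suc m) (r N.+ i) (L̃ M (suc (suc q) ∸ i))) ⊕ sg q ⊗ ev M (suc m) (r N.+ q) (Lλ M 1))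
ev-Lλ-asymptotic m r zero    = ≡⇒≈ (λ M → trans (eq (ev M (suc m) r (Lλ M 1))) (cong (λ k → 0ℚ ⊕ 1ℚ ⊗ ev M (suc m) k (Lλ M 1)) (sym (NP.+-identityʳ r))))
  where
  abstract
    eq : ∀ x → x ≡ 0ℚ ⊕ 1ℚ ⊗ x
    eq = solve-∀ ring
ev-Lλ-asymptotic m r (suc q) = ≈-trans drop-error (≈-trans (≈-⊕ (≡⇒≈ (λ _ → refl)) (≈-⊗ (⊝ 1ℚ) (ev-Lλ-asymptotic m (suc r) q))) (≡⇒≈ rearrange))
  where
  abstract
    eq₁ : ∀ a x e → ⊝ 1ℚ ⊗ e ≡ a ⊖ x ⊖ e ⊖ (a ⊕ ⊝ 1ℚ ⊗ x)
    eq₁ = solve-∀ ring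
    eq₂ : ∀ a s x y → a ⊕ ⊝ 1ℚ ⊗ (s ⊕ x ⊗ y) ≡ 1ℚ ⊗ a ⊕ ⊝ 1ℚ ⊗ s ⊕ ⊝ x ⊗ y
    eq₂ = solve-∀ ring
    eq₃ : ∀ s x → ⊝ 1ℚ ⊗ (s ⊗ x) ≡ ⊝ s ⊗ x
    eq₃ = solve-∀ ring
  head : ℕ → ℚ
  head M = ev M (suc m) (suc r) (L̃ M (suc (suc q)))
  drop-error : (λ M → ev M (suc m) r (Lλ M (suc (suc q)))) ≈ (λ M → head M ⊕ ⊝ 1ℚ ⊗ ev M (suc m) (suc r) (Lλ M (suc q)))
  drop-error = Null-cong
    (λ M → trans (eq₁ (head M) (ev M (suc m) (suc r) (Lλ M (suc q))) (ev M (suc m) (suc r) (κL M (suc q))))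
      (cong (_⊖ (head M ⊕ ⊝ 1ℚ ⊗ ev M (suc m) (suc r) (Lλ M (suc q)))) (sym (ev-Lλ M (suc m) r (suc q)))))
    (Null-⊗ (⊝ 1ℚ) (Null-κL m r q))
  rearrange : ∀ M →
    head M ⊕ ⊝ 1ℚ ⊗ (∑ q (λ i → sg (i ∸ 1) ⊗ ev M (suc m) (suc r N.+ i) (L̃ M (suc (suc q) ∸ i))) ⊕ sg q ⊗ ev M (suc m) (suc r N.+ q) (Lλ M 1)) ≡
    ∑ (suc q) (λ i → sg (i ∸ 1) ⊗ ev M (suc m) (r N.+ i) (L̃ M (suc (suc (suc q)) ∸ i))) ⊕ sg (suc q) ⊗ ev M (suc m) (r N.+ suc q) (Lλ M 1)
  rearrange M = begin
    head M ⊕ ⊝ 1ℚ ⊗ (∑ q F ⊕ sg q ⊗ ev M (suc m) (suc r N.+ q) (Lλ M 1))          ≡⟨ eq₂ (head M) (∑ q F) (sg q) (ev M (suc m) (suc r N.+ q) (Lλ M 1)) ⟩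
    1ℚ ⊗ head M ⊕ ⊝ 1ℚ ⊗ ∑ q F ⊕ sg (suc q) ⊗ ev M (suc m) (suc r N.+ q) (Lλ M 1)  ≡⟨ cong₂ _⊕_ (cong₂ _⊕_ (cong (λ k → 1ℚ ⊗ ev M (suc m) k (L̃ M (suc (suc q)))) (NP.+-comm 1 r)) shift) (cong (λ k → sg (suc q) ⊗ ev M (suc m) k (Lλ M 1)) (sym (NP.+-suc r q))) ⟩
    F′ 1 ⊕ ∑ q (λ i → F′ (suc i)) ⊕ sg (suc q) ⊗ ev M (suc m) (r N.+ suc q) (Lλ M 1)  ≡⟨ cong (_⊕ sg (suc q) ⊗ ev M (suc m) (r N.+ suc q) (Lλ M 1)) (sym (∑-suc q F′)) ⟩
    ∑ (suc q) F′ ⊕ sg (suc q) ⊗ ev M (suc m) (r N.+ suc q) (Lλ M 1)                ∎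
    where
    open ≡-Reasoning
    F F′ : ℕ → ℚ
    F i = sg (i ∸ 1) ⊗ ev M (suc m) (suc r N.+ i) (L̃ M (suc (suc q) ∸ i))
    F′ i = sg (i ∸ 1) ⊗ ev M (suc m) (r N.+ i) (L̃ M (suc (suc (suc q)) ∸ i))
    shift : ⊝ 1ℚ ⊗ ∑ q F ≡ ∑ q (λ i → F′ (suc i))
    shift = trans (sym (∑-⊗ˡ q (⊝ 1ℚ) F)) (∑-cong q (λ i _ → trans
      (eq₃ (sg i) (ev M (suc m) (suc r N.+ suc i) (L̃ M (suc q ∸ i))))
      (cong (λ k → ⊝ sg i ⊗ ev M (suc m) k (L̃ M (suc q ∸ i))) (sym (NP.+-suc r (suc i))))))

ev-L̃-expand : ∀ M m r q → ev M m r (L̃ M (suc q)) ≡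
  ∑ q (λ j → sg (j ∸ 1) ⊗ (ζ M (suc (suc q) ∸ j ∷ []) ⊗ ev M m (r N.+ (j ∸ 1)) one)) ⊕ sg q ⊗ ev M m (r N.+ q) (ℓ M)
ev-L̃-expand M m r zero    = trans (ev-cong M m r (L̃-1 M)) (trans (eq (ev M m r (ℓ M))) (cong (λ k → 0ℚ ⊕ 1ℚ ⊗ ev M m k (ℓ M)) (sym (NP.+-identityʳ r))))
  where
  abstract
    eq : ∀ x → x ≡ 0ℚ ⊕ 1ℚ ⊗ x
    eq = solve-∀ ring
ev-L̃-expand M m r (suc q) = begin
  ev M m r (L̃ M (suc (suc q)))                                                       ≡⟨ ev-L̃ M m r (suc q) ⟩
  z ⊗ ev M m r one ⊖ ev M m (suc r) (L̃ M (suc q))                                ≡⟨ cong (z ⊗ ev M m r one ⊖_) (ev-L̃-expand M m (suc r) q) ⟩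
  z ⊗ ev M m r one ⊖ (∑ q F ⊕ sg q ⊗ ev M m (suc r N.+ q) (ℓ M))                 ≡⟨ eq₂ (z ⊗ ev M m r one) (∑ q F) (sg q) (ev M m (suc r N.+ q) (ℓ M)) ⟩
  1ℚ ⊗ (z ⊗ ev M m r one) ⊕ ⊝ 1ℚ ⊗ ∑ q F ⊕ sg (suc q) ⊗ ev M m (suc r N.+ q) (ℓ M)  ≡⟨ cong₂ _⊕_ (cong₂ _⊕_ (cong (λ k → 1ℚ ⊗ (z ⊗ ev M m k one)) (sym (NP.+-identityʳ r))) shift) (cong (λ k → sg (suc q) ⊗ ev M m k (ℓ M)) (sym (NP.+-suc r q))) ⟩
  F′ 1 ⊕ ∑ q (λ j → F′ (suc j)) ⊕ sg (suc q) ⊗ ev M m (r N.+ suc q) (ℓ M)            ≡⟨ cong (_⊕ sg (suc q) ⊗ ev M m (r N.+ suc q) (ℓ M)) (sym (∑-suc q F′)) ⟩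
  ∑ (suc q) F′ ⊕ sg (suc q) ⊗ ev M m (r N.+ suc q) (ℓ M)                             ∎
  where
  open ≡-Reasoning
  z = ζ M (suc (suc q) ∷ [])
  F F′ : ℕ → ℚ
  F j = sg (j ∸ 1) ⊗ (ζ M (suc (suc q) ∸ j ∷ []) ⊗ ev M m (suc r N.+ (j ∸ 1)) one)
  F′ j = sg (j ∸ 1) ⊗ (ζ M (suc (suc (suc q)) ∸ j ∷ []) ⊗ ev M m (r N.+ (j ∸ 1)) one)
  abstract
    eq₂ : ∀ a s x y → a ⊖ (s ⊕ x ⊗ y) ≡ 1ℚ ⊗ a ⊕ ⊝ 1ℚ ⊗ s ⊕ ⊝ x ⊗ y
    eq₂ = solve-∀ ring
    eq₃ : ∀ s x → ⊝ 1ℚ ⊗ (s ⊗ x) ≡ ⊝ s ⊗ x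
    eq₃ = solve-∀ ring
  shift : ⊝ 1ℚ ⊗ ∑ q F ≡ ∑ q (λ j → F′ (suc j))
  shift = trans (sym (∑-⊗ˡ q (⊝ 1ℚ) F)) (∑-cong q (λ j _ → trans
    (eq₃ (sg j) (ζ M (suc q ∸ j ∷ []) ⊗ ev M m (suc r N.+ j) one))
    (cong (λ k → ⊝ sg j ⊗ (ζ M (suc q ∸ j ∷ []) ⊗ ev M m k one)) (sym (NP.+-suc r j)))))

doubleSum : ℕ → ℕ → ℕ → ℚ
doubleSum M m q = ∑ q (λ i → ∑ (suc q ∸ i) (λ j → sg (i N.+ j) ⊗ ζ M (suc q N.+ 2 ∸ i ∸ j ∷ []) ⊗ ζ M (suc m ∷ ones (i N.+ j ∸ 1))))

-- Row i has already consumed i letters and signs, and its own expansion consumes the remaining q -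
-- i. So all rows end in the same multiple of the same `ℓ` term, which occurs q times.
∑-ev-L̃ : ∀ M m q → ∑ q (λ i → sg (i ∸ 1) ⊗ ev M m (1 N.+ i) (L̃ M (suc (suc q) ∸ i))) ≡
  doubleSum M m q ⊕ ι q ⊗ (sg q ⊗ ev M m (suc (suc q)) (ℓ M))
∑-ev-L̃ M m q = begin
  ∑ q (λ i → sg (i ∸ 1) ⊗ ev M m (1 N.+ i) (L̃ M (suc (suc q) ∸ i)))   ≡⟨ ∑-cong q row ⟩
  ∑ q (λ i → ∑ (suc q ∸ i) (λ j → F i j) ⊕ E)                          ≡⟨ ∑-⊕ q (λ i → ∑ (suc q ∸ i) (λ j → F i j)) (λ _ → E) ⟩
  doubleSum M m q ⊕ ∑ q (λ _ → E)                                         ≡⟨ cong (doubleSum M m q ⊕_) (∑-const q E) ⟩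
  doubleSum M m q ⊕ ι q ⊗ E                                               ∎
  where
  open ≡-Reasoning
  E = sg q ⊗ ev M m (suc (suc q)) (ℓ M)
  F : ℕ → ℕ → ℚ
  F i j = sg (i N.+ j) ⊗ ζ M (suc q N.+ 2 ∸ i ∸ j ∷ []) ⊗ ζ M (suc m ∷ ones (i N.+ j ∸ 1))
  abstract
    eq₁ : ∀ s t x y → s ⊗ (t ⊗ (x ⊗ y)) ≡ s ⊗ t ⊗ x ⊗ y
    eq₁ = solve-∀ ring
    eq₂ : ∀ x → x ≡ ⊝ ⊝ x
    eq₂ = solve-∀ ring
  row : ∀ i → i N.< q → sg i ⊗ ev M m (suc (suc i)) (L̃ M (suc q ∸ i)) ≡ ∑ (q ∸ i) (F (suc i)) ⊕ E
  row i i<q = begin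
    sg i ⊗ ev M m (suc (suc i)) (L̃ M (suc q ∸ i))                      ≡⟨ cong (λ k → sg i ⊗ ev M m (suc (suc i)) (L̃ M k)) (NP.+-∸-assoc 1 i≤q) ⟩
    sg i ⊗ ev M m (suc (suc i)) (L̃ M (suc (q ∸ i)))                    ≡⟨ cong (sg i ⊗_) (ev-L̃-expand M m (suc (suc i)) (q ∸ i)) ⟩
    sg i ⊗ (∑ (q ∸ i) F′ ⊕ sg (q ∸ i) ⊗ e (suc (suc i) N.+ (q ∸ i)))    ≡⟨ ⊗-distribˡ (sg i) (∑ (q ∸ i) F′) (sg (q ∸ i) ⊗ e (suc (suc i) N.+ (q ∸ i))) ⟩
    sg i ⊗ ∑ (q ∸ i) F′ ⊕ sg i ⊗ (sg (q ∸ i) ⊗ e (suc (suc i) N.+ (q ∸ i)))  ≡⟨ cong₂ _⊕_ (trans (sym (∑-⊗ˡ (q ∸ i) (sg i) F′)) (∑-cong (q ∸ i) (λ j _ → entry j))) constant ⟩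
    ∑ (q ∸ i) (F (suc i)) ⊕ E                                           ∎
    where
    i≤q : i N.≤ q
    i≤q = NP.<⇒≤ i<q
    e : ℕ → ℚ
    e k = ev M m k (ℓ M)
    F′ : ℕ → ℚ
    F′ j = sg (j ∸ 1) ⊗ (ζ M (suc (suc (q ∸ i)) ∸ j ∷ []) ⊗ ev M m (suc (suc i) N.+ (j ∸ 1)) one)
    constant : sg i ⊗ (sg (q ∸ i) ⊗ e (suc (suc i) N.+ (q ∸ i))) ≡ E
    constant = begin
      sg i ⊗ (sg (q ∸ i) ⊗ e (suc (suc i) N.+ (q ∸ i)))   ≡⟨ sym (⊗-assoc (sg i) (sg (q ∸ i)) (e (suc (suc i) N.+ (q ∸ i)))) ⟩
      sg i ⊗ sg (q ∸ i) ⊗ e (suc (suc i) N.+ (q ∸ i))     ≡⟨ cong (_⊗ e (suc (suc i) N.+ (q ∸ i))) (sg-+ i (q ∸ i)) ⟩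
      sg (i N.+ (q ∸ i)) ⊗ e (suc (suc (i N.+ (q ∸ i))))  ≡⟨ cong (λ k → sg k ⊗ e (suc (suc k))) (NP.m+[n∸m]≡n i≤q) ⟩
      E                                                   ∎
    entry : ∀ j → sg i ⊗ F′ (suc j) ≡ F (suc i) (suc j)
    entry j = begin
      sg i ⊗ (sg j ⊗ (ζ M (suc (q ∸ i) ∸ j ∷ []) ⊗ ev M m (suc (suc i N.+ j)) one))   ≡⟨ eq₁ (sg i) (sg j) _ _ ⟩
      sg i ⊗ sg j ⊗ ζ M (suc (q ∸ i) ∸ j ∷ []) ⊗ ev M m (suc (suc i N.+ j)) one       ≡⟨ cong₂ _⊗_ (cong₂ (λ x k → x ⊗ ζ M (k ∸ suc j ∷ [])) sign index) value ⟩
      F (suc i) (suc j)                                                                   ∎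
      where
      -- Both indices are shifted by one, and the two sign changes cancel.
      sign : sg i ⊗ sg j ≡ sg (suc i N.+ suc j)
      sign = trans (sg-+ i j) (trans (eq₂ (sg (i N.+ j))) (cong (λ k → sg (suc k)) (sym (NP.+-suc i j))))
      index : suc (suc (q ∸ i)) ≡ q N.+ 2 ∸ i
      index = trans (NP.+-comm 2 (q ∸ i)) (sym (NP.+-∸-comm 2 i≤q))
      value : ev M m (suc (suc i N.+ j)) one ≡ ζ M (suc m ∷ ones (suc i N.+ suc j ∸ 1))
      value = trans (ev-one M m (suc i N.+ j)) (cong₂ (λ s k → ζ M (s ∷ ones k)) (NP.+-comm m 1) (sym (NP.+-suc i j)))

-- Comparison of the two sides

rhs : ℕ → ℕ → ℕ → ℚ
rhs M m q = doubleSum M m q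
  ⊕ sg (suc (suc q)) ⊗ ι (suc q N.* suc m) ⊗ ζ M (m N.+ 2 ∷ ones (suc q))
  ⊕ sg (suc (suc q)) ⊗ ι (suc q) ⊗ ∑ (suc q) (λ i → ζ M (suc m ∷ ones (i ∸ 1) ++ 2 ∷ ones (q ∸ (i ∸ 1))))
  ⊖ sg (suc (suc q)) ⊗ ζ M (suc m ∷ ones q ++ 2 ∷ [])

-- With p = q + 1 there are p words containing `ℓ`: q from the rows of the double sum and one from
-- `Lλ 1`. In each, `ℓ` passing the letters `B` gives m copies of `top`, and the insertion in front
-- of the letters `A` gives one more, whence p(m+1). Each also gives one `S`; only the word from
-- `Lλ 1` lacks `last`.
lhs≈rhs : ∀ m q → (λ M → lhs M (suc m) (suc q)) ≈ (λ M → rhs M (suc m) q)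
lhs≈rhs m′ q = ≈-trans (≡⇒≈ (λ M → lhs-expand M m (suc q))) (≈-trans
  (≈-⊕ (ev-Lλ-asymptotic m′ 1 q) (Null-cong (λ M → eq₀ (ev M m 1 (κL M (suc q)))) (Null-κL m′ 0 q)))
  -- Each of the p words also carries one `⊝ Err` with sign `sg q`, which explains the constant.
  (Null-cong final (Null-⊗ (sg q ⊗ ι (suc q) ⊗ ⊝ 1ℚ) (Null-Err (suc q) m))))
  where
  m = suc m′
  abstract
    eq₀ : ∀ x → x ≡ x ⊖ 0ℚ
    eq₀ = solve-∀ ring
    eq₁ : ∀ r s k e → s ⊗ k ⊗ ⊝ 1ℚ ⊗ e ≡ r ⊖ s ⊗ k ⊗ e ⊖ r
    eq₁ = solve-∀ ring
    eq₂ : ∀ d k s i t S l e →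
      d ⊕ ⊝ ⊝ s ⊗ ((k ⊕ 1ℚ) ⊗ (i ⊕ 1ℚ)) ⊗ t ⊕ ⊝ ⊝ s ⊗ (k ⊕ 1ℚ) ⊗ S ⊖ ⊝ ⊝ s ⊗ l ⊖ s ⊗ (k ⊕ 1ℚ) ⊗ e ≡
      d ⊕ k ⊗ (s ⊗ (i ⊗ t ⊖ e ⊕ (t ⊕ S))) ⊕ s ⊗ (i ⊗ t ⊖ e ⊕ (t ⊕ S ⊖ l)) ⊕ 0ℚ
    eq₂ = solve-∀ ring
  final : ∀ M → sg q ⊗ ι (suc q) ⊗ ⊝ 1ℚ ⊗ Err M (G M (suc q)) m M ≡
    ∑ q (λ i → sg (i ∸ 1) ⊗ ev M m (1 N.+ i) (L̃ M (suc (suc q) ∸ i))) ⊕ sg q ⊗ ev M m (1 N.+ q) (Lλ M 1) ⊕ 0ℚ ⊖ rhs M m q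
  final M = begin
    sg q ⊗ ι (suc q) ⊗ ⊝ 1ℚ ⊗ e                                     ≡⟨ eq₁ (rhs M m q) (sg q) (ι (suc q)) e ⟩
    rhs M m q ⊖ sg q ⊗ ι (suc q) ⊗ e ⊖ rhs M m q                    ≡⟨ cong (_⊖ rhs M m q) sums ⟩
    ∑ q (λ i → sg (i ∸ 1) ⊗ ev M m (1 N.+ i) (L̃ M (suc (suc q) ∸ i))) ⊕ sg q ⊗ ev M m (1 N.+ q) (Lλ M 1) ⊕ 0ℚ ⊖ rhs M m q ∎
    where
    open ≡-Reasoning
    d e t s l : ℚ
    d = doubleSum M m q
    e = Err M (G M (suc q)) m M
    t = top M m (suc q)
    s = S M m (suc q)
    l = last M m q
    sums : rhs M m q ⊖ sg q ⊗ ι (suc q) ⊗ e ≡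
      ∑ q (λ i → sg (i ∸ 1) ⊗ ev M m (1 N.+ i) (L̃ M (suc (suc q) ∸ i))) ⊕ sg q ⊗ ev M m (1 N.+ q) (Lλ M 1) ⊕ 0ℚ
    sums = begin
      rhs M m q ⊖ sg q ⊗ ι (suc q) ⊗ e
        ≡⟨ cong₂ (λ x y → d ⊕ ⊝ ⊝ sg q ⊗ ι (suc q N.* suc m) ⊗ t ⊕ ⊝ ⊝ sg q ⊗ ι (suc q) ⊗ x ⊖ ⊝ ⊝ sg q ⊗ y ⊖ sg q ⊗ ι (suc q) ⊗ e)
             (∑-cong (suc q) (λ i _ → cong (λ k → ζ M (k ∷ ones i ++ 2 ∷ ones (q ∸ i))) (NP.+-comm 1 m)))
             (cong (λ k → ζ M (k ∷ ones q ++ 2 ∷ [])) (NP.+-comm 1 m)) ⟩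
      d ⊕ ⊝ ⊝ sg q ⊗ ι (suc q N.* suc m) ⊗ t ⊕ ⊝ ⊝ sg q ⊗ ι (suc q) ⊗ s ⊖ ⊝ ⊝ sg q ⊗ l ⊖ sg q ⊗ ι (suc q) ⊗ e
        ≡⟨ cong₂ (λ x y → d ⊕ ⊝ ⊝ sg q ⊗ x ⊗ t ⊕ ⊝ ⊝ sg q ⊗ y ⊗ s ⊖ ⊝ ⊝ sg q ⊗ l ⊖ sg q ⊗ y ⊗ e)
             (trans (ι-* (suc q) (suc m)) (cong₂ _⊗_ (ι-suc q) (ι-suc m))) (ι-suc q) ⟩
      d ⊕ ⊝ ⊝ sg q ⊗ ((ι q ⊕ 1ℚ) ⊗ (ι m ⊕ 1ℚ)) ⊗ t ⊕ ⊝ ⊝ sg q ⊗ (ι q ⊕ 1ℚ) ⊗ s ⊖ ⊝ ⊝ sg q ⊗ l ⊖ sg q ⊗ (ι q ⊕ 1ℚ) ⊗ e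
        ≡⟨ eq₂ d (ι q) (sg q) (ι m) t s l e ⟩
      d ⊕ ι q ⊗ (sg q ⊗ (ι m ⊗ t ⊖ e ⊕ (t ⊕ s))) ⊕ sg q ⊗ (ι m ⊗ t ⊖ e ⊕ (t ⊕ s ⊖ l)) ⊕ 0ℚ
        ≡⟨ cong (λ x → d ⊕ ι q ⊗ (sg q ⊗ (x ⊕ (t ⊕ s))) ⊕ sg q ⊗ (x ⊕ (t ⊕ s ⊖ l)) ⊕ 0ℚ) (sym (iterB-ℓG M m (suc q))) ⟩
      d ⊕ ι q ⊗ (sg q ⊗ (I ⊕ (t ⊕ s))) ⊕ sg q ⊗ (I ⊕ (t ⊕ s ⊖ l)) ⊕ 0ℚ
        ≡⟨ cong₂ (λ x y → d ⊕ ι q ⊗ (sg q ⊗ x) ⊕ sg q ⊗ y ⊕ 0ℚ) (sym (ev-ℓ M m (suc q))) (sym (ev-Lλ-1 M m q)) ⟩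
      d ⊕ ι q ⊗ (sg q ⊗ ev M m (suc (suc q)) (ℓ M)) ⊕ sg q ⊗ ev M m (suc q) (Lλ M 1) ⊕ 0ℚ
        ≡⟨ cong (λ x → x ⊕ sg q ⊗ ev M m (suc q) (Lλ M 1) ⊕ 0ℚ) (sym (∑-ev-L̃ M m q)) ⟩
      ∑ q (λ i → sg (i ∸ 1) ⊗ ev M m (1 N.+ i) (L̃ M (suc (suc q) ∸ i))) ⊕ sg q ⊗ ev M m (1 N.+ q) (Lλ M 1) ⊕ 0ℚ ∎
      where
      I : ℚ
      I = iter (B M) m (λ i → ℓ M i ⊗ G M (suc q) i) M

-- Return to the definitions of the statement

abstract
  +≡⊕ : ∀ {a a′ b b′} → a ≡ a′ → b ≡ b′ → a Q.+ b ≡ a′ ⊕ b′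
  +≡⊕ p q = cong₂ Q._+_ p q

  *≡⊗ : ∀ {a a′ b b′} → a ≡ a′ → b ≡ b′ → a Q.* b ≡ a′ ⊗ b′
  *≡⊗ p q = cong₂ Q._*_ p q

  -≡⊖ : ∀ {a a′ b b′} → a ≡ a′ → b ≡ b′ → a Q.- b ≡ a′ ⊖ b′
  -≡⊖ p q = cong₂ Q._-_ p q

  ℕ→ℚ≡ι : ∀ n → ℕ→ℚ n ≡ ι n
  ℕ→ℚ≡ι n = refl

  sgn≡sg : ∀ k → sgn k ≡ sg k
  sgn≡sg zero    = refl
  sgn≡sg (suc k) = cong Q.-_ (sgn≡sg k)

  invPow≡ipow : ∀ n s → invPow (suc n) s ≡ ipow (suc n) s
  invPow≡ipow n zero    = refl
  invPow≡ipow n (suc s) = cong (inv (suc n) Q.*_) (invPow≡ipow n s)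

Σ1≡∑ : ∀ n {f g : ℕ → ℚ} → (∀ i → f (suc i) ≡ g (suc i)) → Σ1 n f ≡ ∑ n g
Σ1≡∑ zero    h = refl
Σ1≡∑ (suc n) h = +≡⊕ (Σ1≡∑ n h) (h n)

-- The local function of ΣR cannot be named: checking the first clause fills in
-- the left-hand side of the second statement.
mutual
  ΣR≡∑ : ∀ a b {f g : ℕ → ℚ} → (∀ i → f (a N.+ i) ≡ g (suc i)) → ΣR a b f ≡ ∑ (suc b ∸ a) g
  ΣR≡∑ a b {f} {g} h with suc b ∸ a
  ... | n = ΣR-go≡∑ a b f g h n

  ΣR-go≡∑ : ∀ a b (f g : ℕ → ℚ) → (∀ i → f (a N.+ i) ≡ g (suc i)) → ∀ n → _ ≡ ∑ n g
  ΣR-go≡∑ a b f g h zero    = refl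
  ΣR-go≡∑ a b f g h (suc n) = +≡⊕ (ΣR-go≡∑ a b f g h n) (h n)

ζN≡ζ : ∀ n ss → ζN n ss ≡ ζ n ss
ζN≡ζ n []       = refl
ζN≡ζ n (s ∷ ss) = Σ1≡∑ n (λ k → *≡⊗ (invPow≡ipow k s) (ζN≡ζ k ss))

ζ⋆N≡ζ⋆ : ∀ n ss → ζ⋆N n ss ≡ ζ⋆ n ss
ζ⋆N≡ζ⋆ n []       = refl
ζ⋆N≡ζ⋆ n (s ∷ ss) = Σ1≡∑ n (λ k → *≡⊗ (invPow≡ipow k s) (ζ⋆N≡ζ⋆ (suc k) ss))

open Q using (_+_; _-_; _*_)

left right : ℕ → ℕ → ℕ → ℚ
left N p m = ΣR 1 m (λ i → ζ⋆N N (N.suc p ∷ (ones (i ∸ 1) ++ (2 ∷ ones (m ∸ i))))) + ζ⋆N N (p N.+ 2 ∷ ones m) - ΣR 0 (m ∸ 1) (λ i → ζN N (m ∸ i N.+ 1 ∷ []) * ζ⋆N N (N.suc p ∷ ones i))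
right N p m = ΣR 1 (p ∸ 1) (λ i → ΣR 1 (p ∸ i) (λ j → sgn (i N.+ j) * ζN N (p N.+ 2 ∸ i ∸ j ∷ []) * ζN N (N.suc m ∷ ones (i N.+ j ∸ 1)))) + sgn (N.suc p) * ℕ→ℚ (p N.* N.suc m) * ζN N (m N.+ 2 ∷ ones p) + sgn (N.suc p) * ℕ→ℚ p * ΣR 0 (p ∸ 1) (λ i → ζN N (N.suc m ∷ (ones i ++ (2 ∷ ones (p ∸ 1 ∸ i))))) - sgn (N.suc p) * ζN N (N.suc m ∷ (ones (p ∸ 1) ++ (2 ∷ [])))

left≡lhs : ∀ N q m → left N (suc q) (suc m) ≡ lhs N (suc m) (suc q)
left≡lhs N q m = -≡⊖
  (+≡⊕
    (ΣR≡∑ 1 (suc m) (λ i → ζ⋆N≡ζ⋆ N (suc (suc q) ∷ (ones i ++ (2 ∷ ones (m ∸ i))))))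
    (trans (ζ⋆N≡ζ⋆ N (suc q N.+ 2 ∷ ones (suc m))) (cong (λ k → ζ⋆ N (suc k ∷ ones (suc m))) (NP.+-comm q 2))))
  (ΣR≡∑ 0 m (λ i → *≡⊗
    (trans (ζN≡ζ N (suc m ∸ i N.+ 1 ∷ [])) (cong (λ k → ζ N (k ∷ [])) (NP.+-comm (suc m ∸ i) 1)))
    (ζ⋆N≡ζ⋆ N (suc (suc q) ∷ ones i))))

right≡rhs : ∀ N q m → right N (suc q) (suc m) ≡ rhs N (suc m) q
right≡rhs N q m = -≡⊖
  (+≡⊕
    (+≡⊕
      (ΣR≡∑ 1 q (λ i → ΣR≡∑ 1 (q ∸ i) (λ j → *≡⊗
        (*≡⊗ (sgn≡sg (suc i N.+ suc j)) (ζN≡ζ N (suc q N.+ 2 ∸ suc i ∸ suc j ∷ [])))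
        (ζN≡ζ N (suc (suc m) ∷ ones (suc i N.+ suc j ∸ 1))))))
      (*≡⊗ (*≡⊗ (sgn≡sg (suc (suc q))) (ℕ→ℚ≡ι (suc q N.* suc (suc m)))) (ζN≡ζ N (suc m N.+ 2 ∷ ones (suc q)))))
    (*≡⊗ (*≡⊗ (sgn≡sg (suc (suc q))) (ℕ→ℚ≡ι (suc q)))
      (ΣR≡∑ 0 q (λ i → ζN≡ζ N (suc (suc m) ∷ (ones i ++ (2 ∷ ones (q ∸ i))))))))
  (*≡⊗ (sgn≡sg (suc (suc q))) (ζN≡ζ N (suc (suc m) ∷ (ones q ++ (2 ∷ [])))))

difference : ℕ → ℕ → ℕ → ℚ
difference p m N = left N p m - right N p m

Null-difference : ∀ p m → p ≥ 1 → m ≥ 1 → Null (difference p m)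
Null-difference (suc q) (suc m) _ _ = Null-cong (λ N → sym (-≡⊖ (left≡lhs N q m) (right≡rhs N q m))) (lhs≈rhs m q)

Null⇒< : ∀ {f} → Null f → ∀ ε → 0ℚ < ε → ∃ λ N₀ → ∀ N → N ≥ N₀ → ∣ f N ∣ < ε
Null⇒< null ε 0<ε with null (½ ⊗ ε) (½⊗-pos 0<ε)
... | N₀ , bound = N₀ , λ N N≥N₀ → ≤-<-trans (bound N N≥N₀) (½⊗-< 0<ε)

theorem3p3 : (p m : ℕ) → p ≥ 1 → m ≥ 1 → (ε : ℚ) → 0ℚ < ε → ∃ λ N₀ → (N : ℕ) → N ≥ N₀ → ∣ ((ΣR 1 m (λ i → ζ⋆N N (N.suc p ∷ (ones (i ∸ 1) ++ (2 ∷ ones (m ∸ i))))) + ζ⋆N N (p N.+ 2 ∷ ones m) - ΣR 0 (m ∸ 1) (λ i → ζN N (m ∸ i N.+ 1 ∷ []) * ζ⋆N N (N.suc p ∷ ones i))) - (ΣR 1 (p ∸ 1) (λ i → ΣR 1 (p ∸ i) (λ j → sgn (i N.+ j) * ζN N (p N.+ 2 ∸ i ∸ j ∷ []) * ζN N (N.suc m ∷ ones (i N.+ j ∸ 1)))) + sgn (N.suc p) * ℕ→ℚ (p N.* N.suc m) * ζN N (m N.+ 2 ∷ ones p) + sgn (N.suc p) * ℕ→ℚ p * ΣR 0 (p ∸ 1) (λ i → ζN N (N.suc m ∷ (ones i ++ (2 ∷ ones (p ∸ 1 ∸ i))))) - sgn (N.suc p) * ζN N (N.suc m ∷ (ones (p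 ∸ 1) ++ (2 ∷ []))))) ∣ < ε
theorem3p3 p m p≥1 m≥1 = Null⇒< {difference p m} (Null-difference p m p≥1 m≥1)
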